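{- Let $n$ and $q$ be integers with $0\le q\le n-4$. Among all trees on $n$ vertices with exactly $q$ vertices of degree two, $BS_{n,n-1-q}$ is the unique tree having maximal Harary index.
   Context: The Harary index of a connected graph $G$ is $H(G)=\sum_{\{x,y\}\subseteq V(G),\,x\ne y}\frac{1}{d(x,y)}$, $d$ the shortest-path distance. For $2\le k\le n-1$, $BS_{n,k}$ is the balanced starlike tree: the tree on $n$ vertices consisting of a vertex $v$ such that removing $v$ leaves $k$ disjoint paths with $n_1,\dots,n_k$ vertices ($n_1+\dots+n_k=n-1$, $|n_i-n_j|\le 1$ for all $i,j$), $v$ being adjacent to an endvertex of each path. -}

module Defs where

open import Data.Bool using (Bool; true; false; _∧_; _∨_; if_then_else_)
open import Data.Nat using (ℕ; zero; suc; _+_; _≤_; _≡ᵇ_; _<ᵇ_; _≤ᵇ_)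
open import Data.Fin using (Fin; toℕ)
import Data.Fin as F
open import Data.List using (List; []; _∷_; [_]; _++_; length; allFin; map; foldr; concatMap)
open import Data.Bool.ListAction using (any)
open import Data.Nat.ListAction using (sum)
open import Data.List.Relation.Unary.Unique.Propositional using (Unique)
open import Data.Product using (Σ; ∃; _×_)
open import Data.Unit using (⊤)
open import Data.Empty using (⊥)
open import Relation.Nullary.Decidable using (isYes)
open import Relation.Binary.PropositionalEquality using (_≡_)
open import Function.Bundles using (Bijection; _⤖_)
open import Data.Rational using (ℚ; 0ℚ; _/_) renaming (_+_ to _+ℚ_)
open import Data.Integer using (+_)

Graph : ℕ → Set
Graph n = Fin n → Fin n → Bool

IsSimple : ∀ {n} → Graph n → Set
IsSimple {n} G = (∀ x y → G x y ≡ G y x) × (∀ x → G x x ≡ false)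

reach : ∀ {n} → Graph n → ℕ → Fin n → Fin n → Bool
reach G zero    x y = isYes (x F.≟ y)
reach {n} G (suc k) x y = reach G k x y ∨ any (λ z → G x z ∧ reach G k z y) (allFin n)

Connected : ∀ {n} → Graph n → Set
Connected G = ∀ x y → ∃ λ k → reach G k x y ≡ true

Chain : ∀ {n} → Graph n → List (Fin n) → Set
Chain G []           = ⊤
Chain G (x ∷ [])     = ⊤
Chain G (x ∷ y ∷ r)  = (G x y ≡ true) × Chain G (y ∷ r)

HasCycle : ∀ {n} → Graph n → Set
HasCycle {n} G = Σ (Fin n) λ x → Σ (List (Fin n)) λ r →
  (2 ≤ length r) × Unique (x ∷ r) × Chain G ((x ∷ r) ++ [ x ])

Acyclic : ∀ {n} → Graph n → Set
Acyclic G = HasCycle G → ⊥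

IsTree : ∀ {n} → Graph n → Set
IsTree G = IsSimple G × Connected G × Acyclic G

-- least i < b with p i (b if none)
least : (ℕ → Bool) → ℕ → ℕ
least p zero    = zero
least p (suc b) = if p zero then zero else suc (least (λ i → p (suc i)) b)

-- shortest-path distance (for connected graphs on n vertices it is < n)
dist : ∀ {n} → Graph n → Fin n → Fin n → ℕ
dist {n} G x y = least (λ k → reach G k x y) n

inv : ℕ → ℚ
inv zero    = 0ℚ
inv (suc k) = + 1 / suc k

sumℚ : List ℚ → ℚ
sumℚ = foldr _+ℚ_ 0ℚ

harary : ∀ {n} → Graph n → ℚ
harary {n} G = sumℚ (concatMap (λ x → map (λ y → if toℕ x <ᵇ toℕ y then inv (dist G x y) else 0ℚ) (allFin n)) (allFin n))

degree : ∀ {n} → Graph n → Fin n → ℕ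
degree {n} G x = sum (map (λ y → if G x y then 1 else 0) (allFin n))

numDeg2 : ∀ {n} → Graph n → ℕ
numDeg2 {n} G = sum (map (λ x → if degree G x ≡ᵇ 2 then 1 else 0) (allFin n))

-- Balanced starlike tree BS_{n,k}: vertex 0 is the centre; vertex i ≥ 1 lies on
-- path (i-1) mod k at position (i-1) div k. Edges: 0 — i for 1 ≤ i ≤ k, and
-- i — i+k for i ≥ 1. The k path sizes differ by at most one.
bsEdge : ℕ → ℕ → ℕ → Bool
bsEdge k x y = ((x ≡ᵇ 0) ∧ (1 ≤ᵇ y) ∧ (y ≤ᵇ k)) ∨ ((1 ≤ᵇ x) ∧ (x + k ≡ᵇ y))

BS : (n k : ℕ) → Graph n
BS n k x y = bsEdge k (toℕ x) (toℕ y) ∨ bsEdge k (toℕ y) (toℕ x)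

_≅_ : ∀ {n} → Graph n → Graph n → Set
_≅_ {n} G H = Σ (Fin n ⤖ Fin n) λ f →
  ∀ x y → G x y ≡ H (Bijection.to f x) (Bijection.to f y)

{-# OPTIONS --safe #-}
module Submission where

-- Put k = n − 1 − q. By the handshake lemma a tree with exactly q ≤ n − 4 vertices of degree two
-- has at most k leaves, so, rooted at a leaf, it is obtained from the root by successively
-- attaching at most k − 1 paths to vertices already present. After j paths every sphere has at
-- most j + 1 elements. Hence a path attached at u contributes at most what it would contribute
-- when attached to the centre of the balanced starlike tree with j + 1 branches on the vertices
-- present, whose spheres about the centre are filled greedily from the inside. Induction on j
-- bounds the index of the tree by that of a starlike tree all of whose branches but one are
-- balanced, and deleting the last vertex of a longest branch of the latter shows, again by the
-- greedy bound, that it is at most the index of the balanced starlike tree. In case of equality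
-- the last attachment vertex u has degree k, so by the handshake lemma all other vertices have
-- degree at most two, and the sizes of the spheres about u force the branches to be balanced.

open import Defs
open import Data.Bool as Bool using (Bool; true; false; T; _∧_; _∨_; if_then_else_)
open import Data.Bool.ListAction using (any)
open import Data.Bool.Properties using (T-≡)
open import Data.Empty using (⊥; ⊥-elim)
open import Data.Fin as Fin using (Fin; toℕ; fromℕ<; zero; suc)
import Data.Fin.Properties as Fin
import Data.Integer as ℤ
open import Data.List using (List; []; _∷_; [_]; _++_; length; map; allFin; concatMap; filter)
open import Data.List.Membership.Propositional using (_∈_; _∉_; find)
open import Data.List.Membership.Propositional.Properties using (∈-∃++; ∈-++⁺ʳ; ∈-++⁻; ∈-map⁺; ∈-map⁻; ∈-allFin; ∈-filter⁺; ∈-filter⁻)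
open import Data.List.Properties using (map-++; map-∘; map-id; length-map; length-++; length-tabulate; ++-identityʳ; filter-accept; filter-reject)
open import Data.List.Relation.Binary.Permutation.Propositional using (_↭_; refl; prep; swap; trans; ↭-sym; ↭-trans; ↭-refl; ↭-reflexive; module PermutationReasoning)
import Data.List.Relation.Binary.Permutation.Propositional.Properties as Perm
open import Data.List.Relation.Unary.All as All using (All; []; _∷_)
import Data.List.Relation.Unary.All.Properties as AllP
open import Data.List.Relation.Unary.Any as Any using (here; there)
open import Data.List.Relation.Unary.Unique.Propositional using (Unique; []; _∷_)
import Data.List.Relation.Unary.Unique.Propositional.Properties as Unique
open import Data.Nat using (ℕ; zero; suc; _+_; _*_; _∸_; _≤_; _<_; z≤n; s≤s; _⊓_; _/_; _%_; _≡ᵇ_; _<ᵇ_; _≤ᵇ_)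
open import Data.Nat.Coprimality using (1-coprimeTo)
open import Data.Nat.DivMod using (m/n*n≤m; m≡m%n+[m/n]*n; m%n<n; m*n/n≡m; /-mono-≤; [m+kn]%n≡m%n; m<n⇒m%n≡m; m/n≤m; n/1≡n)
open import Data.Nat.ListAction using (sum)
open import Data.Nat.ListAction.Properties using (sum-↭)
open import Data.Nat.Properties
open import Data.Nat.Tactic.RingSolver using (solve-∀)
open import Data.Product using (∃; _×_; _,_; proj₁; proj₂)
open import Data.Rational using (ℚ; 0ℚ; *<*) renaming (_+_ to _+ℚ_; _≤_ to _≤ℚ_; _<_ to _<ℚ_)
import Data.Rational.Properties as ℚ
open import Data.Sum using (_⊎_; inj₁; inj₂; [_,_]′)
open import Data.Unit using (⊤; tt)
open import Function using (_∘_; id; case_of_)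
open import Function.Bundles using (mk⤖; module Equivalence)
open import Relation.Binary.Definitions using (tri<; tri≈; tri>)
open import Relation.Binary.PropositionalEquality as Eq using (_≡_; _≢_; refl; sym; cong; cong₂; subst; subst₂; module ≡-Reasoning)
open import Relation.Nullary using (¬_; Dec; yes; no; ¬?; contradiction)
open import Relation.Nullary.Decidable using (isYes; _×-dec_)

-- Sums over lists

-- The comparison is made on lists of distances up to permutation, with an arbitrary weight that
-- strictly decreases on positive distances; `inv` is one instance. A path enlarges each sphere by
-- at most one because the vertices added after a fixed vertex lie at distinct distances from it,
-- while the spheres about the advancing tip are the former ones pushed outward by one. Rooting at a
-- leaf lets the root count as a leaf, so k leaves correspond to k - 1 paths; a tree with fewer
-- leaves is padded with empty paths to exactly that number. The condition q ≤ n - 4 means k ≥ 3.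
-- For the starlike tree itself only a lower bound of the index is computed, and explicit walks,
-- hence upper bounds of the distances, are enough for it.

sumOver : ∀ {A : Set} → (A → ℚ) → List A → ℚ
sumOver g xs = sumℚ (map g xs)

module _ {A : Set} where

  sumOver-++ : ∀ (g : A → ℚ) xs ys → sumOver g (xs ++ ys) ≡ sumOver g xs +ℚ sumOver g ys
  sumOver-++ g []       ys = sym (ℚ.+-identityˡ _)
  sumOver-++ g (x ∷ xs) ys = Eq.trans (cong (g x +ℚ_) (sumOver-++ g xs ys)) (sym (ℚ.+-assoc (g x) _ _))

  sumOver-↭ : ∀ (g : A → ℚ) {xs ys} → xs ↭ ys → sumOver g xs ≡ sumOver g ys
  sumOver-↭ g refl         = refl
  sumOver-↭ g (prep x p)   = cong (g x +ℚ_) (sumOver-↭ g p)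
  sumOver-↭ g {x ∷ y ∷ xs} {_ ∷ _ ∷ ys} (swap x y p) = begin
    g x +ℚ (g y +ℚ sumOver g xs) ≡⟨ ℚ.+-assoc (g x) (g y) _ ⟨
    (g x +ℚ g y) +ℚ sumOver g xs ≡⟨ cong₂ _+ℚ_ (ℚ.+-comm (g x) (g y)) (sumOver-↭ g p) ⟩
    (g y +ℚ g x) +ℚ sumOver g ys ≡⟨ ℚ.+-assoc (g y) (g x) _ ⟩
    g y +ℚ (g x +ℚ sumOver g ys) ∎
    where open ≡-Reasoning
  sumOver-↭ g (trans p q)  = Eq.trans (sumOver-↭ g p) (sumOver-↭ g q)

  sumOver-cong : ∀ {g h : A → ℚ} xs → (∀ {x} → x ∈ xs → g x ≡ h x) → sumOver g xs ≡ sumOver h xs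
  sumOver-cong []       e = refl
  sumOver-cong (x ∷ xs) e = cong₂ _+ℚ_ (e (here refl)) (sumOver-cong xs (e ∘ there))

  sumOver-map : ∀ {B : Set} (g : B → ℚ) (h : A → B) xs → sumOver g (map h xs) ≡ sumOver (g ∘ h) xs
  sumOver-map g h xs = cong sumℚ (sym (map-∘ xs))

+ℚ-interchange : ∀ a b c d → (a +ℚ b) +ℚ (c +ℚ d) ≡ (a +ℚ c) +ℚ (b +ℚ d)
+ℚ-interchange a b c d = begin
  (a +ℚ b) +ℚ (c +ℚ d) ≡⟨ ℚ.+-assoc a b _ ⟩
  a +ℚ (b +ℚ (c +ℚ d)) ≡⟨ cong (a +ℚ_) (ℚ.+-assoc b c d) ⟨
  a +ℚ ((b +ℚ c) +ℚ d) ≡⟨ cong (λ z → a +ℚ (z +ℚ d)) (ℚ.+-comm b c) ⟩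
  a +ℚ ((c +ℚ b) +ℚ d) ≡⟨ cong (a +ℚ_) (ℚ.+-assoc c b d) ⟩
  a +ℚ (c +ℚ (b +ℚ d)) ≡⟨ ℚ.+-assoc a c _ ⟨
  (a +ℚ c) +ℚ (b +ℚ d) ∎
  where open ≡-Reasoning

sumOver-+ : ∀ {A : Set} (g h : A → ℚ) xs → sumOver (λ x → g x +ℚ h x) xs ≡ sumOver g xs +ℚ sumOver h xs
sumOver-+ g h []       = refl
sumOver-+ g h (x ∷ xs) = Eq.trans (cong ((g x +ℚ h x) +ℚ_) (sumOver-+ g h xs)) (+ℚ-interchange (g x) (h x) _ _)

-- All equality cases are extracted with this: every bound is a sum of two bounds, and equality
-- descends to both.
+ℚ-tight : ∀ {a b c d} → a ≤ℚ b → c ≤ℚ d → a +ℚ c ≡ b +ℚ d → (a ≡ b) × (c ≡ d)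
+ℚ-tight {a} {b} {c} {d} p q e = ℚ.≤-antisym p b≤a , ℚ.≤-antisym q d≤c
  where
  b≤a : b ≤ℚ a
  b≤a with b ℚ.≤? a
  ... | yes r = r
  ... | no r  = contradiction e (ℚ.<⇒≢ (ℚ.+-mono-<-≤ (ℚ.≰⇒> r) q))
  d≤c : d ≤ℚ c
  d≤c with d ℚ.≤? c
  ... | yes r = r
  ... | no r  = contradiction e (ℚ.<⇒≢ (ℚ.+-mono-≤-< p (ℚ.≰⇒> r)))

-- Multiplicities

-- Recursive, so that `δ (suc a) (suc b)` and `δ a b` are convertible; `cnt-shift` and `cnt-levels`
-- rely on this.
δ : ℕ → ℕ → ℕ
δ zero    zero    = 1
δ zero    (suc _) = 0
δ (suc _) zero    = 0
δ (suc a) (suc b) = δ a b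

δ-refl : ∀ a → δ a a ≡ 1
δ-refl zero    = refl
δ-refl (suc a) = δ-refl a

δ-≢ : ∀ {a b} → a ≢ b → δ a b ≡ 0
δ-≢ {zero}  {zero}  p = contradiction refl p
δ-≢ {zero}  {suc b} p = refl
δ-≢ {suc a} {zero}  p = refl
δ-≢ {suc a} {suc b} p = δ-≢ (p ∘ cong suc)

cnt : ℕ → List ℕ → ℕ
cnt v []       = 0
cnt v (x ∷ xs) = δ v x + cnt v xs

cnt-++ : ∀ v xs ys → cnt v (xs ++ ys) ≡ cnt v xs + cnt v ys
cnt-++ v []       ys = refl
cnt-++ v (x ∷ xs) ys = Eq.trans (cong (δ v x +_) (cnt-++ v xs ys)) (sym (+-assoc (δ v x) _ _))

cnt-↭ : ∀ v {xs ys} → xs ↭ ys → cnt v xs ≡ cnt v ys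
cnt-↭ v refl        = refl
cnt-↭ v (prep x p)  = cong (δ v x +_) (cnt-↭ v p)
cnt-↭ v {x ∷ y ∷ xs} {_ ∷ _ ∷ ys} (swap x y p) = begin
  δ v x + (δ v y + cnt v xs) ≡⟨ cong (λ z → δ v x + (δ v y + z)) (cnt-↭ v p) ⟩
  δ v x + (δ v y + cnt v ys) ≡⟨ +-comm-mid (δ v x) (δ v y) (cnt v ys) ⟩
  δ v y + (δ v x + cnt v ys) ∎
  where
  open ≡-Reasoning
  +-comm-mid : ∀ a b c → a + (b + c) ≡ b + (a + c)
  +-comm-mid = solve-∀
cnt-↭ v (trans p q) = Eq.trans (cnt-↭ v p) (cnt-↭ v q)

cnt-∉ : ∀ v xs → (∀ {x} → x ∈ xs → v ≢ x) → cnt v xs ≡ 0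
cnt-∉ v []       p = refl
cnt-∉ v (x ∷ xs) p = cong₂ _+_ (δ-≢ (p (here refl))) (cnt-∉ v xs (p ∘ there))

cnt-shift : ∀ j v xs → cnt (j + v) (map (j +_) xs) ≡ cnt v xs
cnt-shift j v []       = refl
cnt-shift j v (x ∷ xs) = cong₂ _+_ (δ-shift j) (cnt-shift j v xs)
  where
  δ-shift : ∀ j → δ (j + v) (j + x) ≡ δ v x
  δ-shift zero    = refl
  δ-shift (suc j) = δ-shift j

-- levels c N consists of the numbers 1 + ⌊t/c⌋ for t < N, i.e. the depths of the first N
-- non-central vertices of a balanced starlike tree with c branches; level 0 t is a junk value.
level : ℕ → ℕ → ℕ
level zero    t = 1
level (suc c) t = suc (t / suc c)

levels : ℕ → ℕ → List ℕ
levels c zero    = []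
levels c (suc N) = level c N ∷ levels c N

length-levels : ∀ c N → length (levels c N) ≡ N
length-levels c zero    = refl
length-levels c (suc N) = cong suc (length-levels c N)

1≤level : ∀ c t → 1 ≤ level c t
1≤level zero    t = s≤s z≤n
1≤level (suc c) t = s≤s z≤n

1≤levels : ∀ c N → All (1 ≤_) (levels c N)
1≤levels c zero    = []
1≤levels c (suc N) = 1≤level c N ∷ 1≤levels c N

levels-≤ : ∀ c M N → N ≤ M * suc c → All (_≤ M) (levels (suc c) N)
levels-≤ c M zero    p = []
levels-≤ c M (suc N) p = *-cancelʳ-< _ _ _ (≤-<-trans (m/n*n≤m N (suc c)) p) ∷ levels-≤ c M N (≤-trans (n≤1+n N) p)

m<[1+m/n]*n : ∀ m c → m < suc (m / suc c) * suc c
m<[1+m/n]*n m c = begin-strict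
  m                                     ≡⟨ m≡m%n+[m/n]*n m (suc c) ⟩
  m % suc c + m / suc c * suc c         <⟨ +-monoˡ-< (m / suc c * suc c) (m%n<n m (suc c)) ⟩
  suc (m / suc c) * suc c ∎
  where open ≤-Reasoning

/-unique : ∀ c {m a} → a * suc c ≤ m → m < suc a * suc c → m / suc c ≡ a
/-unique c {m} {a} p q = ≤-antisym
  (≤-pred (*-cancelʳ-< (suc c) _ _ (≤-<-trans (m/n*n≤m m (suc c)) q)))
  (≤-pred (*-cancelʳ-< (suc c) _ _ (≤-<-trans p (m<[1+m/n]*n m c))))

[a*n+b]/n≡a : ∀ c a {b} → b < suc c → (a * suc c + b) / suc c ≡ a
[a*n+b]/n≡a c a {b} b< = /-unique c {a * suc c + b} {a} (m≤m+n (a * suc c) b)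
  (≤-trans (+-monoʳ-< (a * suc c) b<) (≤-reflexive (+-comm (a * suc c) (suc c))))

-- Level `suc a` is the block of the t with t / (c + 1) = a; it is empty, being filled or full
-- according as the newest t lies before, in or after this block.
cnt-levels : ∀ c a N → cnt (suc a) (levels (suc c) N) ≡ suc c ⊓ (N ∸ a * suc c)
cnt-levels c a zero    = sym (Eq.trans (cong (suc c ⊓_) (0∸n≡0 (a * suc c))) (⊓-zeroʳ (suc c)))
cnt-levels c a (suc N) with <-cmp (N / suc c) a
... | tri< lt ne _ = begin
    δ a (N / suc c) + cnt (suc a) (levels (suc c) N) ≡⟨ cong₂ _+_ (δ-≢ (ne ∘ sym)) (cnt-levels c a N) ⟩
    suc c ⊓ (N ∸ a * suc c)     ≡⟨ cong (suc c ⊓_) (Eq.trans (m≤n⇒m∸n≡0 (<⇒≤ N<)) (sym (m≤n⇒m∸n≡0 N<))) ⟩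
    suc c ⊓ (suc N ∸ a * suc c) ∎
  where
  open ≡-Reasoning
  N< : suc N ≤ a * suc c
  N< = ≤-trans (m<[1+m/n]*n N c) (*-monoˡ-≤ (suc c) lt)
... | tri≈ _ eq _ = begin
    δ a (N / suc c) + cnt (suc a) (levels (suc c) N) ≡⟨ cong₂ _+_ (Eq.trans (cong (δ a) eq) (δ-refl a)) (cnt-levels c a N) ⟩
    suc (suc c ⊓ (N ∸ a * suc c))   ≡⟨ cong suc (m≥n⇒m⊓n≡n (<⇒≤ r<)) ⟩
    suc (N ∸ a * suc c)             ≡⟨ m≥n⇒m⊓n≡n r< ⟨
    suc c ⊓ suc (N ∸ a * suc c)     ≡⟨ cong (suc c ⊓_) (+-∸-assoc 1 ac≤N) ⟨
    suc c ⊓ (suc N ∸ a * suc c) ∎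
  where
  open ≡-Reasoning
  ac≤N : a * suc c ≤ N
  ac≤N = subst (λ z → z * suc c ≤ N) eq (m/n*n≤m N (suc c))
  r< : N ∸ a * suc c < suc c
  r< = +-cancelʳ-< (a * suc c) _ _ (subst (_< suc a * suc c) (sym (m∸n+n≡m ac≤N)) (subst (λ z → N < suc z * suc c) eq (m<[1+m/n]*n N c)))
... | tri> _ ne gt = begin
    δ a (N / suc c) + cnt (suc a) (levels (suc c) N) ≡⟨ cong₂ _+_ (δ-≢ (ne ∘ sym)) (cnt-levels c a N) ⟩
    suc c ⊓ (N ∸ a * suc c)     ≡⟨ m≤n⇒m⊓n≡m c≤ ⟩
    suc c                       ≡⟨ m≤n⇒m⊓n≡m (≤-trans c≤ (∸-monoˡ-≤ (a * suc c) (n≤1+n N))) ⟨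
    suc c ⊓ (suc N ∸ a * suc c) ∎
  where
  open ≡-Reasoning
  c≤ : suc c ≤ N ∸ a * suc c
  c≤ = m+n≤o⇒m≤o∸n (suc c) (≤-trans (*-monoˡ-≤ (suc c) gt) (m/n*n≤m N (suc c)))

cnt-levels-≤ : ∀ c v N → cnt v (levels (suc c) N) ≤ suc c
cnt-levels-≤ c zero    N = ≤-trans (≤-reflexive (cnt-∉ 0 _ (λ x∈ → <⇒≢ (All.lookup (1≤levels (suc c) N) x∈)))) z≤n
cnt-levels-≤ c (suc a) N = ≤-trans (≤-reflexive (cnt-levels c a N)) (m⊓n≤m _ _)

-- For a branch with n vertices these are the distances from the centre to its vertices, and also
-- those from its last vertex to the rest of the branch and the centre.
down : ℕ → List ℕ
down zero    = []
down (suc n) = suc n ∷ down n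

length-down : ∀ n → length (down n) ≡ n
length-down zero    = refl
length-down (suc n) = cong suc (length-down n)

1≤down : ∀ n → All (1 ≤_) (down n)
1≤down zero    = []
1≤down (suc n) = s≤s z≤n ∷ 1≤down n

down-≤ : ∀ n → All (_≤ n) (down n)
down-≤ zero    = []
down-≤ (suc n) = ≤-refl ∷ All.map (λ p → ≤-trans p (n≤1+n n)) (down-≤ n)

cnt-down-> : ∀ {v n} → n < v → cnt v (down n) ≡ 0
cnt-down-> {v} {n} p = cnt-∉ v _ (λ x∈ e → <⇒≱ p (subst (_≤ n) (sym e) (All.lookup (down-≤ n) x∈)))

cnt-down-≤1 : ∀ v n → cnt v (down n) ≤ 1
cnt-down-≤1 v zero    = z≤n
cnt-down-≤1 v (suc n) with v ≟ suc n
... | yes refl = ≤-reflexive (cong₂ _+_ (δ-refl n) (cnt-down-> {suc n} {n} ≤-refl))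
... | no ne    = ≤-trans (≤-reflexive (cong (_+ cnt v (down n)) (δ-≢ ne))) (cnt-down-≤1 v n)

cnt-down-1 : ∀ v n → suc v ≤ n → cnt (suc v) (down n) ≡ 1
cnt-down-1 v (suc n) p with v ≟ n
... | yes refl = cong₂ _+_ (δ-refl n) (cnt-down-> {suc n} {n} ≤-refl)
... | no ne    = Eq.trans (cong (_+ cnt (suc v) (down n)) (δ-≢ ne)) (cnt-down-1 v n (≤∧≢⇒< (≤-pred p) ne))

-- The greedy bound

cnts : ℕ → List ℕ → ℕ
cnts zero    xs = 0
cnts (suc h) xs = cnt (suc h) xs + cnts h xs

cnts-∷ : ∀ h x xs → cnts h xs ≤ cnts h (x ∷ xs)
cnts-∷ zero    x xs = z≤n
cnts-∷ (suc h) x xs = +-mono-≤ (m≤n+m _ (δ (suc h) x)) (cnts-∷ h x xs)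

cnts-∷-< : ∀ h {x} xs → 1 ≤ x → x ≤ h → cnts h xs < cnts h (x ∷ xs)
cnts-∷-< zero    xs 1≤x x≤h = contradiction (≤-trans 1≤x x≤h) λ ()
cnts-∷-< (suc h) {x} xs 1≤x x≤h with x ≟ suc h
... | yes refl = +-mono-<-≤ (≤-reflexive (cong (_+ cnt (suc h) xs) (sym (δ-refl h)))) (cnts-∷ h x xs)
... | no ne    = +-mono-≤-< (m≤n+m _ (δ (suc h) x)) (cnts-∷-< h xs 1≤x (≤-pred (≤∧≢⇒< x≤h ne)))

length≤cnts : ∀ h xs → All (1 ≤_) xs → All (_≤ h) xs → length xs ≤ cnts h xs
length≤cnts h []       _        _        = z≤n
length≤cnts h (x ∷ xs) (p ∷ ps) (q ∷ qs) = ≤-trans (s≤s (length≤cnts h xs ps qs)) (cnts-∷-< h xs p q)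

pigeonhole : ∀ h c xs → All (1 ≤_) xs → All (_≤ h) xs → (∀ v → cnt v xs ≤ c) → length xs ≤ h * c
pigeonhole h c xs p q r = ≤-trans (length≤cnts h xs p q) (cnts≤ h)
  where
  cnts≤ : ∀ h → cnts h xs ≤ h * c
  cnts≤ zero    = z≤n
  cnts≤ (suc h) = +-mono-≤ (r (suc h)) (cnts≤ h)

-- Monotonicity is restricted to positive arguments because `inv 0` is `0ℚ`.
module Weighted (f : ℕ → ℚ) (f-anti : ∀ {a b} → 1 ≤ a → a < b → f b <ℚ f a) where

  f-mono : ∀ {a b} → 1 ≤ a → a ≤ b → f b ≤ℚ f a
  f-mono 1≤a a≤b with m≤n⇒m<n∨m≡n a≤b
  ... | inj₁ lt   = ℚ.<⇒≤ (f-anti 1≤a lt)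
  ... | inj₂ refl = ℚ.≤-refl

  shifted : ℕ → List ℕ → ℚ
  shifted e xs = sumOver (λ x → f (e + x)) xs

  -- The largest value must be at least the top level, by the pigeonhole principle; discard it.
  greedy : ∀ c e L xs → length xs ≡ L → All (1 ≤_) xs → (∀ v → cnt v xs ≤ suc c) →
    (shifted e xs ≤ℚ shifted e (levels (suc c) L)) ×
    (shifted e xs ≡ shifted e (levels (suc c) L) → xs ↭ levels (suc c) L)
  greedy c e zero    []       _  _  _ = ℚ.≤-refl , λ _ → ↭-refl
  greedy c e (suc L) xs len pos caps with Any.any? (λ x → level (suc c) L ≤? x) xs
  ... | no none = contradiction (≤-trans (≤-trans (≤-reflexive (sym len)) (pigeonhole (L / suc c) (suc c) xs pos small caps)) (m/n*n≤m L (suc c))) 1+n≰n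
    where
    small : All (_≤ L / suc c) xs
    small = All.map (λ p → ≤-pred (≰⇒> p)) (AllP.¬Any⇒All¬ xs none)
  ... | yes some with find some
  ...   | x , x∈ , big with ∈-∃++ x∈
  ...     | ys , zs , refl = ≤-part , eq-part
    where
    perm : ys ++ x ∷ zs ↭ x ∷ ys ++ zs
    perm = Perm.shift x ys zs
    pos′ : All (1 ≤_) (x ∷ ys ++ zs)
    pos′ = Perm.All-resp-↭ perm pos
    ih = greedy c e L (ys ++ zs) (suc-injective (Eq.trans (sym (Perm.↭-length perm)) len)) (All.tail pos′)
           (λ v → ≤-trans (≤-trans (m≤n+m _ (δ v x)) (≤-reflexive (sym (cnt-↭ v perm)))) (caps v))
    head≤ : f (e + x) ≤ℚ f (e + level (suc c) L)
    head≤ = f-mono (≤-trans (s≤s z≤n) (m≤n+m _ e)) (+-monoʳ-≤ e big)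
    ≤-part = ℚ.≤-trans (ℚ.≤-reflexive (sumOver-↭ _ perm)) (ℚ.+-mono-≤ head≤ (proj₁ ih))
    eq-part : _ → _
    eq-part eq with +ℚ-tight head≤ (proj₁ ih) (Eq.trans (sym (sumOver-↭ _ perm)) eq)
    ... | eq₁ , eq₂ = ↭-trans perm (subst (λ z → z ∷ ys ++ zs ↭ _) (sym x≡) (prep _ (proj₂ ih eq₂)))
      where
      x≡ : x ≡ level (suc c) L
      x≡ with m≤n⇒m<n∨m≡n big
      ... | inj₂ e = sym e
      ... | inj₁ lt = contradiction eq₁ (ℚ.<⇒≢ (f-anti (≤-trans (s≤s z≤n) (m≤n+m _ e)) (+-monoʳ-< e lt)))

-- Rebalancing starlike trees

module Spider (f : ℕ → ℚ) (f-anti : ∀ {a b} → 1 ≤ a → a < b → f b <ℚ f a) where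

  open Weighted f f-anti

  -- Regroups the distances from an endvertex at distance M + j from the centre. The vertex at
  -- distance M takes over the role of centre, and what lies behind it, j further vertices ending in
  -- the true centre and then `ys`, becomes a single profile.
  prefix-down : ∀ M j ys →
    shifted 0 (down (M + j)) +ℚ shifted (M + j) ys ≡ shifted 0 (down M) +ℚ shifted M (down j ++ map (j +_) ys)
  prefix-down M j ys = begin
    shifted 0 (down (M + j)) +ℚ shifted (M + j) ys                         ≡⟨ cong (_+ℚ shifted (M + j) ys) (down-+ j) ⟩
    (shifted 0 (down M) +ℚ shifted M (down j)) +ℚ shifted (M + j) ys       ≡⟨ ℚ.+-assoc (shifted 0 (down M)) _ _ ⟩
    shifted 0 (down M) +ℚ (shifted M (down j) +ℚ shifted (M + j) ys)       ≡⟨ cong (λ z → shifted 0 (down M) +ℚ (shifted M (down j) +ℚ z)) shift-map ⟨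
    shifted 0 (down M) +ℚ (shifted M (down j) +ℚ shifted M (map (j +_) ys)) ≡⟨ cong (shifted 0 (down M) +ℚ_) (sumOver-++ _ (down j) _) ⟨
    shifted 0 (down M) +ℚ shifted M (down j ++ map (j +_) ys) ∎
    where
    open ≡-Reasoning
    down-+ : ∀ j → shifted 0 (down (M + j)) ≡ shifted 0 (down M) +ℚ shifted M (down j)
    down-+ zero    = Eq.trans (cong (λ z → shifted 0 (down z)) (+-identityʳ M)) (sym (ℚ.+-identityʳ _))
    down-+ (suc j) = begin
      shifted 0 (down (M + suc j))                       ≡⟨ cong (λ z → shifted 0 (down z)) (+-suc M j) ⟩
      f (suc (M + j)) +ℚ shifted 0 (down (M + j))        ≡⟨ cong₂ _+ℚ_ (cong f (sym (+-suc M j))) (down-+ j) ⟩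
      f (M + suc j) +ℚ (shifted 0 (down M) +ℚ shifted M (down j)) ≡⟨ ℚ.+-assoc (f (M + suc j)) _ _ ⟨
      (f (M + suc j) +ℚ shifted 0 (down M)) +ℚ shifted M (down j) ≡⟨ cong (_+ℚ shifted M (down j)) (ℚ.+-comm (f (M + suc j)) _) ⟩
      (shifted 0 (down M) +ℚ f (M + suc j)) +ℚ shifted M (down j) ≡⟨ ℚ.+-assoc (shifted 0 (down M)) _ _ ⟩
      shifted 0 (down M) +ℚ shifted M (down (suc j)) ∎
    shift-map : shifted M (map (j +_) ys) ≡ shifted (M + j) ys
    shift-map = Eq.trans (sumOver-map _ (j +_) ys) (sumOver-cong ys (λ {x} _ → cong f (sym (+-assoc M j x))))

  module _ (c j : ℕ) (ys : List ℕ) (pos : All (1 ≤_) ys) (caps : ∀ v → cnt v ys ≤ suc c) where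

    private
      xs : List ℕ
      xs = down j ++ map (j +_) ys

      xs-pos : All (1 ≤_) xs
      xs-pos = AllP.++⁺ (1≤down j) (AllP.map⁺ (All.map (λ p → ≤-trans p (m≤n+m _ j)) pos))

      cnt-low : ∀ {v} → v ≤ j → cnt v (map (j +_) ys) ≡ 0
      cnt-low {v} v≤j = cnt-∉ v (map (j +_) ys) λ x∈ eq → case ∈-map⁻ (j +_) x∈ of λ where
        (y , y∈ , refl) → <⇒≱ (m<m+n j (All.lookup pos y∈)) (subst (_≤ j) eq v≤j)

      xs-caps : ∀ v → cnt v xs ≤ suc c
      xs-caps v with v ≤? j
      ... | yes v≤j = begin
        cnt v xs                                     ≡⟨ cnt-++ v (down j) _ ⟩
        cnt v (down j) + cnt v (map (j +_) ys)       ≡⟨ cong (cnt v (down j) +_) (cnt-low v≤j) ⟩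
        cnt v (down j) + 0                           ≡⟨ +-identityʳ _ ⟩
        cnt v (down j)                               ≤⟨ cnt-down-≤1 v j ⟩
        1                                            ≤⟨ s≤s z≤n ⟩
        suc c                                        ∎
        where open ≤-Reasoning
      ... | no v≰j = begin
        cnt v xs                                     ≡⟨ cnt-++ v (down j) _ ⟩
        cnt v (down j) + cnt v (map (j +_) ys)       ≡⟨ cong (_+ cnt v (map (j +_) ys)) (cnt-down-> (≰⇒> v≰j)) ⟩
        cnt v (map (j +_) ys)                        ≡⟨ cong (λ z → cnt z (map (j +_) ys)) (m+[n∸m]≡n (<⇒≤ (≰⇒> v≰j))) ⟨
        cnt (j + (v ∸ j)) (map (j +_) ys)            ≡⟨ cnt-shift j (v ∸ j) ys ⟩
        cnt (v ∸ j) ys                               ≤⟨ caps (v ∸ j) ⟩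
        suc c                                        ∎
        where open ≤-Reasoning

      length-xs : length xs ≡ j + length ys
      length-xs = Eq.trans (length-++ (down j)) (cong₂ _+_ (length-down j) (length-map (j +_) ys))

      -- A path of positive length has a single vertex at distance 1, whereas the greedy profile has at least two.
      no-path : ∀ L → 1 ≤ c → 2 ≤ L → xs ↭ levels (suc c) L → j ≡ 0
      no-path L 1≤c 2≤L perm with j ≟ 0
      ... | yes e = e
      ... | no ne = contradiction two λ { (s≤s ()) }
        where
        open ≤-Reasoning
        two : 2 ≤ 1
        two = begin
          2                                      ≤⟨ ⊓-glb (s≤s 1≤c) 2≤L ⟩
          suc c ⊓ (L ∸ 0)                        ≡⟨ cnt-levels c 0 L ⟨
          cnt 1 (levels (suc c) L)               ≡⟨ cnt-↭ 1 perm ⟨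
          cnt 1 xs                               ≡⟨ cnt-++ 1 (down j) _ ⟩
          cnt 1 (down j) + cnt 1 (map (j +_) ys) ≡⟨ cong (cnt 1 (down j) +_) (cnt-low (n≢0⇒n>0 ne)) ⟩
          cnt 1 (down j) + 0                     ≡⟨ +-identityʳ _ ⟩
          cnt 1 (down j)                         ≤⟨ cnt-down-≤1 1 j ⟩
          1                                      ∎

    -- The substitute centre of `prefix-down` sees one vertex at each distance up to j and then the
    -- spheres of `ys` pushed outward by j. No sphere therefore exceeds c + 1, and `greedy` applies
    -- to the whole profile.
    prefix-greedy : ∀ M L → j + length ys ≡ L →
      (shifted 0 (down (M + j)) +ℚ shifted (M + j) ys ≤ℚ shifted 0 (down M) +ℚ shifted M (levels (suc c) L)) ×
      (shifted 0 (down (M + j)) +ℚ shifted (M + j) ys ≡ shifted 0 (down M) +ℚ shifted M (levels (suc c) L) →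
        1 ≤ c → 2 ≤ L → (j ≡ 0) × (ys ↭ levels (suc c) L))
    prefix-greedy M L len = ≤-part , eq-part
      where
      g = greedy c M L xs (Eq.trans length-xs len) xs-pos xs-caps
      ≤-part : _
      ≤-part = ℚ.≤-trans (ℚ.≤-reflexive (prefix-down M j ys)) (ℚ.+-monoʳ-≤ (shifted 0 (down M)) (proj₁ g))
      eq-part : _ → _
      eq-part eq 1≤c 2≤L = j≡0 , subst (λ zs → zs ↭ levels (suc c) L) (xs≡ j≡0) perm
        where
        perm : xs ↭ levels (suc c) L
        perm = proj₂ g (proj₂ (+ℚ-tight (ℚ.≤-refl {shifted 0 (down M)}) (proj₁ g) (Eq.trans (sym (prefix-down M j ys)) eq)))
        j≡0 : j ≡ 0
        j≡0 = no-path L 1≤c 2≤L perm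
        xs≡ : j ≡ 0 → xs ≡ ys
        xs≡ refl = map-id ys

  -- The contribution to the Harary index of the vertex N + 1 of BS when it is added to the
  -- vertices 0, …, N and there are c + 1 branches.
  newLeaf : ℕ → ℕ → ℚ
  newLeaf c N = shifted 0 (down (level (suc c) N)) +ℚ shifted (level (suc c) N) (levels c (N ∸ N / suc c))

  -- The index of the balanced starlike tree with N non-central vertices and c + 1 branches, built
  -- in order of depth. The parameter is one less than the number of branches so that it matches the
  -- number of attached paths.
  balanced : ℕ → ℕ → ℚ
  balanced c zero    = 0ℚ
  balanced c (suc N) = balanced c N +ℚ newLeaf c N

  -- The contribution of a path with p vertices attached to the centre of a balanced starlike tree with
  -- c branches and N non-central vertices.
  branch : ℕ → ℕ → ℕ → ℚ
  branch c N zero    = 0ℚ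
  branch c N (suc p) = branch c N p +ℚ (shifted 0 (down (suc p)) +ℚ shifted (suc p) (levels c N))

  -- The new vertex of the core has depth `level c N`, so it sees the p path vertices at distances
  -- `level c N + 1`, ..., `level c N + p`.
  branch-suc : ∀ c N p → branch c (suc N) p ≡ branch c N p +ℚ shifted (level c N) (down p)
  branch-suc c N zero    = refl
  branch-suc c N (suc p) = begin
    branch c (suc N) p +ℚ (D +ℚ (f (suc p + l) +ℚ L))           ≡⟨ cong₂ _+ℚ_ (branch-suc c N p) (swap-mid D (f (suc p + l)) L) ⟩
    (branch c N p +ℚ R) +ℚ (f (suc p + l) +ℚ (D +ℚ L))          ≡⟨ cong ((branch c N p +ℚ R) +ℚ_) (ℚ.+-comm (f (suc p + l)) (D +ℚ L)) ⟩
    (branch c N p +ℚ R) +ℚ ((D +ℚ L) +ℚ f (suc p + l))          ≡⟨ +ℚ-interchange (branch c N p) R (D +ℚ L) _ ⟩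
    (branch c N p +ℚ (D +ℚ L)) +ℚ (R +ℚ f (suc p + l))          ≡⟨ cong ((branch c N p +ℚ (D +ℚ L)) +ℚ_) (ℚ.+-comm R _) ⟩
    (branch c N p +ℚ (D +ℚ L)) +ℚ (f (suc p + l) +ℚ R)          ≡⟨ cong (λ z → (branch c N p +ℚ (D +ℚ L)) +ℚ (f z +ℚ R)) (+-comm (suc p) l) ⟩
    (branch c N p +ℚ (D +ℚ L)) +ℚ (f (l + suc p) +ℚ R) ∎
    where
    open ≡-Reasoning
    l = level c N
    D = shifted 0 (down (suc p))
    L = shifted (suc p) (levels c N)
    R = shifted l (down p)
    swap-mid : ∀ a b c → a +ℚ (b +ℚ c) ≡ b +ℚ (a +ℚ c)
    swap-mid a b c = Eq.trans (sym (ℚ.+-assoc a b c)) (Eq.trans (cong (_+ℚ c) (ℚ.+-comm a b)) (ℚ.+-assoc b a c))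

  module _ (c N : ℕ) where

    private
      h : ℕ
      -- In the target with c + 2 branches the last vertex has depth `suc h`; its own branch has h
      -- other vertices, which leaves `N ∸ h` on the other branches.
      h = N / suc (suc c)

      h*c+h≤N : h * suc c + h ≤ N
      h*c+h≤N = ≤-trans (≤-reflexive (distrib h c)) (m/n*n≤m N (suc (suc c)))
        where
        distrib : ∀ h c → h * suc c + h ≡ h * suc (suc c)
        distrib = solve-∀

      h*c≤ : h * suc c ≤ N ∸ h
      h*c≤ = m+n≤o⇒m≤o∸n (h * suc c) h*c+h≤N

      2≤N∸h : 1 ≤ c → suc c ≤ N → 2 ≤ N ∸ h
      2≤N∸h 1≤c c<N with h ≟ 0
      ... | yes e = subst (λ z → 2 ≤ N ∸ z) (sym e) (≤-trans (s≤s 1≤c) c<N)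
      ... | no ne = ≤-trans (*-mono-≤ (n≢0⇒n>0 ne) (s≤s 1≤c)) h*c≤

    -- The path reaches at least the depth `suc h` of the target. Its surplus of j vertices is
    -- absorbed into the profile behind a prefix of length `suc h`.
    leaf-from-branch : ∀ N′ p → N′ + p ≡ suc N → level (suc (suc c)) N ≤ p →
      (shifted 0 (down p) +ℚ shifted p (levels (suc c) N′) ≤ℚ newLeaf (suc c) N) ×
      (shifted 0 (down p) +ℚ shifted p (levels (suc c) N′) ≡ newLeaf (suc c) N →
        1 ≤ c → suc c ≤ N → p ≡ level (suc (suc c)) N)
    leaf-from-branch N′ p sum M≤p with m≤n⇒∃[o]m+o≡n M≤p
    ... | j , refl = proj₁ g , λ eq 1≤c c<N →
        Eq.trans (cong (suc h +_) (proj₁ (proj₂ g eq 1≤c (2≤N∸h 1≤c c<N)))) (+-identityʳ (suc h))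
      where
      len : j + length (levels (suc c) N′) ≡ N ∸ h
      len = begin
        j + length (levels (suc c) N′) ≡⟨ cong (j +_) (length-levels (suc c) N′) ⟩
        j + N′                         ≡⟨ m+n∸n≡m (j + N′) h ⟨
        (j + N′ + h) ∸ h               ≡⟨ cong (_∸ h) (suc-injective (Eq.trans (rearrange j N′ h) sum)) ⟩
        N ∸ h                          ∎
        where
        open ≡-Reasoning
        rearrange : ∀ j N′ h → suc (j + N′ + h) ≡ N′ + (suc h + j)
        rearrange = solve-∀
      g = prefix-greedy c j (levels (suc c) N′) (1≤levels (suc c) N′) (λ v → cnt-levels-≤ c v N′) (suc h) (N ∸ h) len

    leaf-from-core : ∀ N′ p → N′ + p ≡ N → p < level (suc (suc c)) N →
      (newLeaf c N′ +ℚ shifted (level (suc c) N′) (down p) ≤ℚ newLeaf (suc c) N) ×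
      (newLeaf c N′ +ℚ shifted (level (suc c) N′) (down p) ≡ newLeaf (suc c) N →
        1 ≤ c → suc c ≤ N → (level (suc c) N′ ≡ level (suc (suc c)) N) × (suc p ≡ level (suc (suc c)) N))
    leaf-from-core N′ p sum (s≤s p≤h) = ≤-part , eq-part
      where
      h′ = N′ / suc c
      h≤h′ : h ≤ h′
      h≤h′ = subst (_≤ h′) (m*n/n≡m h (suc c)) (/-mono-≤ {o = suc c} (+-cancelʳ-≤ p _ _ (≤-trans (+-monoʳ-≤ (h * suc c) p≤h) (≤-trans h*c+h≤N (≤-reflexive (sym sum))))) ≤-refl)
      j = proj₁ (m≤n⇒∃[o]m+o≡n h≤h′)
      h+j≡h′ : h + j ≡ h′
      h+j≡h′ = proj₂ (m≤n⇒∃[o]m+o≡n h≤h′)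
      X = N′ ∸ h′
      ys = down p ++ levels c X
      caps₀ : ∀ c v → cnt v (levels c (N′ ∸ N′ / suc c)) ≤ c
      -- A core with a single branch has no other branches: `N′ / 1` exhausts N′, and the junk value
      -- of `level 0` does not enter.
      caps₀ zero    v = ≤-reflexive (cong (cnt v ∘ levels 0) (Eq.trans (cong (N′ ∸_) (n/1≡n N′)) (n∸n≡0 N′)))
      caps₀ (suc c) v = cnt-levels-≤ c v (N′ ∸ N′ / suc (suc c))
      caps : ∀ v → cnt v ys ≤ suc c
      caps v = ≤-trans (≤-reflexive (cnt-++ v (down p) _)) (+-mono-≤ (cnt-down-≤1 v p) (caps₀ c v))
      len : j + length ys ≡ N ∸ h
      len = begin
        j + length ys                  ≡⟨ cong (j +_) (Eq.trans (length-++ (down p)) (cong₂ _+_ (length-down p) (length-levels c X))) ⟩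
        j + (p + X)                    ≡⟨ m+n∸n≡m (j + (p + X)) h ⟨
        (j + (p + X) + h) ∸ h          ≡⟨ cong (_∸ h) (rearrange j p X h) ⟩
        ((X + (h + j)) + p) ∸ h        ≡⟨ cong (λ z → (X + z + p) ∸ h) h+j≡h′ ⟩
        ((X + h′) + p) ∸ h             ≡⟨ cong (λ z → (z + p) ∸ h) (m∸n+n≡m (m/n≤m N′ (suc c))) ⟩
        (N′ + p) ∸ h                   ≡⟨ cong (_∸ h) sum ⟩
        N ∸ h                          ∎
        where
        open ≡-Reasoning
        rearrange : ∀ j p X h → j + (p + X) + h ≡ X + (h + j) + p
        rearrange = solve-∀
      g = prefix-greedy c j ys (AllP.++⁺ (1≤down p) (1≤levels c X)) caps (suc h) (N ∸ h) len
      lhs : newLeaf c N′ +ℚ shifted (suc h′) (down p) ≡ shifted 0 (down (suc h + j)) +ℚ shifted (suc h + j) ys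
      lhs = begin
        (D +ℚ shifted (suc h′) (levels c X)) +ℚ shifted (suc h′) (down p) ≡⟨ ℚ.+-assoc D _ _ ⟩
        D +ℚ (shifted (suc h′) (levels c X) +ℚ shifted (suc h′) (down p)) ≡⟨ cong (D +ℚ_) (ℚ.+-comm (shifted (suc h′) (levels c X)) _) ⟩
        D +ℚ (shifted (suc h′) (down p) +ℚ shifted (suc h′) (levels c X)) ≡⟨ cong (D +ℚ_) (sumOver-++ _ (down p) _) ⟨
        D +ℚ shifted (suc h′) ys                                          ≡⟨ cong (λ z → shifted 0 (down (suc z)) +ℚ shifted (suc z) ys) h+j≡h′ ⟨
        shifted 0 (down (suc h + j)) +ℚ shifted (suc h + j) ys ∎
        where
        open ≡-Reasoning
        D = shifted 0 (down (suc h′))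
      ≤-part : _
      ≤-part = ℚ.≤-trans (ℚ.≤-reflexive lhs) (proj₁ g)
      eq-part : _ → _ → _ → _
      eq-part eq 1≤c c<N with proj₂ g (Eq.trans (sym lhs) eq) 1≤c (2≤N∸h 1≤c c<N)
      ... | j≡0 , perm = cong suc (Eq.trans (sym h+j≡h′) (Eq.trans (cong (h +_) j≡0) (+-identityʳ h))) , cong suc p≡h
        where
        p≡h : p ≡ h
        p≡h with m≤n⇒m<n∨m≡n p≤h
        ... | inj₂ e  = e
        -- If p < h, level `suc p` of the greedy profile is full with c + 1 vertices, but the path
        -- ends before it and the other core branches supply at most c.
        ... | inj₁ lt = contradiction full 1+n≰n
          where
          open ≤-Reasoning
          full : suc c ≤ c
          full = begin
            suc c                                  ≤⟨ ⊓-glb ≤-refl (m+n≤o⇒m≤o∸n (suc c) (≤-trans (*-monoˡ-≤ (suc c) lt) h*c≤)) ⟩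
            suc c ⊓ (N ∸ h ∸ p * suc c)            ≡⟨ cnt-levels c p (N ∸ h) ⟨
            cnt (suc p) (levels (suc c) (N ∸ h))   ≡⟨ cnt-↭ (suc p) perm ⟨
            cnt (suc p) ys                         ≡⟨ cnt-++ (suc p) (down p) _ ⟩
            cnt (suc p) (down p) + _               ≡⟨ cong (_+ cnt (suc p) (levels c X)) (cnt-down-> {suc p} {p} ≤-refl) ⟩
            cnt (suc p) (levels c X)               ≤⟨ caps₀ c (suc p) ⟩
            c                                      ∎

  -- Induction on N: delete the last vertex of the longer of the attached path and the longest branch.
  spider≤ : ∀ c N N′ p → N′ + p ≡ N →
    balanced c N′ +ℚ branch (suc c) N′ p ≤ℚ balanced (suc c) N
  spider-step : ∀ c N N′ p → N′ + p ≡ suc N →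
    (balanced c N′ +ℚ branch (suc c) N′ p ≤ℚ balanced (suc c) (suc N)) ×
    (balanced c N′ +ℚ branch (suc c) N′ p ≡ balanced (suc c) (suc N) → 1 ≤ c → suc c ≤ N →
      (p ≡ level (suc (suc c)) N) ⊎
      (∃ λ N″ → (N′ ≡ suc N″) × (level (suc c) N″ ≡ level (suc (suc c)) N) × (suc p ≡ level (suc (suc c)) N)))

  spider≤ c zero    zero     zero    sum = ℚ.≤-reflexive (ℚ.+-identityʳ 0ℚ)
  spider≤ c (suc N) N′       p       sum = proj₁ (spider-step c N N′ p sum)

  spider-step c N N′ p sum with level (suc (suc c)) N ≤? p
  spider-step c N N′ (suc p) sum | yes M≤p = ≤-part , λ eq 1≤c c<N → inj₁ (proj₂ leaf (proj₂ (+ℚ-tight ih (proj₁ leaf) (Eq.trans assoc eq))) 1≤c c<N)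
    where
    ih = spider≤ c N N′ p (suc-injective (Eq.trans (sym (+-suc N′ p)) sum))
    leaf = leaf-from-branch c N N′ (suc p) sum M≤p
    assoc = ℚ.+-assoc (balanced c N′) (branch (suc c) N′ p) (shifted 0 (down (suc p)) +ℚ shifted (suc p) (levels (suc c) N′))
    ≤-part = ℚ.≤-trans (ℚ.≤-reflexive (sym assoc)) (ℚ.+-mono-≤ ih (proj₁ leaf))
  spider-step c N zero    p sum | no M≰p = contradiction (subst (level (suc (suc c)) N ≤_) (sym sum) (s≤s (m/n≤m N (suc (suc c))))) M≰p
  spider-step c N (suc N″) p sum | no M≰p = ≤-part , λ eq 1≤c c<N → inj₂ (N″ , refl , proj₂ leaf (proj₂ (+ℚ-tight ih (proj₁ leaf) (Eq.trans (sym assoc) eq))) 1≤c c<N)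
    where
    ih = spider≤ c N N″ p (suc-injective sum)
    leaf = leaf-from-core c N N″ p (suc-injective sum) (≰⇒> M≰p)
    assoc : (balanced c N″ +ℚ newLeaf c N″) +ℚ branch (suc c) (suc N″) p ≡
            (balanced c N″ +ℚ branch (suc c) N″ p) +ℚ (newLeaf c N″ +ℚ shifted (level (suc c) N″) (down p))
    assoc = Eq.trans (cong ((balanced c N″ +ℚ newLeaf c N″) +ℚ_) (branch-suc (suc c) N″ p)) (+ℚ-interchange (balanced c N″) _ _ _)
    ≤-part = ℚ.≤-trans (ℚ.≤-reflexive assoc) (ℚ.+-mono-≤ ih (proj₁ leaf))

-- Spheres and distances in trees grown by paths

remove : ∀ {A : Set} {x : A} {xs} → x ∈ xs → ∃ λ xs′ → xs ↭ x ∷ xs′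
remove x∈ with ∈-∃++ x∈
... | ys , zs , refl = ys ++ zs , Perm.shift _ ys zs

map-cong-∈ : ∀ {A B : Set} {f g : A → B} xs → (∀ {x} → x ∈ xs → f x ≡ g x) → map f xs ≡ map g xs
map-cong-∈ []       p = refl
map-cong-∈ (x ∷ xs) p = cong₂ _∷_ (p (here refl)) (map-cong-∈ xs (p ∘ there))

cnt-suc : ∀ v xs → cnt (suc v) (map suc xs) ≡ cnt v xs
cnt-suc v xs = cnt-shift 1 v xs

cnt-shifted-down : ∀ v e m → cnt v (map (e +_) (down m)) ≤ 1
cnt-shifted-down v e m with e ≤? v
... | yes e≤v = ≤-trans (≤-reflexive (Eq.trans (cong (λ z → cnt z (map (e +_) (down m))) (sym (m+[n∸m]≡n e≤v))) (cnt-shift e (v ∸ e) (down m)))) (cnt-down-≤1 (v ∸ e) m)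
... | no e≰v  = ≤-trans (≤-reflexive (cnt-∉ v (map (e +_) (down m)) λ x∈ eq → case ∈-map⁻ (e +_) x∈ of λ where
      (y , _ , refl) → e≰v (≤-trans (m≤m+n e y) (≤-reflexive (sym eq))))) z≤n

down-∷ : ∀ p → 1 ∷ map suc (down p) ↭ down (suc p)
down-∷ zero    = ↭-refl
down-∷ (suc p) = ↭-trans (swap 1 (suc (suc p)) ↭-refl) (prep (suc (suc p)) (down-∷ p))

tip : ∀ {V : Set} → V → List V → V
tip u []      = u
tip u (y ∷ _) = y

pairSum : ∀ {V : Set} → (V → V → ℚ) → List V → ℚ
pairSum g []      = 0ℚ
pairSum g (y ∷ A) = pairSum g A +ℚ sumOver (g y) A

-- A tree grown from a root by successively attaching paths; lists carry the newest vertex first.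
module Runs {V : Set} (d : V → V → ℕ) (d-refl : ∀ x → d x x ≡ 0) (d-sym : ∀ x y → d x y ≡ d y x) where

  -- The metric trace of attaching `y` to `x` as a leaf; it allows the counting to be done without
  -- an adjacency relation.
  Step : List V → V → V → Set
  Step A x y = ∀ {a} → a ∈ A → d y a ≡ suc (d x a)

  data Path (u : V) (A : List V) : List V → Set where
    []  : Path u A []
    _∷_ : ∀ {y P} → Step (P ++ A) (tip u P) y → Path u A P → Path u A (y ∷ P)

  data Runs (ρ : V) : ℕ → List V → Set where
    root : Runs ρ 0 (ρ ∷ [])
    run  : ∀ {j A u P} → Runs ρ j A → u ∈ A → Path u A P → Runs ρ (suc j) (P ++ A)

  tip∈ : ∀ {u : V} {A} P → u ∈ A → tip u P ∈ P ++ A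
  tip∈ []      u∈ = u∈
  tip∈ (y ∷ P) u∈ = here refl

  -- The exact count at distance 0 makes all distances to the other vertices positive, as `greedy`
  -- demands.
  SphereBound : ℕ → List V → Set
  SphereBound j A = ∀ {x} → x ∈ A → (cnt 0 (map (d x) A) ≡ 1) × (∀ v → cnt (suc v) (map (d x) A) ≤ suc j)

  -- The invariant while a path is being attached. Spheres about the tip keep the old bound since
  -- attaching a vertex only shifts them; about any x, the vertices attached after both x and the
  -- start of the path lie at distances e + 1, ..., e + m, at most one per sphere.
  record Growing (j : ℕ) (t : V) (S : List V) : Set where
    field
      one  : ∀ {x} → x ∈ S → cnt 0 (map (d x) S) ≡ 1
      tip≤ : ∀ v → cnt v (map (d t) S) ≤ suc j
      all≤ : ∀ {x} → x ∈ S → ∃ λ e → ∃ λ m → (d x t ≡ e + m) ×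
               (∀ v → cnt (suc v) (map (d x) S) ≤ suc j + cnt (suc v) (map (e +_) (down m)))

  module _ {j : ℕ} where
    open Growing

    growing-step : ∀ {t y S} → t ∈ S → Step S t y → Growing j t S → Growing j y (y ∷ S)
    growing-step {t} {y} {S} t∈ st g = record { one = one′ ; tip≤ = tip≤′ ; all≤ = all≤′ }
      where
      open ≤-Reasoning
      from-y : map (d y) S ≡ map suc (map (d t) S)
      from-y = Eq.trans (map-cong-∈ S st) (map-∘ S)
      to-y : ∀ {x} → x ∈ S → d x y ≡ suc (d x t)
      to-y {x} x∈ = Eq.trans (d-sym x y) (Eq.trans (st x∈) (cong suc (d-sym t x)))
      one′ : ∀ {x} → x ∈ y ∷ S → cnt 0 (map (d x) (y ∷ S)) ≡ 1
      one′ (here refl) = cong₂ _+_ (cong (δ 0) (d-refl y)) (Eq.trans (cong (cnt 0) from-y) (cnt-∉ 0 (map suc (map (d t) S)) λ x∈ eq → case ∈-map⁻ suc x∈ of λ { (_ , _ , refl) → 0≢1+n eq }))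
      one′ {x} (there x∈)  = Eq.trans (cong (λ z → δ 0 z + cnt 0 (map (d x) S)) (to-y x∈)) (one g x∈)
      tip≤′ : ∀ v → cnt v (map (d y) (y ∷ S)) ≤ suc j
      tip≤′ zero    = ≤-trans (≤-reflexive (one′ (here refl))) (s≤s z≤n)
      tip≤′ (suc v) = begin
        δ (suc v) (d y y) + cnt (suc v) (map (d y) S) ≡⟨ cong₂ _+_ (cong (δ (suc v)) (d-refl y)) (cong (cnt (suc v)) from-y) ⟩
        cnt (suc v) (map suc (map (d t) S))           ≡⟨ cnt-suc v (map (d t) S) ⟩
        cnt v (map (d t) S)                           ≤⟨ tip≤ g v ⟩
        suc j                                         ∎
      all≤′ : ∀ {x} → x ∈ y ∷ S → ∃ λ e → ∃ λ m → (d x y ≡ e + m) ×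
               (∀ v → cnt (suc v) (map (d x) (y ∷ S)) ≤ suc j + cnt (suc v) (map (e +_) (down m)))
      all≤′ (here refl) = 0 , 0 , d-refl y , λ v → ≤-trans (tip≤′ (suc v)) (≤-reflexive (sym (+-identityʳ (suc j))))
      all≤′ {x} (there x∈) with all≤ g x∈
      ... | e , m , eq , bd = e , suc m , dxy , λ v → begin
        δ (suc v) (d x y) + cnt (suc v) (map (d x) S)          ≤⟨ +-mono-≤ (≤-reflexive (cong (δ (suc v)) dxy)) (bd v) ⟩
        δ (suc v) (e + suc m) + (suc j + cnt (suc v) (map (e +_) (down m))) ≡⟨ mid (δ (suc v) (e + suc m)) (suc j) _ ⟩
        suc j + (δ (suc v) (e + suc m) + cnt (suc v) (map (e +_) (down m))) ∎
        where
        mid : ∀ a b c → a + (b + c) ≡ b + (a + c)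
        mid = solve-∀
        dxy : d x y ≡ e + suc m
        dxy = Eq.trans (to-y x∈) (Eq.trans (cong suc eq) (sym (+-suc e m)))

    path-growing : ∀ {u A P} → SphereBound j A → u ∈ A → Path u A P → Growing j (tip u P) (P ++ A)
    path-growing {u} {A} sb u∈ [] = record
      { one  = λ x∈ → proj₁ (sb x∈)
      ; tip≤ = λ { zero → ≤-trans (≤-reflexive (proj₁ (sb u∈))) (s≤s z≤n) ; (suc v) → proj₂ (sb u∈) v }
      ; all≤ = λ {x} x∈ → d x u , 0 , sym (+-identityʳ _) , λ v → ≤-trans (proj₂ (sb x∈) v) (m≤m+n (suc j) 0) }
    path-growing {P = y ∷ P} sb u∈ (st ∷ path) = growing-step (tip∈ P u∈) st (path-growing sb u∈ path)

  sphere-bound : ∀ {ρ j A} → Runs ρ j A → SphereBound j A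
  sphere-bound {ρ} root (here refl) = cong (λ z → δ 0 z + 0) (d-refl ρ) , λ v → ≤-trans (≤-reflexive (cong (λ z → δ (suc v) z + 0) (d-refl ρ))) z≤n
  sphere-bound (run {j} rs u∈ path) x∈ = Growing.one g x∈ , λ v → case Growing.all≤ g x∈ of λ where
      (e , m , _ , bd) → ≤-trans (bd v) (≤-trans (+-monoʳ-≤ (suc j) (cnt-shifted-down (suc v) e m)) (≤-reflexive (+-comm (suc j) 1)))
    where g = path-growing (sphere-bound rs) u∈ path

  -- With the outer `suc` these are the distances from the next vertex of the path to all earlier
  -- ones, which covers an empty `P` as well.
  path-dists : ∀ {u A P} → Path u A P →
    map suc (map (d (tip u P)) (P ++ A)) ↭ down (length P) ++ map (suc (length P) +_) (map (d u) A)
  path-dists [] = ↭-refl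
  path-dists {u} {A} {y ∷ P} (st ∷ path) = begin
    suc (d y y) ∷ map suc (map (d y) (P ++ A))                        ≡⟨ cong₂ _∷_ (cong suc (d-refl y)) (cong (map suc) (map-cong-∈ (P ++ A) st)) ⟩
    1 ∷ map suc (map (suc ∘ d (tip u P)) (P ++ A))                    ≡⟨ cong (λ z → 1 ∷ map suc z) (map-∘ (P ++ A)) ⟩
    1 ∷ map suc (map suc (map (d (tip u P)) (P ++ A)))                ↭⟨ prep 1 (Perm.map⁺ suc (path-dists path)) ⟩
    1 ∷ map suc (down (length P) ++ map (suc (length P) +_) D)        ≡⟨ cong (1 ∷_) (map-++ suc (down (length P)) _) ⟩
    1 ∷ map suc (down (length P)) ++ map suc (map (suc (length P) +_) D) ≡⟨ cong (λ z → 1 ∷ map suc (down (length P)) ++ z) (map-∘ D) ⟨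
    (1 ∷ map suc (down (length P))) ++ map (suc (suc (length P)) +_) D ↭⟨ Perm.++⁺ʳ _ (down-∷ (length P)) ⟩
    down (suc (length P)) ++ map (suc (suc (length P)) +_) D          ∎
    where
    open PermutationReasoning
    D = map (d u) A

  path-from-base : ∀ {u A P} → u ∈ A → Path u A P → map (d u) P ≡ down (length P)
  path-from-base u∈ [] = refl
  path-from-base {u} {A} {y ∷ P} u∈ (st ∷ path) = cong₂ _∷_ (Eq.trans (d-sym u y) (Eq.trans (st (∈-++⁺ʳ P u∈)) (cong suc (to-tip u∈ path)))) (path-from-base u∈ path)
    where
    to-tip : ∀ {P} → u ∈ A → Path u A P → d (tip u P) u ≡ length P
    to-tip u∈ []          = d-refl u
    to-tip {y ∷ P} u∈ (st ∷ path) = Eq.trans (st (∈-++⁺ʳ P u∈)) (cong suc (to-tip u∈ path))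

  -- The index of a grown tree and its equality case

  module Energy (f : ℕ → ℚ) (f-anti : ∀ {a b} → 1 ≤ a → a < b → f b <ℚ f a) where
    open Weighted f f-anti
    open Spider f f-anti

    energy : List V → ℚ
    energy = pairSum (λ y a → f (d y a))

    -- The distance `suc p` to `u` joins the p distances along the path and completes the prefix
    -- `down (suc p)`; u plays the role of the centre.
    tip-energy : ∀ {u y A A′ P} → A ↭ u ∷ A′ → Step (P ++ A) (tip u P) y → Path u A P →
      sumOver (λ a → f (d y a)) (P ++ A) ≡ shifted 0 (down (suc (length P))) +ℚ shifted (suc (length P)) (map (d u) A′)
    tip-energy {u} {y} {A} {A′} {P} perm st path = begin
      sumOver (λ a → f (d y a)) (P ++ A)                         ≡⟨ sumOver-cong (P ++ A) (λ a∈ → cong f (st a∈)) ⟩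
      sumOver (λ a → f (suc (d (tip u P) a))) (P ++ A)           ≡⟨ sumOver-map (f ∘ suc) (d (tip u P)) (P ++ A) ⟨
      sumOver (f ∘ suc) (map (d (tip u P)) (P ++ A))             ≡⟨ sumOver-map f suc (map (d (tip u P)) (P ++ A)) ⟨
      sumOver f (map suc (map (d (tip u P)) (P ++ A)))           ≡⟨ sumOver-↭ f (path-dists path) ⟩
      sumOver f (down p ++ map (suc p +_) (map (d u) A))         ≡⟨ sumOver-++ f (down p) _ ⟩
      X +ℚ sumOver f (map (suc p +_) (map (d u) A))              ≡⟨ cong (X +ℚ_) (sumOver-map f (suc p +_) (map (d u) A)) ⟩
      X +ℚ shifted (suc p) (map (d u) A)                         ≡⟨ cong (X +ℚ_) (sumOver-↭ _ (Perm.map⁺ (d u) perm)) ⟩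
      X +ℚ (f (suc p + d u u) +ℚ Y)                              ≡⟨ cong (λ z → X +ℚ (f z +ℚ Y)) (Eq.trans (cong (suc p +_) (d-refl u)) (+-identityʳ (suc p))) ⟩
      X +ℚ (f (suc p) +ℚ Y)                                      ≡⟨ ℚ.+-assoc X (f (suc p)) Y ⟨
      (X +ℚ f (suc p)) +ℚ Y                                      ≡⟨ cong (_+ℚ Y) (ℚ.+-comm X (f (suc p))) ⟩
      (f (suc p) +ℚ X) +ℚ Y ∎
      where
      open ≡-Reasoning
      p = length P
      X = shifted 0 (down p)
      Y = shifted (suc p) (map (d u) A′)

    module _ {j u A A′} (sb : SphereBound j A) (perm : A ↭ u ∷ A′) where

      private
        u∈ : u ∈ A
        u∈ = Perm.∈-resp-↭ (↭-sym perm) (here refl)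

        cnt-A : ∀ v → cnt v (map (d u) A) ≡ δ v 0 + cnt v (map (d u) A′)
        cnt-A v = Eq.trans (cnt-↭ v (Perm.map⁺ (d u) perm)) (cong (λ z → δ v z + cnt v (map (d u) A′)) (d-refl u))

        no-zero : cnt 0 (map (d u) A′) ≡ 0
        no-zero = suc-injective (Eq.trans (sym (cnt-A 0)) (proj₁ (sb u∈)))

        caps : ∀ v → cnt v (map (d u) A′) ≤ suc j
        caps zero    = ≤-trans (≤-reflexive no-zero) z≤n
        caps (suc v) = ≤-trans (≤-reflexive (sym (cnt-A (suc v)))) (proj₂ (sb u∈) v)

        positive : ∀ xs → cnt 0 xs ≡ 0 → All (1 ≤_) xs
        positive []           _ = []
        positive (suc x ∷ xs) e = s≤s z≤n ∷ positive xs e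

        profile = λ e → greedy j e (length A′) (map (d u) A′) (length-map (d u) A′) (positive _ no-zero) caps

      -- Every path vertex sees `A′` through `u`, so the one list of distances from `u`, shifted by
      -- the position on the path, is compared with the greedy profile. In case of equality the
      -- newest vertex alone determines that list, hence the path must not be empty.
      path-energy : ∀ {P} → Path u A P →
        (energy (P ++ A) ≤ℚ energy A +ℚ branch (suc j) (length A′) (length P)) ×
        (energy (P ++ A) ≡ energy A +ℚ branch (suc j) (length A′) (length P) → 1 ≤ length P →
          map (d u) A′ ↭ levels (suc j) (length A′))
      path-energy [] = ℚ.≤-reflexive (sym (ℚ.+-identityʳ (energy A))) , λ _ ()
      path-energy {y ∷ P} (st ∷ path) = ≤-part , λ eq _ → proj₂ (profile (suc p)) (proj₂ (+ℚ-tight (ℚ.≤-refl {shifted 0 (down (suc p))}) (proj₁ (profile (suc p))) (Eq.trans (sym new≡) (proj₂ (+ℚ-tight (proj₁ ih) new≤ (Eq.trans eq (sym assoc)))))))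
        where
        p = length P
        ih = path-energy path
        new≡ = tip-energy perm st path
        new≤ : sumOver (λ a → f (d y a)) (P ++ A) ≤ℚ shifted 0 (down (suc p)) +ℚ shifted (suc p) (levels (suc j) (length A′))
        new≤ = ℚ.≤-trans (ℚ.≤-reflexive new≡) (ℚ.+-monoʳ-≤ (shifted 0 (down (suc p))) (proj₁ (profile (suc p))))
        assoc = ℚ.+-assoc (energy A) (branch (suc j) (length A′) p) (shifted 0 (down (suc p)) +ℚ shifted (suc p) (levels (suc j) (length A′)))
        ≤-part = ℚ.≤-trans (ℚ.+-mono-≤ (proj₁ ih) new≤) (ℚ.≤-reflexive assoc)

    length-run : ∀ {u : V} {A A′} P → A ↭ u ∷ A′ → length (P ++ A) ≡ suc (length A′ + length P)
    length-run {A = A} {A′} P perm = Eq.trans (length-++ P) (Eq.trans (cong (length P +_) (Perm.↭-length perm)) (+-comm (length P) (suc (length A′))))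

    energy≤ : ∀ {ρ j A N} → Runs ρ j A → length A ≡ suc N → energy A ≤ℚ balanced j N
    energy≤ root refl = ℚ.≤-reflexive (ℚ.+-identityʳ 0ℚ)
    energy≤ {N = N} (run {j} {A} {u} {P} rs u∈ path) len with remove u∈
    ... | A′ , perm = begin
      energy (P ++ A)                                              ≤⟨ proj₁ (path-energy (sphere-bound rs) perm path) ⟩
      energy A +ℚ branch (suc j) (length A′) (length P)            ≤⟨ ℚ.+-monoˡ-≤ (branch (suc j) (length A′) (length P)) (energy≤ rs (Perm.↭-length perm)) ⟩
      balanced j (length A′) +ℚ branch (suc j) (length A′) (length P) ≤⟨ spider≤ j N (length A′) (length P) (suc-injective (Eq.trans (sym (length-run P perm)) len)) ⟩
      balanced (suc j) N ∎
      where open ℚ.≤-Reasoning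

    -- `suc h` is the bottom level. `bottom≤` says that its vertices fit after h full levels of j +
    -- 2 vertices each, which is the room available when vertices are numbered level by level.
    record BalancedCentre (j N : ℕ) (A : List V) : Set where
      field
        centre   : V
        centre∈  : centre ∈ A
        h        : ℕ
        depth≤   : ∀ {x} → x ∈ A → d centre x ≤ suc h
        degree≡  : cnt 1 (map (d centre) A) ≡ suc (suc j)
        bottom≤  : cnt (suc h) (map (d centre) A) + h * suc (suc j) ≤ N

    energy≡⇒centre : ∀ {ρ j A N} → Runs ρ (suc j) A → 1 ≤ j → suc j ≤ N → length A ≡ suc (suc N) →
      energy A ≡ balanced (suc j) (suc N) → BalancedCentre j (suc N) A
    energy≡⇒centre {N = N} (run {j} {A} {u} {P} rs u∈ path) 1≤j j<N len eq with remove u∈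
    ... | A′ , perm = record { centre = u ; centre∈ = ∈-++⁺ʳ P u∈ ; h = h ; depth≤ = depth ; degree≡ = deg ; bottom≤ = bottom }
      where
      h = N / suc (suc j)
      N′ = length A′
      p = length P
      N′+p : N′ + p ≡ suc N
      N′+p = suc-injective (Eq.trans (sym (length-run P perm)) len)
      pe = path-energy (sphere-bound rs) perm path
      en = energy≤ rs (Perm.↭-length perm)
      br = branch (suc j) N′ p
      sp = spider-step j N N′ p N′+p
      -- The inequalities for the last path, for the earlier tree and for rebalancing form a closed
      -- chain; the first and the third are read off as equalities.
      tight : (energy (P ++ A) ≡ energy A +ℚ br) × (balanced j N′ +ℚ br ≡ balanced (suc j) (suc N))
      tight = ℚ.≤-antisym (proj₁ pe) (ℚ.≤-trans (ℚ.+-monoˡ-≤ br en) (ℚ.≤-trans (proj₁ sp) (ℚ.≤-reflexive (sym eq))))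
            , ℚ.≤-antisym (proj₁ sp) (ℚ.≤-trans (ℚ.≤-reflexive (sym eq)) (ℚ.≤-trans (proj₁ pe) (ℚ.+-monoˡ-≤ br en)))
      h*k≤N : h * suc j + h ≤ N
      h*k≤N = ≤-trans (≤-reflexive (distrib h j)) (m/n*n≤m N (suc (suc j)))
        where
        distrib : ∀ h c → h * suc c + h ≡ h * suc (suc c)
        distrib = solve-∀
      -- Either the last path reaches the bottom level `suc h`, or it stops at level h and the core
      -- reaches the bottom.
      shape : ((p ≡ suc h) × (N′ + h ≡ N)) ⊎ ((p ≡ h) × (∃ λ N″ → (N′ ≡ suc N″) × (N″ / suc j ≡ h)))
      shape with proj₂ sp (proj₂ tight) 1≤j j<N
      ... | inj₁ e = inj₁ (e , suc-injective (Eq.trans (sym (+-suc N′ h)) (Eq.trans (cong (N′ +_) (sym e)) N′+p)))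
      ... | inj₂ (N″ , e₁ , e₂ , e₃) = inj₂ (suc-injective e₃ , N″ , e₁ , suc-injective e₂)
      1≤p : 1 ≤ p
      1≤p with shape
      ... | inj₁ (e , _) = subst (1 ≤_) (sym e) (s≤s z≤n)
      ... | inj₂ (e , N″ , e₁ , e₂) with p ≟ 0
      ...   | no ne = n≢0⇒n>0 ne
      -- This excludes a padding path in last place: with p = h = 0 the N + 1 non-central vertices
      -- would all lie at level 1 of a core with j + 1 branches, against j + 1 ≤ N.
      ...   | yes z = contradiction (≤-trans j<N (≤-reflexive (sym N″≡N))) (<⇒≱ N″<)
        where
        N″≡N : N″ ≡ N
        N″≡N = suc-injective (Eq.trans (sym e₁) (Eq.trans (sym (+-identityʳ N′)) (Eq.trans (cong (N′ +_) (sym z)) N′+p)))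
        N″< : N″ < suc j
        N″< = subst (N″ <_) (*-identityˡ (suc j)) (subst (λ z → N″ < suc z * suc j) (Eq.trans e₂ (Eq.trans (sym e) z)) (m<[1+m/n]*n N″ j))
      profile : map (d u) A′ ↭ levels (suc j) N′
      profile = proj₂ pe (proj₁ tight) 1≤p
      dists : map (d u) (P ++ A) ↭ down p ++ 0 ∷ levels (suc j) N′
      dists = ↭-trans (↭-reflexive (map-++ (d u) P A)) (Perm.++⁺ (↭-reflexive (path-from-base u∈ path))
                (↭-trans (Perm.map⁺ (d u) perm) (subst (λ z → z ∷ map (d u) A′ ↭ 0 ∷ levels (suc j) N′) (sym (d-refl u)) (prep 0 profile))))
      cnt-dists : ∀ v → cnt (suc v) (map (d u) (P ++ A)) ≡ cnt (suc v) (down p) + suc j ⊓ (N′ ∸ v * suc j)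
      cnt-dists v = Eq.trans (cnt-↭ (suc v) dists) (Eq.trans (cnt-++ (suc v) (down p) _) (cong (cnt (suc v) (down p) +_) (cnt-levels j v N′)))
      N′≤ : N′ ≤ suc h * suc j
      N′≤ with shape
      ... | inj₂ (_ , N″ , e₁ , e₂) = ≤-trans (≤-reflexive e₁) (subst (λ z → N″ < suc z * suc j) e₂ (m<[1+m/n]*n N″ j))
      ... | inj₁ (_ , e) = +-cancelʳ-≤ h _ _ (≤-pred (begin
          suc (N′ + h)                 ≡⟨ cong suc e ⟩
          suc N                        ≤⟨ m<[1+m/n]*n N (suc j) ⟩
          suc h * suc (suc j)          ≡⟨ expand h j ⟩
          suc (suc h * suc j + h)      ∎))
        where
        open ≤-Reasoning
        expand : ∀ h j → suc h * suc (suc j) ≡ suc (suc h * suc j + h)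
        expand = solve-∀
      hj≤N′ : h * suc j ≤ N′
      hj≤N′ with shape
      ... | inj₁ (_ , e) = +-cancelʳ-≤ h _ _ (≤-trans h*k≤N (≤-reflexive (sym e)))
      ... | inj₂ (_ , N″ , e₁ , e₂) = ≤-trans (subst (λ z → z * suc j ≤ N″) e₂ (m/n*n≤m N″ (suc j))) (≤-trans (n≤1+n N″) (≤-reflexive (sym e₁)))
      p≤ : p ≤ suc h
      p≤ with shape
      ... | inj₁ (e , _) = ≤-reflexive e
      ... | inj₂ (e , _) = ≤-trans (≤-reflexive e) (n≤1+n h)
      depth : ∀ {x} → x ∈ P ++ A → d u x ≤ suc h
      depth x∈ = All.lookup (Perm.All-resp-↭ (↭-sym dists) (AllP.++⁺ (All.map (λ q → ≤-trans q p≤) (down-≤ p)) (z≤n ∷ levels-≤ j (suc h) N′ N′≤))) (∈-map⁺ (d u) x∈)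
      j<N′ : suc j ≤ N′
      j<N′ with h ≟ 0
      ... | no ne = ≤-trans (≤-trans (≤-reflexive (sym (*-identityˡ (suc j)))) (*-monoˡ-≤ (suc j) (n≢0⇒n>0 ne))) hj≤N′
      ... | yes z with shape
      ...   | inj₁ (_ , e) = ≤-trans j<N (≤-reflexive (Eq.trans (sym e) (Eq.trans (cong (N′ +_) z) (+-identityʳ N′))))
      ...   | inj₂ (e , _) = contradiction (Eq.trans e z) (>⇒≢ 1≤p)
      deg : cnt 1 (map (d u) (P ++ A)) ≡ suc (suc j)
      deg = Eq.trans (cnt-dists 0) (cong₂ _+_ (cnt-down-1 0 p 1≤p) (m≤n⇒m⊓n≡m j<N′))
      -- The bottom level holds at most the end of the path and the core vertices left over after h
      -- full levels of j + 1; the path fills the remaining place of each of these h levels.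
      bottom : cnt (suc h) (map (d u) (P ++ A)) + h * suc (suc j) ≤ suc N
      bottom = begin
        cnt (suc h) (map (d u) (P ++ A)) + h * suc (suc j)            ≡⟨ cong (_+ h * suc (suc j)) (cnt-dists h) ⟩
        X + suc j ⊓ (N′ ∸ h * suc j) + h * suc (suc j)                ≤⟨ +-monoˡ-≤ (h * suc (suc j)) (+-monoʳ-≤ X (m⊓n≤n (suc j) _)) ⟩
        X + (N′ ∸ h * suc j) + h * suc (suc j)                        ≡⟨ expand X (N′ ∸ h * suc j) h j ⟩
        ((N′ ∸ h * suc j) + h * suc j) + (X + h)                      ≡⟨ cong (_+ (X + h)) (m∸n+n≡m hj≤N′) ⟩
        N′ + (X + h)                                                  ≤⟨ +-monoʳ-≤ N′ X+h≤p ⟩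
        N′ + p                                                        ≡⟨ N′+p ⟩
        suc N                                                         ∎
        where
        open ≤-Reasoning
        X = cnt (suc h) (down p)
        expand : ∀ x y h j → x + y + h * suc (suc j) ≡ (y + h * suc j) + (x + h)
        expand = solve-∀
        X+h≤p : X + h ≤ p
        X+h≤p with shape
        ... | inj₁ (e , _) = ≤-trans (+-monoˡ-≤ h (cnt-down-≤1 (suc h) p)) (≤-reflexive (sym e))
        ... | inj₂ (e , _) = ≤-reflexive (Eq.trans (cong (_+ h) (cnt-down-> (s≤s (≤-reflexive e)))) (sym e))

-- Lists without repetition

∈-tail : ∀ {A : Set} {x z : A} {xs} → z ∈ x ∷ xs → z ≢ x → z ∈ xs
∈-tail (here e)   ne = contradiction e ne
∈-tail (there z∈) _  = z∈

unique-∉ : ∀ {A : Set} {x z : A} {xs} → Unique (x ∷ xs) → z ∈ xs → z ≢ x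
unique-∉ u z∈ refl = Unique.Unique[x∷xs]⇒x∉xs u z∈

∉⇒All≢ : ∀ {A : Set} {x : A} {xs} → x ∉ xs → All (x ≢_) xs
∉⇒All≢ x∉ = All.tabulate λ z∈ e → x∉ (subst (_∈ _) (sym e) z∈)

unique-⊆-length : ∀ {A : Set} {xs ys : List A} → Unique xs → (∀ {z} → z ∈ xs → z ∈ ys) → length xs ≤ length ys
unique-⊆-length {xs = []}     _ _ = z≤n
unique-⊆-length {xs = x ∷ xs} u@(_ ∷ u′) sub with remove (sub (here refl))
... | ys′ , perm = ≤-trans (s≤s (unique-⊆-length u′ λ z∈ → ∈-tail (Perm.∈-resp-↭ perm (sub (there z∈))) (unique-∉ u z∈)))
                           (≤-reflexive (sym (Perm.↭-length perm)))

Unique-resp-↭ : ∀ {A : Set} {xs ys : List A} → xs ↭ ys → Unique xs → Unique ys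
Unique-resp-↭ refl        u = u
Unique-resp-↭ (prep x p)  (a ∷ u) = Perm.All-resp-↭ p a ∷ Unique-resp-↭ p u
Unique-resp-↭ (swap x y p) ((xy ∷ a) ∷ b ∷ u) = ((xy ∘ sym) ∷ Perm.All-resp-↭ p b) ∷ Perm.All-resp-↭ p a ∷ Unique-resp-↭ p u
Unique-resp-↭ (trans p q) u = Unique-resp-↭ q (Unique-resp-↭ p u)

unique-same⇒↭ : ∀ {A : Set} {xs ys : List A} → Unique xs → Unique ys →
  (∀ {z} → z ∈ xs → z ∈ ys) → (∀ {z} → z ∈ ys → z ∈ xs) → xs ↭ ys
unique-same⇒↭ {xs = []} {[]}     _ _ _ _ = ↭-refl
unique-same⇒↭ {xs = []} {y ∷ ys} _ _ _ q = contradiction (q (here refl)) λ ()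
unique-same⇒↭ {xs = x ∷ xs} u@(_ ∷ u′) v p q with remove (p (here refl))
... | ys′ , perm with Unique-resp-↭ perm v
...   | w@(_ ∷ w′) = ↭-trans (prep x (unique-same⇒↭ u′ w′
          (λ z∈ → ∈-tail (Perm.∈-resp-↭ perm (p (there z∈))) (unique-∉ u z∈))
          (λ z∈ → ∈-tail (q (Perm.∈-resp-↭ (↭-sym perm) (there z∈))) (unique-∉ w z∈)))) (↭-sym perm)

complete⇒↭allFin : ∀ {n} {A : List (Fin n)} → Unique A → (∀ z → z ∈ A) → A ↭ allFin n
complete⇒↭allFin {n} u c = unique-same⇒↭ u (Unique.allFin⁺ n) (λ _ → ∈-allFin _) (λ _ → c _)

unique-length≤ : ∀ {n} {A : List (Fin n)} → Unique A → length A ≤ n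
unique-length≤ {n} u = ≤-trans (unique-⊆-length u (λ _ → ∈-allFin _)) (≤-reflexive (length-tabulate {n = n} id))

-- Reachability

∧-true : ∀ {a b} → a ∧ b ≡ true → (a ≡ true) × (b ≡ true)
∧-true {true} {true} _ = refl , refl

∨-true : ∀ {a b} → a ∨ b ≡ true → (a ≡ true) ⊎ (b ≡ true)
∨-true {true}         _ = inj₁ refl
∨-true {false} {true} _ = inj₂ refl

∨-trueʳ : ∀ a {b} → b ≡ true → a ∨ b ≡ true
∨-trueʳ true  _ = refl
∨-trueʳ false e = e

any-true⁻ : ∀ {A : Set} {p : A → Bool} xs → any p xs ≡ true → ∃ λ x → p x ≡ true
any-true⁻ (x ∷ xs) e with ∨-true e
... | inj₁ px = x , px
... | inj₂ e′ = any-true⁻ xs e′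

any-true⁺ : ∀ {A : Set} {p : A → Bool} {x xs} → x ∈ xs → p x ≡ true → any p xs ≡ true
any-true⁺ {p = p} (here refl)      px rewrite px = refl
any-true⁺ {p = p} (there {x} x∈) px = ∨-trueʳ (p x) (any-true⁺ x∈ px)

isYes-≟ : ∀ {n} {x y : Fin n} → isYes (x Fin.≟ y) ≡ true → x ≡ y
isYes-≟ {x = x} {y} e with x Fin.≟ y
... | yes p = p
... | no _  = contradiction e λ ()

isYes-refl : ∀ {n} (x : Fin n) → isYes (x Fin.≟ x) ≡ true
isYes-refl x with x Fin.≟ x
... | yes _ = refl
... | no ne = contradiction refl ne

module _ {n} {G : Graph n} where

  reach-suc : ∀ {k x y z} → G x z ≡ true → reach G k z y ≡ true → reach G (suc k) x y ≡ true
  reach-suc {k} {x} {y} {z} e r = ∨-trueʳ (reach G k x y) (any-true⁺ (∈-allFin z) (Eq.trans (cong (_∧ reach G k z y) e) r))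

  reach-suc⁻ : ∀ {k x y} → reach G (suc k) x y ≡ true → (reach G k x y ≡ true) ⊎ (∃ λ z → (G x z ≡ true) × (reach G k z y ≡ true))
  reach-suc⁻ {k} {x} {y} r with ∨-true {reach G k x y} r
  ... | inj₁ r′ = inj₁ r′
  ... | inj₂ a with any-true⁻ (allFin n) a
  ...   | z , e = inj₂ (z , ∧-true e)

least-≡ : ∀ p b k → p k ≡ true → (∀ {i} → p i ≡ true → k ≤ i) → k < b → least p b ≡ k
least-≡ p (suc b) zero    pk lo k<b rewrite pk = refl
least-≡ p (suc b) (suc k) pk lo (s≤s k<b) with p 0 in eq
... | true  = contradiction (lo eq) λ ()
... | false = cong suc (least-≡ (p ∘ suc) b k pk (≤-pred ∘ lo) k<b)

-- Growing a tree vertex by vertex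

module Growth {n : ℕ} (G : Graph n) (simple : IsSimple G) where

  V : Set
  V = Fin n

  G-sym : ∀ {x y} → G x y ≡ true → G y x ≡ true
  G-sym {x} {y} e = Eq.trans (sym (proj₁ simple x y)) e

  G-irrefl : ∀ {x} → G x x ≢ true
  G-irrefl {x} e = case Eq.trans (sym e) (proj₂ simple x) of λ ()

  record Attach (A : List V) (x y : V) : Set where
    constructor attach
    field
      old  : x ∈ A
      new  : y ∉ A
      edge : G y x ≡ true
      only : ∀ {a} → a ∈ A → G y a ≡ true → a ≡ x
  open Attach

  data Grown : List V → Set where
    root : ∀ ρ → Grown (ρ ∷ [])
    grow : ∀ {A x y} → Attach A x y → Grown A → Grown (y ∷ A)

  -- The tree distance, computed along the growth order; its values outside `A` are junk.
  D : ∀ {A} → Grown A → V → V → ℕ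
  D (root ρ)             a b = 0
  D (grow {x = x} {y} at g) a b with a Fin.≟ y | b Fin.≟ y
  ... | yes _ | yes _ = 0
  ... | yes _ | no _  = suc (D g x b)
  ... | no _  | yes _ = suc (D g a x)
  ... | no _  | no _  = D g a b

  module _ {A x y} (at : Attach A x y) (g : Grown A) where

    D-new-new : D (grow at g) y y ≡ 0
    D-new-new with y Fin.≟ y
    ... | yes _ = refl
    ... | no ne = contradiction refl ne

    D-new-old : ∀ {b} → b ≢ y → D (grow at g) y b ≡ suc (D g x b)
    D-new-old {b} ne with y Fin.≟ y | b Fin.≟ y
    ... | yes _ | yes e = contradiction e ne
    ... | yes _ | no _  = refl
    ... | no ne′ | _    = contradiction refl ne′

    D-old-new : ∀ {a} → a ≢ y → D (grow at g) a y ≡ suc (D g a x)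
    D-old-new {a} ne with a Fin.≟ y | y Fin.≟ y
    ... | yes e | _     = contradiction e ne
    ... | no _  | yes _ = refl
    ... | no _  | no ne′ = contradiction refl ne′

    D-old-old : ∀ {a b} → a ≢ y → b ≢ y → D (grow at g) a b ≡ D g a b
    D-old-old {a} {b} na nb with a Fin.≟ y | b Fin.≟ y
    ... | yes e | _     = contradiction e na
    ... | no _  | yes e = contradiction e nb
    ... | no _  | no _  = refl

    old≢new : ∀ {a} → a ∈ A → a ≢ y
    old≢new a∈ refl = new at a∈

  D-refl : ∀ {A} (g : Grown A) a → D g a a ≡ 0
  D-refl (root ρ) a = refl
  D-refl (grow {y = y} at g) a with a Fin.≟ y
  ... | yes _ = refl
  ... | no _  = D-refl g a

  D-sym : ∀ {A} (g : Grown A) a b → D g a b ≡ D g b a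
  D-sym (root ρ) a b = refl
  D-sym (grow {x = x} {y} at g) a b with a Fin.≟ y | b Fin.≟ y
  ... | yes _ | yes _ = refl
  ... | yes _ | no _  = cong suc (D-sym g x b)
  ... | no _  | yes _ = cong suc (D-sym g a x)
  ... | no _  | no _  = D-sym g a b

  D<length : ∀ {A} (g : Grown A) a b → D g a b < length A
  D<length (root ρ) a b = s≤s z≤n
  D<length (grow {x = x} {y} at g) a b with a Fin.≟ y | b Fin.≟ y
  ... | yes _ | yes _ = s≤s z≤n
  ... | yes _ | no _  = s≤s (D<length g x b)
  ... | no _  | yes _ = s≤s (D<length g a x)
  ... | no _  | no _  = m<n⇒m<1+n (D<length g a b)

  -- The Lipschitz property along edges, which makes `D` a lower bound for the lengths of walks.
  D-edge : ∀ {A} (g : Grown A) {a b c} → a ∈ A → c ∈ A → b ∈ A → G a c ≡ true → D g a b ≤ suc (D g c b)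
  D-edge (root ρ) _ _ _ _ = z≤n
  D-edge (grow {x = x} {y} at g) (here refl) (here refl) b∈ e = contradiction e G-irrefl
  D-edge (grow {x = x} {y} at g) {b = b} (here refl) (there c∈) b∈ e with only at c∈ e | b∈
  ... | refl | here refl  = ≤-trans (≤-reflexive (D-new-new at g)) z≤n
  ... | refl | there b∈′ = ≤-reflexive (Eq.trans (D-new-old at g nb) (cong suc (sym (D-old-old at g (old≢new at g c∈) nb))))
    where nb = old≢new at g b∈′
  D-edge (grow {x = x} {y} at g) (there a∈) (here refl) b∈ e with only at a∈ (G-sym e) | b∈
  ... | refl | here refl  = ≤-trans (≤-reflexive (Eq.trans (D-old-new at g (old≢new at g a∈)) (cong suc (D-refl g x)))) (s≤s z≤n)
  ... | refl | there b∈′ = ≤-trans (≤-reflexive (D-old-old at g (old≢new at g a∈) nb)) (≤-trans (m≤n+m _ 2) (≤-reflexive (cong suc (sym (D-new-old at g nb)))))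
    where nb = old≢new at g b∈′
  D-edge (grow {x = x} {y} at g) (there a∈) (there c∈) (here refl) e =
    subst₂ (λ s t → s ≤ suc t) (sym (D-old-new at g (old≢new at g a∈))) (sym (D-old-new at g (old≢new at g c∈))) (s≤s (D-edge g a∈ c∈ (old at) e))
  D-edge (grow {x = x} {y} at g) (there a∈) (there c∈) (there b∈) e =
    subst₂ (λ s t → s ≤ suc t) (sym (D-old-old at g (old≢new at g a∈) nb)) (sym (D-old-old at g (old≢new at g c∈) nb)) (D-edge g a∈ c∈ b∈ e)
    where nb = old≢new at g b∈

  -- Descending along such neighbours produces a walk of length `D`.
  D-step : ∀ {A} (g : Grown A) {a b} → a ∈ A → b ∈ A → a ≢ b → ∃ λ c → (c ∈ A) × (G a c ≡ true) × (D g a b ≡ suc (D g c b))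
  D-step (root ρ) (here refl) (here refl) ne = contradiction refl ne
  D-step (grow at g) (here refl) (here refl) ne = contradiction refl ne
  D-step (grow {x = x} at g) (here refl) (there b∈) ne =
    x , there (old at) , edge at , Eq.trans (D-new-old at g nb) (cong suc (sym (D-old-old at g (old≢new at g (old at)) nb)))
    where nb = old≢new at g b∈
  D-step (grow {x = x} {y} at g) {a} (there a∈) (here refl) ne with a Fin.≟ x
  ... | yes refl = y , here refl , G-sym (edge at) , Eq.trans (D-old-new at g ne) (cong suc (Eq.trans (D-refl g x) (sym (D-new-new at g))))
  ... | no ne′ with D-step g a∈ (old at) ne′
  ...   | c , c∈ , e , eq = c , there c∈ , e , Eq.trans (D-old-new at g ne) (cong suc (Eq.trans eq (sym (D-old-new at g (old≢new at g c∈)))))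
  D-step (grow at g) (there a∈) (there b∈) ne with D-step g a∈ b∈ ne
  ... | c , c∈ , e , eq = c , there c∈ , e , Eq.trans (D-old-old at g (old≢new at g a∈) nb) (Eq.trans eq (cong suc (sym (D-old-old at g (old≢new at g c∈) nb))))
    where nb = old≢new at g b∈

  grown-unique : ∀ {A} → Grown A → Unique A
  grown-unique (root ρ)    = [] ∷ []
  grown-unique (grow at g) = ∉⇒All≢ (new at) ∷ grown-unique g

  module _ {A} (g : Grown A) (complete : ∀ z → z ∈ A) where

    reach⇒D≤ : ∀ k {a b} → reach G k a b ≡ true → D g a b ≤ k
    reach⇒D≤ zero    {a} r with isYes-≟ r
    ... | refl = ≤-reflexive (D-refl g a)
    reach⇒D≤ (suc k) {a} {b} r with reach-suc⁻ {k = k} r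
    ... | inj₁ r′ = ≤-trans (reach⇒D≤ k r′) (n≤1+n k)
    ... | inj₂ (z , e , r′) = ≤-trans (D-edge g (complete a) (complete z) (complete b) e) (s≤s (reach⇒D≤ k r′))

    D⇒reach : ∀ k {a b} → D g a b ≡ k → reach G k a b ≡ true
    D⇒reach k {a} {b} eq with a Fin.≟ b
    D⇒reach zero    {a} eq | yes refl = isYes-refl a
    D⇒reach (suc k) {a} eq | yes refl = contradiction (Eq.trans (sym (D-refl g a)) eq) 0≢1+n
    D⇒reach k {a} {b} eq | no ne with D-step g (complete a) (complete b) ne
    D⇒reach zero    eq | no ne | c , _ , e , eq′ = contradiction (Eq.trans (sym eq) eq′) 0≢1+n
    D⇒reach (suc k) eq | no ne | c , _ , e , eq′ = reach-suc {k = k} e (D⇒reach k (suc-injective (Eq.trans (sym eq′) eq)))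

    dist≡D : ∀ a b → dist G a b ≡ D g a b
    -- `least` searches only below `n`; `D` stays below the length of the duplicate-free list `A`,
    -- which is at most `n`.
    dist≡D a b = least-≡ (λ k → reach G k a b) n (D g a b) (D⇒reach _ refl) (λ {i} → reach⇒D≤ i)
      (≤-trans (D<length g a b) (unique-length≤ (grown-unique g)))

  grown-nonempty : ∀ {A} → Grown A → ∃ λ x → x ∈ A
  grown-nonempty (root ρ)    = ρ , here refl
  grown-nonempty (grow _ _)  = _ , here refl

  module Search (connected : Connected G) (acyclic : Acyclic G) where

    data Walk : V → V → List V → Set where
      done : ∀ {a} → Walk a a (a ∷ [])
      step : ∀ {a b c l} → G a c ≡ true → Walk c b l → Walk a b (a ∷ l)

    walk-chain : ∀ {a b l z} → Walk a b l → G b z ≡ true → Chain G (l ++ [ z ])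
    walk-chain done e = e , tt
    walk-chain (step e′ done) e = e′ , e , tt
    walk-chain (step e′ w@(step _ _)) e = e′ , walk-chain w e

    walk-snoc : ∀ {a b l z} → Walk a b l → G b z ≡ true → Walk a z (l ++ [ z ])
    walk-snoc done       e = step e done
    walk-snoc (step f w) e = step f (walk-snoc w e)

    walk-cycle : ∀ {y a b l} → G y a ≡ true → Walk a b l → G b y ≡ true → Chain G (y ∷ l ++ [ y ])
    walk-cycle e done e′ = e , e′ , tt
    walk-cycle e w@(step _ _) e′ = e , walk-chain w e′

    walk-length : ∀ {a b l} → Walk a b l → a ≢ b → 2 ≤ length l
    walk-length done ne = contradiction refl ne
    walk-length (step _ done) _ = s≤s (s≤s z≤n)
    walk-length (step _ (step _ _)) _ = s≤s (s≤s z≤n)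

    simple-walk : ∀ {A} → Grown A → ∀ {a b} → a ∈ A → b ∈ A → ∃ λ l → Walk a b l × Unique l × (∀ {z} → z ∈ l → z ∈ A)
    simple-walk (root ρ) (here refl) (here refl) = ρ ∷ [] , done , [] ∷ [] , id
    simple-walk (grow {y = y} at g) (here refl) (here refl) = y ∷ [] , done , [] ∷ [] , λ { (here e) → here e }
    simple-walk (grow {y = y} at g) (here refl) (there b∈) with simple-walk g (old at) b∈
    ... | l , w , u , sub = y ∷ l , step (edge at) w , ∉⇒All≢ (new at ∘ sub) ∷ u , λ { (here e) → here e ; (there z∈) → there (sub z∈) }
    simple-walk (grow {y = y} at g) (there a∈) (here refl) with simple-walk g a∈ (old at)
    ... | l , w , u , sub = l ++ [ y ] , walk-snoc w (G-sym (edge at)) , Unique.++⁺ u ([] ∷ []) (λ { (z∈ , here refl) → new at (sub z∈) }) ,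
          λ z∈ → [ there ∘ sub , (λ { (here e) → here e }) ]′ (∈-++⁻ l z∈)
    simple-walk (grow {y = y} at g) (there a∈) (there b∈) with simple-walk g a∈ b∈
    ... | l , w , u , sub = l , w , u , there ∘ sub

    -- A second neighbour of `y` in `A` would be joined to `x` by a simple walk inside `A`, and the
    -- walk would close up to a cycle through `y`.
    attachable : ∀ {A x y} → Grown A → x ∈ A → y ∉ A → G y x ≡ true → Attach A x y
    attachable {A} {x} {y} g x∈ y∉ e = attach x∈ y∉ e λ {a} a∈ e′ → only-x a∈ e′
      where
      only-x : ∀ {a} → a ∈ A → G y a ≡ true → a ≡ x
      only-x {a} a∈ e′ with x Fin.≟ a
      ... | yes eq = sym eq
      ... | no ne with simple-walk g x∈ a∈
      ...   | l , w , u , sub = contradiction (y , l , walk-length w ne , ∉⇒All≢ (y∉ ∘ sub) ∷ u , walk-cycle e w (G-sym e′)) acyclic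

    _∈?_ : (z : V) (A : List V) → Dec (z ∈ A)
    z ∈? A = Any.any? (z Fin.≟_) A

    -- Follow the walk up to its first entry into `A`.
    frontier : ∀ {A z a} k → z ∉ A → a ∈ A → reach G k z a ≡ true → ∃ λ x → ∃ λ y → (x ∈ A) × (y ∉ A) × (G y x ≡ true)
    frontier zero    z∉ a∈ r with isYes-≟ r
    ... | refl = contradiction a∈ z∉
    frontier {A} {z} (suc k) z∉ a∈ r with reach-suc⁻ {k = k} r
    ... | inj₁ r′ = frontier k z∉ a∈ r′
    ... | inj₂ (w , e , r′) with w ∈? A
    ...   | yes w∈ = w , z , w∈ , z∉ , e
    ...   | no w∉  = frontier k w∉ a∈ r′

    data GPath (u : V) (A : List V) : List V → Set where
      []  : GPath u A []
      _∷_ : ∀ {y P} → Attach (P ++ A) (tip u P) y → GPath u A P → GPath u A (y ∷ P)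

    data GRuns (ρ : V) : ℕ → List V → Set where
      root : GRuns ρ 0 (ρ ∷ [])
      run  : ∀ {j A u P} → GRuns ρ j A → u ∈ A → GPath u A P → GRuns ρ (suc j) (P ++ A)

    path-grown : ∀ {u A P} → Grown A → GPath u A P → Grown (P ++ A)
    path-grown g []          = g
    path-grown g (at ∷ path) = grow at (path-grown g path)

    runs-grown : ∀ {ρ j A} → GRuns ρ j A → Grown A
    runs-grown root             = root _
    runs-grown (run rs _ path)  = path-grown (runs-grown rs) path

    Leaf : V → Set
    Leaf x = ∀ {y z} → G x y ≡ true → G x z ≡ true → y ≡ z

    -- One vertex per path, namely the one where it got stuck. It is a leaf of the whole graph, so
    -- no later path can start there and the list remains one of distinct leaves.
    record Ends (ρ : V) (j : ℕ) (A : List V) : Set where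
      field
        ends     : List V
        length≡  : length ends ≡ j
        distinct : Unique (ρ ∷ ends)
        leaves   : All Leaf ends
        inside   : ∀ {z} → z ∈ ρ ∷ ends → z ∈ A

    record Decomposition (ρ : V) : Set where
      field
        {j}      : ℕ
        {A}      : List V
        runs     : GRuns ρ j A
        complete : ∀ z → z ∈ A
        runEnds  : Ends ρ j A

    tooLong : ∀ {A z} → Grown A → z ∉ A → n ≤ length A → ⊥
    tooLong g z∉ le = 1+n≰n (≤-trans (unique-length≤ (∉⇒All≢ z∉ ∷ grown-unique g)) le)

    -- Prolong the current path as long as possible; when stuck, its tip is a leaf and a new path is started.
    extend : ∀ {ρ j A u y P} m → n ≤ m + length (y ∷ P ++ A) → GRuns ρ j A → u ∈ A → GPath u A (y ∷ P) → Ends ρ j A → Decomposition ρ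
    restart : ∀ {ρ j A} m → n ≤ m + length A → GRuns ρ j A → Ends ρ j A → Decomposition ρ

    extend {ρ} {j} {A} {u} {y} {P} m le rs u∈ path@(at ∷ _) es with Fin.any? (λ z → ¬? (z ∈? (y ∷ P ++ A)) ×-dec (G z y Bool.≟ true))
    -- The fuel `m` bounds the number of missing vertices; at zero none can be left outside.
    extend {ρ} {j} {A} {u} {y} {P} zero    le rs u∈ path es | yes (z , z∉ , e) = ⊥-elim (tooLong (path-grown (runs-grown rs) path) z∉ le)
    extend {ρ} {j} {A} {u} {y} {P} (suc m) le rs u∈ path es | yes (z , z∉ , e) =
      extend m (≤-trans le (≤-reflexive (sym (+-suc m _)))) rs u∈ (attachable (path-grown (runs-grown rs) path) (here refl) z∉ e ∷ path) es
    extend {ρ} {j} {A} {u} {y} {P} m le rs u∈ path@(at ∷ _) es | no none = restart m le (run rs u∈ path) record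
        { ends     = y ∷ ends
        ; length≡  = cong suc length≡
        ; distinct = Unique-resp-↭ (swap y ρ ↭-refl) (∉⇒All≢ (λ y∈ → new at (∈-++⁺ʳ P (inside y∈))) ∷ distinct)
        ; leaves   = leaf ∷ leaves
        ; inside   = λ { (here e) → there (∈-++⁺ʳ P (inside (here e))) ; (there (here e)) → here e ; (there (there z∈)) → there (∈-++⁺ʳ P (inside (there z∈))) } }
      where
      open Ends es
      nbr : ∀ {z} → G y z ≡ true → z ≡ tip u P
      nbr {z} e with z ∈? (y ∷ P ++ A)
      ... | no z∉            = contradiction (z , z∉ , G-sym e) none
      ... | yes (here refl)  = contradiction e G-irrefl
      ... | yes (there z∈)   = only at z∈ e
      leaf : Leaf y
      leaf e e′ = Eq.trans (nbr e) (sym (nbr e′))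

    restart {ρ} {j} {A} m le rs es with Fin.any? (λ z → ¬? (z ∈? A))
    ... | no none = record { runs = rs ; complete = all ; runEnds = es }
      where
      all : ∀ z → z ∈ A
      all z with z ∈? A
      ... | yes z∈ = z∈
      ... | no z∉  = contradiction (z , z∉) none
    restart {ρ} {j} {A} zero    le rs es | yes (z , z∉) = ⊥-elim (tooLong (runs-grown rs) z∉ le)
    restart {ρ} {j} {A} (suc m) le rs es | yes (z , z∉) with grown-nonempty (runs-grown rs)
    ... | a , a∈ with frontier (proj₁ (connected z a)) z∉ a∈ (proj₂ (connected z a))
    ...   | x , y , x∈ , y∉ , e = extend m (≤-trans le (≤-reflexive (sym (+-suc m _)))) rs x∈ (attachable (runs-grown rs) x∈ y∉ e ∷ []) es

    decompose : ∀ ρ → Decomposition ρ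
    decompose ρ = restart n (m≤m+n n _) root record { ends = [] ; length≡ = refl ; distinct = [] ∷ [] ; leaves = [] ; inside = id }

-- Reciprocal weights and sums of natural numbers

inv-anti : ∀ {a b} → 1 ≤ a → a < b → inv b <ℚ inv a
inv-anti {suc a} {suc b} _ a<b = subst₂ _<ℚ_ (sym (ℚ.normalize-coprime (1-coprimeTo (suc b)))) (sym (ℚ.normalize-coprime (1-coprimeTo (suc a))))
  (*<* (ℤ.+<+ (subst₂ _<_ (sym (*-identityˡ (suc a))) (sym (*-identityˡ (suc b))) a<b)))

module _ {A : Set} where

  sumN : (A → ℕ) → List A → ℕ
  sumN g xs = sum (map g xs)

  sumN-↭ : ∀ g {xs ys} → xs ↭ ys → sumN g xs ≡ sumN g ys
  sumN-↭ g p = sum-↭ (Perm.map⁺ g p)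

  sumN-++ : ∀ g xs ys → sumN g (xs ++ ys) ≡ sumN g xs + sumN g ys
  sumN-++ g []       ys = refl
  sumN-++ g (x ∷ xs) ys = Eq.trans (cong (g x +_) (sumN-++ g xs ys)) (sym (+-assoc (g x) _ _))

  sumN-cong : ∀ {g h : A → ℕ} xs → (∀ {x} → x ∈ xs → g x ≡ h x) → sumN g xs ≡ sumN h xs
  sumN-cong []       e = refl
  sumN-cong (x ∷ xs) e = cong₂ _+_ (e (here refl)) (sumN-cong xs (e ∘ there))

  sumN-mono : ∀ {g h : A → ℕ} xs → (∀ {x} → x ∈ xs → g x ≤ h x) → sumN g xs ≤ sumN h xs
  sumN-mono []       e = z≤n
  sumN-mono (x ∷ xs) e = +-mono-≤ (e (here refl)) (sumN-mono xs (e ∘ there))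

  sumN-+ : ∀ (g h : A → ℕ) xs → sumN (λ x → g x + h x) xs ≡ sumN g xs + sumN h xs
  sumN-+ g h []       = refl
  sumN-+ g h (x ∷ xs) = Eq.trans (cong (g x + h x +_) (sumN-+ g h xs)) (mid (g x) (h x) _ _)
    where
    mid : ∀ a b c d → a + b + (c + d) ≡ a + c + (b + d)
    mid = solve-∀

  sumN-const : ∀ c (xs : List A) → sumN (λ _ → c) xs ≡ length xs * c
  sumN-const c []       = refl
  sumN-const c (x ∷ xs) = cong (c +_) (sumN-const c xs)

  sumN-tight : ∀ {g h : A → ℕ} xs → (∀ {x} → x ∈ xs → g x ≤ h x) → sumN h xs ≤ sumN g xs → ∀ {x} → x ∈ xs → g x ≡ h x
  sumN-tight {g} {h} (y ∷ xs) p q (here refl) = ≤-antisym (p (here refl))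
    (+-cancelʳ-≤ (sumN g xs) _ _ (≤-trans (+-monoʳ-≤ (h y) (sumN-mono xs (p ∘ there))) q))
  sumN-tight {g} {h} (y ∷ xs) p q (there x∈) = sumN-tight xs (p ∘ there)
    (+-cancelˡ-≤ (g y) _ _ (≤-trans (+-monoˡ-≤ (sumN h xs) (p (here refl))) q)) x∈

  unique-⊆-↭ : ∀ {xs ys : List A} → Unique xs → (∀ {z} → z ∈ xs → z ∈ ys) → ∃ λ zs → ys ↭ xs ++ zs
  unique-⊆-↭ {[]}     {ys} _ _ = ys , ↭-refl
  unique-⊆-↭ {x ∷ xs} u@(_ ∷ u′) sub with remove (sub (here refl))
  ... | ys′ , perm with unique-⊆-↭ u′ (λ z∈ → ∈-tail (Perm.∈-resp-↭ perm (sub (there z∈))) (unique-∉ u z∈))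
  ...   | zs , perm′ = zs , ↭-trans perm (prep x perm′)

ind : Bool → ℕ
ind b = if b then 1 else 0

-- The Harary index as a sum over an enumeration

module _ {n : ℕ} (g : Fin n → Fin n → ℚ) (g-sym : ∀ x y → g x y ≡ g y x) where

  private
    wt : Fin n → Fin n → ℚ
    wt x y = if toℕ x <ᵇ toℕ y then g x y else 0ℚ

    wt-false : ∀ {x y} → ¬ (toℕ x < toℕ y) → wt x y ≡ 0ℚ
    wt-false {x} {y} ¬lt with toℕ x <ᵇ toℕ y in eq
    ... | true  = contradiction (<ᵇ⇒< (toℕ x) (toℕ y) (subst Bool.T (sym eq) tt)) ¬lt
    ... | false = refl

    wt-true : ∀ {x y} → toℕ x < toℕ y → wt x y ≡ g x y
    wt-true {x} {y} lt with toℕ x <ᵇ toℕ y | <⇒<ᵇ lt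
    ... | true | _ = refl

    wt-sum : ∀ {x y} → x ≢ y → wt x y +ℚ wt y x ≡ g x y
    wt-sum {x} {y} ne with <-cmp (toℕ x) (toℕ y)
    ... | tri< lt _ ¬gt = Eq.trans (cong₂ _+ℚ_ (wt-true lt) (wt-false ¬gt)) (ℚ.+-identityʳ _)
    ... | tri≈ _ e _    = contradiction (Fin.toℕ-injective e) ne
    ... | tri> ¬lt _ gt = Eq.trans (cong₂ _+ℚ_ (wt-false ¬lt) (wt-true gt)) (Eq.trans (ℚ.+-identityˡ _) (g-sym y x))

    square : List (Fin n) → ℚ
    square A = sumOver (λ x → sumOver (wt x) A) A

    square-↭ : ∀ {A B} → A ↭ B → square A ≡ square B
    square-↭ {A} {B} p = Eq.trans (sumOver-↭ _ p) (sumOver-cong B λ {x} _ → sumOver-↭ (wt x) p)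

    -- Of the two ordered versions of a pair exactly one passes the test on `toℕ`, so the result
    -- does not depend on the order of enumeration.
    square≡pairSum : ∀ {A} → Unique A → square A ≡ pairSum g A
    square≡pairSum {[]}    _ = refl
    square≡pairSum {y ∷ A} u@(_ ∷ u′) = begin
      (wt y y +ℚ sumOver (wt y) A) +ℚ sumOver (λ x → wt x y +ℚ sumOver (wt x) A) A
        ≡⟨ cong₂ _+ℚ_ (Eq.trans (cong (_+ℚ sumOver (wt y) A) (wt-false {y} {y} (<-irrefl refl))) (ℚ.+-identityˡ (sumOver (wt y) A))) (sumOver-+ (λ x → wt x y) _ A) ⟩
      sumOver (wt y) A +ℚ (sumOver (λ x → wt x y) A +ℚ square A)
        ≡⟨ ℚ.+-assoc (sumOver (wt y) A) _ _ ⟨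
      (sumOver (wt y) A +ℚ sumOver (λ x → wt x y) A) +ℚ square A
        ≡⟨ cong (_+ℚ square A) (sumOver-+ (wt y) (λ x → wt x y) A) ⟨
      sumOver (λ a → wt y a +ℚ wt a y) A +ℚ square A
        ≡⟨ cong (_+ℚ square A) (sumOver-cong A λ a∈ → wt-sum (unique-∉ u a∈ ∘ sym)) ⟩
      sumOver (g y) A +ℚ square A
        ≡⟨ ℚ.+-comm (sumOver (g y) A) _ ⟩
      square A +ℚ sumOver (g y) A
        ≡⟨ cong (_+ℚ sumOver (g y) A) (square≡pairSum u′) ⟩
      pairSum g A +ℚ sumOver (g y) A ∎
      where open ≡-Reasoning

    sumℚ-concatMap : ∀ {B : Set} (F : B → List ℚ) xs → sumℚ (concatMap F xs) ≡ sumOver (sumℚ ∘ F) xs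
    sumℚ-concatMap F []       = refl
    sumℚ-concatMap F (x ∷ xs) = Eq.trans (sumℚ-++ (F x) _) (cong (sumℚ (F x) +ℚ_) (sumℚ-concatMap F xs))
      where
      sumℚ-++ : ∀ as bs → sumℚ (as ++ bs) ≡ sumℚ as +ℚ sumℚ bs
      sumℚ-++ []       bs = sym (ℚ.+-identityˡ _)
      sumℚ-++ (a ∷ as) bs = Eq.trans (cong (a +ℚ_) (sumℚ-++ as bs)) (sym (ℚ.+-assoc a _ _))

  allPairs≡pairSum : ∀ {A} → Unique A → (∀ z → z ∈ A) →
    sumℚ (concatMap (λ x → map (λ y → if toℕ x <ᵇ toℕ y then g x y else 0ℚ) (allFin n)) (allFin n)) ≡ pairSum g A
  allPairs≡pairSum u c = Eq.trans (sumℚ-concatMap (λ x → map (wt x) (allFin n)) (allFin n))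
    (Eq.trans (square-↭ (↭-sym (complete⇒↭allFin u c))) (square≡pairSum u))

-- Metric, degrees and the handshake lemma

module Tree {n : ℕ} (G : Graph n) (tree : IsTree G) where

  open Growth G (proj₁ tree) public
  open Search (proj₁ (proj₂ tree)) (proj₂ (proj₂ tree)) public
  open Attach

  private
    e : V → V → ℕ
    e x y = ind (G x y)

    e-true : ∀ {x y} → G x y ≡ true → e x y ≡ 1
    e-true eq = cong ind eq

    e-false : ∀ {x y} → G x y ≢ true → e x y ≡ 0
    e-false {x} {y} ne with G x y
    ... | true  = contradiction refl ne
    ... | false = refl

  degree-single : ∀ {x y A} → Unique A → y ∈ A → G x y ≡ true → (∀ {a} → a ∈ A → G x a ≡ true → a ≡ y) → sumN (e x) A ≡ 1
  degree-single {x} {y} {A} u y∈ xy only-y with remove y∈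
  ... | A′ , perm with Unique-resp-↭ perm u
  ...   | u′ = begin
    sumN (e x) A            ≡⟨ sumN-↭ (e x) perm ⟩
    e x y + sumN (e x) A′   ≡⟨ cong₂ _+_ (e-true xy) (sumN-cong A′ (λ a∈ → e-false (λ xa → unique-∉ u′ a∈ (only-y (Perm.∈-resp-↭ (↭-sym perm) (there a∈)) xa)))) ⟩
    1 + sumN (λ _ → 0) A′   ≡⟨ cong suc (Eq.trans (sumN-const 0 A′) (*-zeroʳ (length A′))) ⟩
    1                       ∎
    where open ≡-Reasoning

  -- A new leaf contributes one to its own degree and one to that of its neighbour.
  handshake : ∀ {A N} → Grown A → length A ≡ suc N → sumN (λ x → sumN (e x) A) A ≡ N + N
  handshake {N = zero} (root ρ) refl = cong (λ z → z + 0 + 0) (e-false {ρ} {ρ} G-irrefl)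
  handshake {N = zero} (grow _ (root _)) ()
  handshake {N = zero} (grow _ (grow _ _)) ()
  handshake {N = suc N} (grow {A} {x} {y} at g) len = begin
    (e y y + sumN (e y) A) + sumN (λ a → e a y + sumN (e a) A) A
      ≡⟨ cong₂ _+_ (cong₂ _+_ (e-false {y} {y} G-irrefl) one) (sumN-+ (λ a → e a y) _ A) ⟩
    1 + (sumN (λ a → e a y) A + sumN (λ a → sumN (e a) A) A)
      ≡⟨ cong (λ z → 1 + (z + sumN (λ a → sumN (e a) A) A)) (Eq.trans (sumN-cong A (λ {a} _ → cong ind (proj₁ (proj₁ tree) a y))) one) ⟩
    1 + (1 + sumN (λ a → sumN (e a) A) A)
      ≡⟨ cong (λ z → 1 + (1 + z)) (handshake g (suc-injective len)) ⟩
    1 + (1 + (N + N))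
      ≡⟨ cong suc (+-suc N N) ⟨
    suc N + suc N ∎
    where
    open ≡-Reasoning
    one : sumN (e y) A ≡ 1
    one = degree-single (grown-unique g) (old at) (edge at) (only at)

  module _ {ρ} (dec : Decomposition ρ) where
    open Decomposition dec

    private
      g : Grown A
      g = runs-grown runs

      A↭ : A ↭ allFin n
      A↭ = complete⇒↭allFin (grown-unique g) complete

    length-A : length A ≡ n
    length-A = Eq.trans (Perm.↭-length A↭) (length-tabulate {n = n} id)

    dist-refl : ∀ x → dist G x x ≡ 0
    dist-refl x = Eq.trans (dist≡D g complete x x) (D-refl g x)

    dist-sym : ∀ x y → dist G x y ≡ dist G y x
    dist-sym x y = Eq.trans (dist≡D g complete x y) (Eq.trans (D-sym g x y) (sym (dist≡D g complete y x)))

    nearer : ∀ {x y} → x ≢ y → ∃ λ z → (G x z ≡ true) × (dist G x y ≡ suc (dist G z y))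
    nearer {x} {y} ne with D-step g (complete x) (complete y) ne
    ... | z , _ , xz , eq = z , xz , Eq.trans (dist≡D g complete x y) (Eq.trans eq (cong suc (sym (dist≡D g complete z y))))

    dist≡0 : ∀ {x y} → dist G x y ≡ 0 → x ≡ y
    dist≡0 {x} {y} eq with x Fin.≟ y
    ... | yes p = p
    ... | no ne with nearer ne
    ...   | _ , _ , eq′ = contradiction (Eq.trans (sym eq) eq′) 0≢1+n

    dist≡1⇒edge : ∀ {x y} → dist G x y ≡ 1 → G x y ≡ true
    dist≡1⇒edge {x} {y} eq with x Fin.≟ y
    ... | yes refl = contradiction (Eq.trans (sym (dist-refl x)) eq) 0≢1+n
    ... | no ne with nearer ne
    ...   | z , xz , eq′ = subst (λ w → G x w ≡ true) (dist≡0 (suc-injective (Eq.trans (sym eq′) eq))) xz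

    edge⇒dist≡1 : ∀ {x y} → G x y ≡ true → dist G x y ≡ 1
    edge⇒dist≡1 {x} {y} xy = ≤-antisym
      (≤-trans (≤-reflexive (dist≡D g complete x y)) (≤-trans (D-edge g (complete x) (complete y) (complete y) xy) (≤-reflexive (cong suc (D-refl g y)))))
      (n≢0⇒n>0 λ eq → G-irrefl (subst (λ z → G x z ≡ true) (sym (dist≡0 eq)) xy))

    degree≡cnt : ∀ x → degree G x ≡ cnt 1 (map (dist G x) A)
    degree≡cnt x = Eq.trans (Eq.trans (sumN-cong (allFin n) (λ {y} _ → pointwise y)) (sym (sumN-↭ (λ y → δ 1 (dist G x y)) A↭))) (sym (cnt-map A))
      where
      cnt-map : ∀ B → cnt 1 (map (dist G x) B) ≡ sumN (λ y → δ 1 (dist G x y)) B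
      cnt-map []      = refl
      cnt-map (b ∷ B) = cong (δ 1 (dist G x b) +_) (cnt-map B)
      pointwise : ∀ y → e x y ≡ δ 1 (dist G x y)
      pointwise y with 1 ≟ dist G x y
      ... | yes eq = Eq.trans (e-true (dist≡1⇒edge (sym eq))) (cong (δ 1) eq)
      ... | no ne  = Eq.trans (e-false (λ xy → ne (sym (edge⇒dist≡1 xy)))) (sym (δ-≢ ne))

    harary≡ : harary G ≡ pairSum (λ x y → inv (dist G x y)) A
    harary≡ = allPairs≡pairSum (λ x y → inv (dist G x y)) (λ x y → cong inv (dist-sym x y)) (grown-unique g) complete

    degreeSum : ∀ {N} → n ≡ suc N → sumN (degree G) (allFin n) ≡ N + N
    degreeSum eq = Eq.trans (Eq.trans (sumN-cong (allFin n) (λ {x} _ → sumN-↭ (e x) (↭-sym A↭))) (sumN-↭ _ (↭-sym A↭))) (handshake g (Eq.trans length-A eq))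

    module R = Runs (dist G) dist-refl dist-sym

    private
      -- Later vertices never alter `D` between earlier ones, so agreement with the distance of the
      -- whole tree is inherited by every intermediate stage.
      convert-path : ∀ {u B P} (h : Grown B) (path : GPath u B P) →
        (∀ {a b} → a ∈ P ++ B → b ∈ P ++ B → dist G a b ≡ D (path-grown h path) a b) →
        R.Path u B P × (∀ {a b} → a ∈ B → b ∈ B → dist G a b ≡ D h a b)
      convert-path h [] agree = R.[] , agree
      convert-path {u} {B} {y ∷ P} h (at ∷ path) agree = st R.∷ proj₁ rec , proj₂ rec
        where
        h′ = path-grown h path
        agree′ : ∀ {a b} → a ∈ P ++ B → b ∈ P ++ B → dist G a b ≡ D h′ a b
        agree′ a∈ b∈ = Eq.trans (agree (there a∈) (there b∈)) (D-old-old at h′ (old≢new at h′ a∈) (old≢new at h′ b∈))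
        rec = convert-path h path agree′
        st : R.Step (P ++ B) (tip u P) y
        st a∈ = Eq.trans (agree (here refl) (there a∈)) (Eq.trans (D-new-old at h′ (old≢new at h′ a∈)) (cong suc (sym (agree′ (old at) a∈))))

      convert : ∀ {j B} (rs : GRuns ρ j B) → (∀ {a b} → a ∈ B → b ∈ B → dist G a b ≡ D (runs-grown rs) a b) → R.Runs ρ j B
      convert root agree = R.root
      convert (run rs u∈ path) agree with convert-path (runs-grown rs) path agree
      ... | path′ , agree′ = R.run (convert rs agree′) u∈ path′

    metricRuns : R.Runs ρ j A
    metricRuns = convert runs (λ {a} {b} _ _ → dist≡D g complete a b)

  degree-≥ : ∀ {x L} → Unique L → All (λ y → G x y ≡ true) L → length L ≤ degree G x
  degree-≥ {x} {L} u nbrs with unique-⊆-↭ u (λ _ → ∈-allFin _)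
  ... | R , perm = begin
    length L                      ≡⟨ *-identityʳ (length L) ⟨
    length L * 1                  ≡⟨ sumN-const 1 L ⟨
    sumN (λ _ → 1) L              ≡⟨ sumN-cong L (λ y∈ → e-true (All.lookup nbrs y∈)) ⟨
    sumN (e x) L                  ≤⟨ m≤m+n _ _ ⟩
    sumN (e x) L + sumN (e x) R   ≡⟨ sumN-++ (e x) L R ⟨
    sumN (e x) (L ++ R)           ≡⟨ sumN-↭ (e x) perm ⟨
    degree G x                    ∎
    where open ≤-Reasoning

  degree-exact : ∀ {x L} → Unique L → All (λ y → G x y ≡ true) L → (∀ {y} → G x y ≡ true → y ∈ L) → degree G x ≡ length L
  degree-exact {x} {L} u nbrs all with unique-⊆-↭ u (λ _ → ∈-allFin _)
  ... | R , perm = begin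
    degree G x                    ≡⟨ sumN-↭ (e x) perm ⟩
    sumN (e x) (L ++ R)           ≡⟨ sumN-++ (e x) L R ⟩
    sumN (e x) L + sumN (e x) R   ≡⟨ cong₂ _+_ (sumN-cong L (λ y∈ → e-true (All.lookup nbrs y∈))) (sumN-cong R (λ y∈ → e-false (λ xy → disjoint L (Unique-resp-↭ perm (Unique.allFin⁺ n)) (all xy) y∈))) ⟩
    sumN (λ _ → 1) L + sumN (λ _ → 0) R ≡⟨ cong₂ _+_ (Eq.trans (sumN-const 1 L) (*-identityʳ (length L))) (Eq.trans (sumN-const 0 R) (*-zeroʳ (length R))) ⟩
    length L + 0                  ≡⟨ +-identityʳ (length L) ⟩
    length L                      ∎
    where
    open ≡-Reasoning
    disjoint : ∀ L → Unique (L ++ R) → ∀ {y} → y ∈ L → y ∈ R → ⊥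
    disjoint (z ∷ L) u (here refl) y∈R = unique-∉ u (∈-++⁺ʳ L y∈R) refl
    disjoint (z ∷ L) (_ ∷ u) (there y∈) y∈R = disjoint L u y∈ y∈R

  leaf-degree : ∀ {x y} → Leaf x → G x y ≡ true → degree G x ≡ 1
  leaf-degree lf xy = degree-single (Unique.allFin⁺ n) (∈-allFin _) xy (λ _ xa → lf xa xy)

-- The number of leaves and the degrees away from the centre

ind-≡ᵇ-≢ : ∀ {a b} → a ≢ b → ind (a ≡ᵇ b) ≡ 0
ind-≡ᵇ-≢ {zero}  {zero}  ne = contradiction refl ne
ind-≡ᵇ-≢ {zero}  {suc b} ne = refl
ind-≡ᵇ-≢ {suc a} {zero}  ne = refl
ind-≡ᵇ-≢ {suc a} {suc b} ne = ind-≡ᵇ-≢ (ne ∘ cong suc)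

ind≤1 : ∀ b → ind b ≤ 1
ind≤1 true  = ≤-refl
ind≤1 false = z≤n

other : ∀ {n} → 2 ≤ n → (x : Fin n) → ∃ λ y → x ≢ y
other (s≤s (s≤s _)) zero    = suc zero , λ ()
other (s≤s (s≤s _)) (suc x) = zero , λ ()

module Degrees {n : ℕ} (G : Graph n) (tree : IsTree G) (2≤n : 2 ≤ n) where

  open Tree G tree

  two : V → ℕ
  two x = ind (degree G x ≡ᵇ 2)

  neighbour : ∀ x → ∃ λ y → G x y ≡ true
  neighbour x with nearer (decompose x) (proj₂ (other 2≤n x))
  ... | z , xz , _ = z , xz

  1≤degree : ∀ x → 1 ≤ degree G x
  1≤degree x = degree-≥ {L = proj₁ (neighbour x) ∷ []} ([] ∷ []) (proj₂ (neighbour x) ∷ [])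

  someLeaf : ∃ λ ρ → Leaf ρ
  someLeaf = go (decompose x)
    where
    x : V
    x = fromℕ< (≤-trans (s≤s z≤n) 2≤n)
    y = proj₁ (other 2≤n x)
    x≢y = proj₂ (other 2≤n x)
    go : Decomposition x → ∃ λ ρ → Leaf ρ
    go record { runs = root ; complete = c } with c y
    ... | here e = contradiction (sym e) x≢y
    go record { runs = run _ _ _ ; runEnds = record { ends = z ∷ _ ; leaves = lf ∷ _ } } = z , lf
    go record { runs = run _ _ _ ; runEnds = record { ends = [] ; length≡ = () } }

  -- The j + 1 known leaves cannot be the only vertices of degree ≠ 2 unless the tree is a path.
  runs-bound : ∀ {ρ} → Leaf ρ → (dec : Decomposition ρ) → numDeg2 G + 4 ≤ n → suc (Decomposition.j dec) + suc (numDeg2 G) ≤ n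
  runs-bound {ρ} lf dec 4≤ with unique-⊆-↭ (Ends.distinct (Decomposition.runEnds dec)) (λ _ → ∈-allFin _)
  ... | R , perm = subst (λ l → l + suc q ≤ n) lenL goal
    where
    open Ends (Decomposition.runEnds dec)
    q = numDeg2 G
    L = ρ ∷ ends
    lenL : length L ≡ suc (Decomposition.j dec)
    lenL = cong suc length≡
    lenLR : length L + length R ≡ n
    lenLR = Eq.trans (sym (length-++ L)) (Eq.trans (sym (Perm.↭-length perm)) (length-tabulate {n = n} id))
    degL : ∀ {x} → x ∈ L → degree G x ≡ 1
    degL {x} x∈ = leaf-degree (All.lookup {P = Leaf} (lf ∷ leaves) x∈) (proj₂ (neighbour x))
    split : ∀ (g : V → ℕ) → sumN g (allFin n) ≡ sumN g L + sumN g R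
    split g = Eq.trans (sumN-↭ g perm) (sumN-++ g L R)
    q≡ : q ≡ sumN two R
    q≡ = Eq.trans (split two) (cong (_+ sumN two R) (Eq.trans (sumN-cong L (λ x∈ → cong (λ z → ind (z ≡ᵇ 2)) (degL x∈))) (Eq.trans (sumN-const 0 L) (*-zeroʳ (length L)))))
    goal : length L + suc q ≤ n
    goal with All.all? (λ x → degree G x ≟ 2) R
    -- A vertex outside the known leaves with degree other than two is not counted by q either,
    -- which yields the extra unit.
    ... | no ¬all with find (AllP.¬All⇒Any¬ (λ x → degree G x ≟ 2) R ¬all)
    ...   | x , x∈ , ne with remove x∈
    ...     | R′ , permR = ≤-trans (+-monoʳ-≤ (length L) q<) (≤-reflexive lenLR)
      where
      open ≤-Reasoning
      q< : suc q ≤ length R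
      q< = begin
        suc q                         ≡⟨ cong suc (Eq.trans q≡ (sumN-↭ two permR)) ⟩
        suc (two x + sumN two R′)     ≡⟨ cong (λ z → suc (z + sumN two R′)) (ind-≡ᵇ-≢ ne) ⟩
        suc (sumN two R′)             ≤⟨ s≤s (sumN-mono R′ (λ {y} _ → ind≤1 (degree G y ≡ᵇ 2))) ⟩
        suc (sumN (λ _ → 1) R′)       ≡⟨ cong suc (Eq.trans (sumN-const 1 R′) (*-identityʳ (length R′))) ⟩
        suc (length R′)               ≡⟨ Perm.↭-length permR ⟨
        length R                      ∎
    -- If all other vertices have degree two, the degree sum leaves exactly two leaves, and q + 3 ≤
    -- n follows with room to spare.
    goal | yes all = ≤-trans (≤-reflexive (cong (_+ suc q) L≡2)) (≤-trans (≤-trans (n≤1+n _) (≤-reflexive (+-comm 4 q))) 4≤)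
      where
      open ≡-Reasoning
      l = length ends
      r = length R
      n≡ : n ≡ suc (l + r)
      n≡ = sym lenLR
      L≡2 : length L ≡ 2
      L≡2 = cong suc (+-cancelˡ-≡ (l + r + r) l 1 (suc-injective (begin
        suc (l + r + r + l)                ≡⟨ shuffle l r ⟩
        suc ((l + r) + (l + r))            ≡⟨ cong suc (degreeSum dec n≡) ⟨
        suc (sumN (degree G) (allFin n))   ≡⟨ cong suc (split (degree G)) ⟩
        suc (sumN (degree G) L + sumN (degree G) R)
          ≡⟨ cong suc (cong₂ _+_ (Eq.trans (sumN-cong L degL) (sumN-const 1 L)) (Eq.trans (sumN-cong R (All.lookup all)) (sumN-const 2 R))) ⟩
        suc (suc l * 1 + r * 2)            ≡⟨ shuffle′ l r ⟩
        suc (l + r + r + 1)                ∎)))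
        where
        shuffle : ∀ l r → 1 + (l + r + r + l) ≡ 1 + ((l + r) + (l + r))
        shuffle = solve-∀
        shuffle′ : ∀ l r → 1 + ((1 + l) * 1 + r * 2) ≡ 1 + (l + r + r + 1)
        shuffle′ = solve-∀

  -- The degree sum is 2 (k + q), of which `u` takes k. The other k + q vertices need at least one
  -- each and one more for each of the q vertices of degree two, none of which is `u` as 3 ≤ k. This
  -- already exhausts the remaining k + 2 q.
  others-degree : ∀ {u k} → degree G u ≡ k → 3 ≤ k → suc (k + numDeg2 G) ≡ n → ∀ {x} → x ≢ u → degree G x ≤ 2
  others-degree {u} {k} deg-u 3≤k n≡ {x} x≢u with remove (∈-allFin u)
  ... | R , perm = ≤-trans (≤-reflexive (sym (sumN-tight R lower upper x∈R))) (s≤s (ind≤1 _))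
    where
    open ≡-Reasoning
    q = numDeg2 G
    x∈R : x ∈ R
    x∈R = ∈-tail (Perm.∈-resp-↭ perm (∈-allFin x)) x≢u
    lenR : length R ≡ k + q
    lenR = suc-injective (Eq.trans (sym (Perm.↭-length perm)) (Eq.trans (length-tabulate {n = n} id) (sym n≡)))
    lower : ∀ {y} → y ∈ R → suc (two y) ≤ degree G y
    lower {y} _ with degree G y ≟ 2
    ... | yes e = ≤-reflexive (Eq.trans (cong suc (Eq.trans (cong (λ z → ind (z ≡ᵇ 2)) e) refl)) (sym e))
    ... | no ne = ≤-trans (≤-reflexive (cong suc (ind-≡ᵇ-≢ ne))) (1≤degree y)
    twos : sumN two R ≡ q
    twos = sym (Eq.trans (sumN-↭ two perm) (cong (_+ sumN two R) (ind-≡ᵇ-≢ (λ e → <⇒≢ 3≤k (sym (Eq.trans (sym deg-u) e))))))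
    degs : k + sumN (degree G) R ≡ k + (k + q + q)
    degs = begin
      k + sumN (degree G) R              ≡⟨ cong (_+ sumN (degree G) R) deg-u ⟨
      degree G u + sumN (degree G) R     ≡⟨ sumN-↭ (degree G) perm ⟨
      sumN (degree G) (allFin n)         ≡⟨ degreeSum (decompose u) (sym n≡) ⟩
      (k + q) + (k + q)                  ≡⟨ shuffle k q ⟩
      k + (k + q + q)                    ∎
      where
      shuffle : ∀ k q → (k + q) + (k + q) ≡ k + (k + q + q)
      shuffle = solve-∀
    upper : sumN (degree G) R ≤ sumN (suc ∘ two) R
    upper = ≤-reflexive (begin
      sumN (degree G) R              ≡⟨ +-cancelˡ-≡ k _ _ degs ⟩
      k + q + q                      ≡⟨ cong₂ _+_ (sym (Eq.trans (sumN-const 1 R) (Eq.trans (*-identityʳ (length R)) lenR))) (sym twos) ⟩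
      sumN (λ _ → 1) R + sumN two R  ≡⟨ sumN-+ (λ _ → 1) two R ⟨
      sumN (suc ∘ two) R             ∎)

-- Rooted trees

module Rooted {n : ℕ} (G : Graph n) (tree : IsTree G) (u : Fin n) where

  open Tree G tree
  open Attach

  rootOf : ∀ {A} → Grown A → V
  rootOf (root ρ)   = ρ
  rootOf (grow _ g) = rootOf g

  rootOf∈ : ∀ {A} (g : Grown A) → rootOf g ∈ A
  rootOf∈ (root ρ)   = here refl
  rootOf∈ (grow _ g) = there (rootOf∈ g)

  -- At the root and outside `A` the value defaults to the root.
  parent : ∀ {A} → Grown A → V → V
  parent (root ρ) a = ρ
  parent (grow {x = x} {y} _ g) a with a Fin.≟ y
  ... | yes _ = x
  ... | no _  = parent g a

  parent∈ : ∀ {A} (g : Grown A) {a} → a ∈ A → parent g a ∈ A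
  parent∈ (root ρ) _ = here refl
  parent∈ (grow {y = y} at g) {a} a∈ with a Fin.≟ y
  ... | yes _ = there (old at)
  ... | no ne = there (parent∈ g (∈-tail a∈ ne))

  parent-edge : ∀ {A} (g : Grown A) {a} → a ∈ A → a ≢ rootOf g → G a (parent g a) ≡ true
  parent-edge (root ρ) (here e) ne = contradiction e ne
  parent-edge (grow {y = y} at g) {a} a∈ ne with a Fin.≟ y
  ... | yes refl = edge at
  ... | no ne′   = parent-edge g (∈-tail a∈ ne′) ne

  parent-new : ∀ {A x y} (at : Attach A x y) (g : Grown A) → parent (grow at g) y ≡ x
  parent-new {y = y} at g with y Fin.≟ y
  ... | yes _ = refl
  ... | no ne = contradiction refl ne

  parent-old : ∀ {A x y} (at : Attach A x y) (g : Grown A) {a} → a ≢ y → parent (grow at g) a ≡ parent g a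
  parent-old {y = y} at g {a} ne with a Fin.≟ y
  ... | yes e = contradiction e ne
  ... | no _  = refl

  parent-depth : ∀ {A} (g : Grown A) {a} → a ∈ A → a ≢ rootOf g → D g (rootOf g) a ≡ suc (D g (rootOf g) (parent g a))
  parent-depth (root ρ) (here e) ne = contradiction e ne
  parent-depth (grow at g) (here refl) ne = Eq.trans (D-old-new at g ρ≢)
      (cong suc (Eq.trans (sym (D-old-old at g ρ≢ (old≢new at g (old at)))) (cong (D (grow at g) (rootOf g)) (sym (parent-new at g)))))
    where ρ≢ = old≢new at g (rootOf∈ g)
  parent-depth (grow at g) (there a∈) ne = Eq.trans (D-old-old at g ρ≢ a≢) (Eq.trans (parent-depth g a∈ ne)
      (cong suc (Eq.trans (sym (D-old-old at g ρ≢ (old≢new at g (parent∈ g a∈)))) (cong (D (grow at g) (rootOf g)) (sym (parent-old at g a≢))))))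
    where
    ρ≢ = old≢new at g (rootOf∈ g)
    a≢ = old≢new at g a∈

  parent-or-child : ∀ {A} (g : Grown A) {a b} → a ∈ A → b ∈ A → G a b ≡ true →
    ((a ≢ rootOf g) × (b ≡ parent g a)) ⊎ ((b ≢ rootOf g) × (a ≡ parent g b))
  parent-or-child (root ρ) (here refl) (here refl) ab = contradiction ab G-irrefl
  parent-or-child (grow {y = y} at g) {a} {b} a∈ b∈ ab with a Fin.≟ y | b Fin.≟ y
  ... | yes refl | yes refl = contradiction ab G-irrefl
  ... | yes refl | no nb    = inj₁ ((λ e → old≢new at g (rootOf∈ g) (sym e)) , only at (∈-tail b∈ nb) ab)
  ... | no na    | yes refl = inj₂ ((λ e → old≢new at g (rootOf∈ g) (sym e)) , only at (∈-tail a∈ na) (G-sym ab))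
  ... | no na    | no nb    = parent-or-child g (∈-tail a∈ na) (∈-tail b∈ nb) ab

  private
    -- A decomposition started at `u` supplies a growth order whose root is `u`.
    dec : Decomposition u
    dec = decompose u

    g : Grown (Decomposition.A dec)
    g = runs-grown (Decomposition.runs dec)

    rootOf-runs : ∀ {j A} (rs : GRuns u j A) → rootOf (runs-grown rs) ≡ u
    rootOf-runs root            = refl
    rootOf-runs (run rs _ path) = Eq.trans (rootOf-path path) (rootOf-runs rs)
      where
      rootOf-path : ∀ {h : Grown _} {w P} (path : GPath w _ P) → rootOf (path-grown h path) ≡ rootOf h
      rootOf-path []         = refl
      rootOf-path (_ ∷ path) = rootOf-path path

    root≡u : rootOf g ≡ u
    root≡u = rootOf-runs (Decomposition.runs dec)

    ∈A : ∀ z → z ∈ Decomposition.A dec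
    ∈A = Decomposition.complete dec

  par : V → V
  par = parent g

  depth : V → ℕ
  depth = dist G u

  par-edge : ∀ {x} → x ≢ u → G x (par x) ≡ true
  par-edge {x} ne = parent-edge g (∈A x) (λ e → ne (Eq.trans e root≡u))

  par-depth : ∀ {x} → x ≢ u → depth x ≡ suc (depth (par x))
  par-depth {x} ne = Eq.trans (dist≡D g ∈A u x) (Eq.trans (subst (λ z → D g z x ≡ suc (D g z (par x))) root≡u (parent-depth g (∈A x) (λ e → ne (Eq.trans e root≡u))))
                       (cong suc (sym (dist≡D g ∈A u (par x)))))

  edge-par : ∀ {x y} → G x y ≡ true → ((x ≢ u) × (y ≡ par x)) ⊎ ((y ≢ u) × (x ≡ par y))
  edge-par {x} {y} xy with parent-or-child g (∈A x) (∈A y) xy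
  ... | inj₁ (ne , e) = inj₁ ((λ e′ → ne (Eq.trans e′ (sym root≡u))) , e)
  ... | inj₂ (ne , e) = inj₂ ((λ e′ → ne (Eq.trans e′ (sym root≡u))) , e)

  depth-root : depth u ≡ 0
  depth-root = dist-refl dec u

  depth≡0 : ∀ {x} → depth x ≡ 0 → x ≡ u
  depth≡0 e = sym (dist≡0 dec e)

-- Adjacency in `BS` and the numbering of an extremal tree

T⇒≡true : ∀ {b} → T b → b ≡ true
T⇒≡true = Equivalence.to T-≡

≡true⇒T : ∀ {b} → b ≡ true → T b
≡true⇒T = Equivalence.from T-≡

true-ext : ∀ {a b} → (a ≡ true → b ≡ true) → (b ≡ true → a ≡ true) → a ≡ b
true-ext {true}          p q = sym (p refl)
true-ext {false} {true}  p q = q refl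
true-ext {false} {false} p q = refl

-- The propositional form of `bsEdge`: `x` is the neighbour of `y` on the side of the centre.
BSParent : ℕ → ℕ → ℕ → Set
BSParent k x y = ((x ≡ 0) × (1 ≤ y) × (y ≤ k)) ⊎ ((1 ≤ x) × (x + k ≡ y))

bsEdge⁻ : ∀ {k x y} → bsEdge k x y ≡ true → BSParent k x y
bsEdge⁻ {k} {x} {y} e with ∨-true {(x ≡ᵇ 0) ∧ (1 ≤ᵇ y) ∧ (y ≤ᵇ k)} e
... | inj₁ a with ∧-true {x ≡ᵇ 0} a
...   | b , c with ∧-true {1 ≤ᵇ y} c
...     | c₁ , c₂ = inj₁ (≡ᵇ⇒≡ x 0 (≡true⇒T b) , ≤ᵇ⇒≤ 1 y (≡true⇒T c₁) , ≤ᵇ⇒≤ y k (≡true⇒T c₂))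
bsEdge⁻ {k} {x} {y} e | inj₂ a with ∧-true {1 ≤ᵇ x} a
...   | b , c = inj₂ (≤ᵇ⇒≤ 1 x (≡true⇒T b) , ≡ᵇ⇒≡ (x + k) y (≡true⇒T c))

bsEdge⁺ : ∀ {k x y} → BSParent k x y → bsEdge k x y ≡ true
bsEdge⁺ {k} {x} {y} (inj₁ (refl , 1≤y , y≤k)) rewrite T⇒≡true (≤⇒≤ᵇ 1≤y) | T⇒≡true (≤⇒≤ᵇ y≤k) = refl
bsEdge⁺ {k} {x} {y} (inj₂ (1≤x , refl)) = ∨-trueʳ _ (Eq.trans (cong (_∧ (x + k ≡ᵇ x + k)) (T⇒≡true (≤⇒≤ᵇ 1≤x))) (T⇒≡true (≡⇒≡ᵇ (x + k) (x + k) refl)))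

BS⁻ : ∀ {n k} {x y : Fin n} → BS n k x y ≡ true → BSParent k (toℕ x) (toℕ y) ⊎ BSParent k (toℕ y) (toℕ x)
BS⁻ {n} {k} {x} {y} e with ∨-true {bsEdge k (toℕ x) (toℕ y)} e
... | inj₁ a = inj₁ (bsEdge⁻ a)
... | inj₂ a = inj₂ (bsEdge⁻ a)

BS⁺ : ∀ {n k} {x y : Fin n} → BSParent k (toℕ x) (toℕ y) ⊎ BSParent k (toℕ y) (toℕ x) → BS n k x y ≡ true
BS⁺ {n} {k} {x} {y} (inj₁ p) = cong (_∨ bsEdge k (toℕ y) (toℕ x)) (bsEdge⁺ p)
BS⁺ {n} {k} {x} {y} (inj₂ p) = ∨-trueʳ (bsEdge k (toℕ x) (toℕ y)) (bsEdge⁺ p)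

BSParent-unique : ∀ {k a b c} → BSParent k a c → BSParent k b c → a ≡ b
BSParent-unique (inj₁ (e , _)) (inj₁ (e′ , _)) = Eq.trans e (sym e′)
BSParent-unique {k} (inj₂ (_ , e)) (inj₂ (_ , e′)) = +-cancelʳ-≡ k _ _ (Eq.trans e (sym e′))
BSParent-unique {k} (inj₁ (_ , _ , c≤k)) (inj₂ (1≤b , refl)) = contradiction c≤k (<⇒≱ (m<n+m k 1≤b))
BSParent-unique {k} (inj₂ (1≤a , refl)) (inj₁ (_ , _ , c≤k)) = contradiction c≤k (<⇒≱ (m<n+m k 1≤a))

module Index {n : ℕ} where

  idx : Fin n → List (Fin n) → ℕ
  idx x []       = 0
  idx x (y ∷ ys) with x Fin.≟ y
  ... | yes _ = 0
  ... | no _  = suc (idx x ys)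

  idx< : ∀ {x} xs ys → x ∈ xs → idx x (xs ++ ys) < length xs
  idx< {x} (y ∷ xs) ys x∈ with x Fin.≟ y
  ... | yes _ = s≤s z≤n
  ... | no ne = s≤s (idx< xs ys (∈-tail x∈ ne))

  idx-injective : ∀ {x y} xs → x ∈ xs → y ∈ xs → idx x xs ≡ idx y xs → x ≡ y
  idx-injective {x} {y} (z ∷ xs) x∈ y∈ e with x Fin.≟ z | y Fin.≟ z
  ... | yes p | yes q = Eq.trans p (sym q)
  ... | yes p | no _  = contradiction e 0≢1+n
  ... | no _  | yes q = contradiction (sym e) 0≢1+n
  ... | no p  | no q  = idx-injective xs (∈-tail x∈ p) (∈-tail y∈ q) (suc-injective e)

  injective⇒surjective : (f : Fin n → Fin n) → (∀ {x y} → f x ≡ f y → x ≡ y) → ∀ y → ∃ λ x → f x ≡ y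
  injective⇒surjective f f-inj y with Any.any? (y Fin.≟_) (map f (allFin n))
  ... | yes y∈ = case ∈-map⁻ f y∈ of λ where (x , _ , e) → x , sym e
  ... | no y∉  = contradiction (≤-trans (s≤s (≤-reflexive (sym (Eq.trans (length-map f (allFin n)) (length-tabulate {n = n} id)))))
                   (unique-length≤ (∉⇒All≢ y∉ ∷ Unique.map⁺ f-inj (Unique.allFin⁺ n)))) 1+n≰n

unique-map : ∀ {A B : Set} {f : A → B} {xs} → Unique xs → (∀ {x y} → x ∈ xs → y ∈ xs → f x ≡ f y → x ≡ y) → Unique (map f xs)
unique-map []      _   = []
unique-map {f = f} u@(_ ∷ u′) inj =
  ∉⇒All≢ (λ fx∈ → case ∈-map⁻ f fx∈ of λ where (y , y∈ , e) → unique-∉ u y∈ (sym (inj (here refl) (there y∈) e)))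
  ∷ unique-map u′ (λ x∈ y∈ → inj (there x∈) (there y∈))

-- A tree all of whose vertices other than u have degree at most two is numbered like BS: a vertex
-- of positive depth on the b-th branch gets the number (depth − 1) k + b + 1, where the branches
-- reaching the bottom level come first.
module Numbering {n N : ℕ} (n≡ : n ≡ suc N) (G : Graph n) (tree : IsTree G) (u : Fin n) (k′ h : ℕ)
  (others : ∀ {x} → x ≢ u → degree G x ≤ 2)
  (depth≤ : ∀ x → dist G u x ≤ suc h)
  (degree≡ : cnt 1 (map (dist G u) (allFin n)) ≡ suc k′)
  (bottom≤ : cnt (suc h) (map (dist G u) (allFin n)) + h * suc k′ ≤ N) where

  open Tree G tree using (V; G-sym; degree-≥)
  open Rooted G tree u
  open Index {n}

  k : ℕ
  k = suc k′

  onLevel : ℕ → List V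
  onLevel v = filter (λ x → v ≟ depth x) (allFin n)

  length-onLevel : ∀ v → length (onLevel v) ≡ cnt v (map depth (allFin n))
  length-onLevel v = go (allFin n)
    where
    go : ∀ xs → length (filter (λ x → v ≟ depth x) xs) ≡ cnt v (map depth xs)
    go []       = refl
    go (x ∷ xs) = case v ≟ depth x of λ where
      (yes e) → Eq.trans (cong length (filter-accept (λ x → v ≟ depth x) e)) (cong₂ _+_ (sym (Eq.trans (cong (δ v) (sym e)) (δ-refl v))) (go xs))
      (no ne) → Eq.trans (cong length (filter-reject (λ x → v ≟ depth x) ne)) (Eq.trans (go xs) (cong (_+ cnt v (map depth xs)) (sym (δ-≢ ne))))

  ∈-onLevel⁺ : ∀ {v x} → v ≡ depth x → x ∈ onLevel v
  ∈-onLevel⁺ {v} {x} e = ∈-filter⁺ (λ x → v ≟ depth x) (∈-allFin x) e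

  ∈-onLevel⁻ : ∀ {v x} → x ∈ onLevel v → v ≡ depth x
  ∈-onLevel⁻ {v} x∈ = proj₂ (∈-filter⁻ (λ x → v ≟ depth x) {xs = allFin n} x∈)

  onLevel-unique : ∀ v → Unique (onLevel v)
  onLevel-unique v = Unique.filter⁺ (λ x → v ≟ depth x) (Unique.allFin⁺ n)

  suc-depth⇒≢ : ∀ {x e} → depth x ≡ suc e → x ≢ u
  suc-depth⇒≢ eq refl = contradiction (Eq.trans (sym depth-root) eq) 0≢1+n

  par≡u : ∀ {x} → x ≢ u → depth x ≡ 1 → par x ≡ u
  par≡u ne eq = depth≡0 (suc-injective (Eq.trans (sym (par-depth ne)) eq))

  -- Two children and its own parent would give `par y` three distinct neighbours.
  one-child : ∀ {y z} → y ≢ u → z ≢ u → par y ≢ u → par y ≡ par z → y ≡ z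
  one-child {y} {z} y≢ z≢ p≢ eq with y Fin.≟ z
  ... | yes e = e
  ... | no ne = contradiction (≤-trans (degree-≥ {par y} {par (par y) ∷ y ∷ z ∷ []}
            ((up≢ y≢ refl ∷ up≢ z≢ (sym eq) ∷ []) ∷ (ne ∷ []) ∷ [] ∷ [])
            (par-edge p≢ ∷ G-sym (par-edge y≢) ∷ subst (λ w → G w z ≡ true) (sym eq) (G-sym (par-edge z≢)) ∷ [])) (others p≢)) λ { (s≤s (s≤s ())) }
    where
    up≢ : ∀ {w} → w ≢ u → par w ≡ par y → par (par y) ≢ w
    up≢ {w} w≢ e e′ = <⇒≢ (m<n⇒m<1+n (n<1+n (depth (par (par y)))))
      (Eq.trans (cong depth e′) (Eq.trans (par-depth w≢) (cong suc (Eq.trans (cong depth e) (par-depth p≢)))))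

  ancestor : ℕ → V → V
  ancestor zero    x = x
  ancestor (suc m) x = ancestor m (par x)

  -- The vertex at depth 1 serves as the name of the branch; the root is sent to itself.
  top : V → V
  top x = ancestor (depth x ∸ 1) x

  top-at-1 : ∀ {x} → depth x ≡ 1 → top x ≡ x
  top-at-1 {x} e = cong (λ z → ancestor (z ∸ 1) x) e

  top-par : ∀ {x e} → depth x ≡ suc (suc e) → top (par x) ≡ top x
  top-par {x} {e} eq = Eq.trans (cong (λ z → ancestor (z ∸ 1) (par x)) (suc-injective (Eq.trans (sym (par-depth (suc-depth⇒≢ eq))) eq)))
                                (cong (λ z → ancestor (z ∸ 1) x) (sym eq))

  par-depth′ : ∀ {x e} → depth x ≡ suc e → depth (par x) ≡ e
  par-depth′ eq = suc-injective (Eq.trans (sym (par-depth (suc-depth⇒≢ eq))) eq)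

  top-depth : ∀ {x} e → depth x ≡ suc e → depth (top x) ≡ 1
  top-depth zero    eq = Eq.trans (cong depth (top-at-1 eq)) eq
  top-depth (suc e) eq = Eq.trans (cong depth (sym (top-par eq))) (top-depth e (par-depth′ eq))

  -- By `one-child` the branches are paths and meet each depth at most once.
  top-injective : ∀ e {x y} → depth x ≡ suc e → depth y ≡ suc e → top x ≡ top y → x ≡ y
  top-injective zero    p q t = Eq.trans (sym (top-at-1 p)) (Eq.trans t (top-at-1 q))
  top-injective (suc e) p q t = one-child (suc-depth⇒≢ p) (suc-depth⇒≢ q) (suc-depth⇒≢ (par-depth′ p))
    (top-injective e (par-depth′ p) (par-depth′ q) (Eq.trans (top-par p) (Eq.trans t (sym (top-par q)))))

  long : List V
  long = map top (onLevel (suc h))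

  long-unique : Unique long
  long-unique = unique-map (onLevel-unique (suc h)) (λ x∈ y∈ → top-injective h (sym (∈-onLevel⁻ x∈)) (sym (∈-onLevel⁻ y∈)))

  long⊆ : ∀ {z} → z ∈ long → z ∈ onLevel 1
  long⊆ z∈ with ∈-map⁻ top z∈
  ... | x , x∈ , refl = ∈-onLevel⁺ (sym (top-depth h (sym (∈-onLevel⁻ x∈))))

  short : List V
  short = proj₁ (unique-⊆-↭ long-unique long⊆)

  branches↭ : onLevel 1 ↭ long ++ short
  branches↭ = proj₂ (unique-⊆-↭ long-unique long⊆)

  br : V → ℕ
  br x = idx (top x) (long ++ short)

  top∈ : ∀ {x e} → depth x ≡ suc e → top x ∈ long ++ short
  top∈ {e = e} eq = Perm.∈-resp-↭ branches↭ (∈-onLevel⁺ (sym (top-depth e eq)))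

  length-branches : length (long ++ short) ≡ k
  length-branches = Eq.trans (sym (Perm.↭-length branches↭)) (Eq.trans (length-onLevel 1) degree≡)

  br<k : ∀ {x e} → depth x ≡ suc e → br x < k
  br<k {x} eq = subst₂ _<_ (cong (idx (top x)) (++-identityʳ (long ++ short))) length-branches (idx< (long ++ short) [] (top∈ eq))

  code : ℕ → ℕ → ℕ
  code zero    b = 0
  code (suc e) b = suc (e * k + b)

  label : V → ℕ
  label x = code (depth x) (br x)

  label-suc : ∀ {x e} → depth x ≡ suc e → label x ≡ suc (e * k + br x)
  label-suc {x} eq = cong (λ z → code z (br x)) eq

  label-root : label u ≡ 0
  label-root = cong (λ z → code z (br u)) depth-root

  label-0 : ∀ {x} → depth x ≡ 0 → label x ≡ 0
  label-0 {x} eq = cong (λ z → code z (br x)) eq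

  depth-cases : ∀ x → (depth x ≡ 0) ⊎ (∃ λ e → depth x ≡ suc e)
  depth-cases x = cases (depth x)
    where
    cases : ∀ m → (m ≡ 0) ⊎ (∃ λ e → m ≡ suc e)
    cases zero    = inj₁ refl
    cases (suc e) = inj₂ (e , refl)

  label≤N : ∀ x → label x ≤ N
  label≤N x with depth-cases x
  ... | inj₁ eq = ≤-trans (≤-reflexive (label-0 eq)) z≤n
  ... | inj₂ (e , eq) with m≤n⇒m<n∨m≡n (≤-pred (subst (_≤ suc h) eq (depth≤ x)))
  ...   | inj₁ e<h = begin
    label x             ≡⟨ label-suc eq ⟩
    suc (e * k + br x)  ≡⟨ +-suc (e * k) (br x) ⟨
    e * k + suc (br x)  ≤⟨ +-monoʳ-≤ (e * k) (br<k eq) ⟩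
    e * k + k           ≡⟨ +-comm (e * k) k ⟩
    suc e * k           ≤⟨ *-monoˡ-≤ k e<h ⟩
    h * k               ≤⟨ m≤n+m _ _ ⟩
    cnt (suc h) (map depth (allFin n)) + h * k ≤⟨ bottom≤ ⟩
    N                   ∎
    where open ≤-Reasoning
  -- A bottom vertex lies on a branch in `long`. As these branches are listed first, its index is
  -- below the number of bottom vertices, for which `bottom≤` provides the room.
  ...   | inj₂ refl = begin
    label x                     ≡⟨ label-suc eq ⟩
    suc (e * k + br x)          ≡⟨ cong suc (+-comm (e * k) (br x)) ⟩
    suc (br x) + e * k          ≤⟨ +-monoˡ-≤ (e * k) (idx< long short (∈-map⁺ top (∈-onLevel⁺ (sym eq)))) ⟩
    length long + e * k         ≡⟨ cong (_+ e * k) (Eq.trans (length-map top (onLevel (suc h))) (length-onLevel (suc h))) ⟩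
    cnt (suc h) (map depth (allFin n)) + e * k ≤⟨ bottom≤ ⟩
    N                           ∎
    where open ≤-Reasoning

  code-injective : ∀ {e b e′ b′} → b < k → b′ < k → suc (e * k + b) ≡ suc (e′ * k + b′) → (e ≡ e′) × (b ≡ b′)
  code-injective {e} {b} {e′} {b′} b< b′< eq = e≡ , +-cancelˡ-≡ (e * k) b b′ (Eq.trans (suc-injective eq) (cong (λ z → z * k + b′) (sym e≡)))
    where
    e≡ : e ≡ e′
    e≡ = Eq.trans (sym ([a*n+b]/n≡a k′ e b<)) (Eq.trans (cong (_/ k) (suc-injective eq)) ([a*n+b]/n≡a k′ e′ b′<))

  label-injective : ∀ {x y} → label x ≡ label y → x ≡ y
  label-injective {x} {y} eq with depth-cases x | depth-cases y
  ... | inj₁ dx       | inj₁ dy        = Eq.trans (depth≡0 dx) (sym (depth≡0 dy))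
  ... | inj₁ dx       | inj₂ (_ , dy)  = contradiction (Eq.trans (sym (label-0 dx)) (Eq.trans eq (label-suc dy))) 0≢1+n
  ... | inj₂ (_ , dx) | inj₁ dy        = contradiction (Eq.trans (sym (label-0 dy)) (Eq.trans (sym eq) (label-suc dx))) 0≢1+n
  ... | inj₂ (e , dx) | inj₂ (e′ , dy) with code-injective {e} {_} {e′} (br<k dx) (br<k dy) (Eq.trans (sym (label-suc dx)) (Eq.trans eq (label-suc dy)))
  ...   | refl , b≡ = top-injective e dx dy (idx-injective (long ++ short) (top∈ dx) (top∈ dy) b≡)

  label-par : ∀ {y} → y ≢ u → BSParent k (label (par y)) (label y)
  label-par {y} y≢ with depth-cases y
  ... | inj₁ dy           = contradiction (depth≡0 dy) y≢
  ... | inj₂ (zero , dy)  = inj₁ (Eq.trans (cong label (par≡u y≢ dy)) label-root , subst (1 ≤_) (sym (label-suc dy)) (s≤s z≤n) , subst (_≤ k) (sym (label-suc dy)) (br<k dy))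
  ... | inj₂ (suc e , dy) = inj₂ (≤-trans (s≤s z≤n) (≤-reflexive (sym lp)) , Eq.trans (cong (_+ k) lp) (Eq.trans (cong suc (shuffle e k (br y))) (sym (label-suc dy))))
    where
    lp : label (par y) ≡ suc (e * k + br y)
    lp = Eq.trans (label-suc (par-depth′ dy)) (cong (λ z → suc (e * k + idx z (long ++ short))) (top-par dy))
    shuffle : ∀ e k b → e * k + b + k ≡ k + e * k + b
    shuffle = solve-∀

  parent-label : ∀ {x y} → BSParent k (label x) (label y) → (y ≢ u) × (x ≡ par y)
  parent-label {x} {y} bp = y≢ , label-injective (BSParent-unique bp (label-par y≢))
    where
    y≢ : y ≢ u
    y≢ y≡u = no-parent (subst (BSParent k (label x)) (Eq.trans (cong label y≡u) label-root) bp)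
      where
      no-parent : ∀ {a} → ¬ BSParent k a 0
      no-parent (inj₁ (_ , () , _))
      no-parent (inj₂ (1≤a , eq)) = contradiction (subst (1 ≤_) (m+n≡0⇒m≡0 _ eq) 1≤a) λ ()

  number : V → V
  number x = fromℕ< {label x} (subst (label x <_) (sym n≡) (s≤s (label≤N x)))

  toℕ-number : ∀ x → toℕ (number x) ≡ label x
  toℕ-number x = Fin.toℕ-fromℕ< _

  number-injective : ∀ {x y} → number x ≡ number y → x ≡ y
  number-injective {x} {y} e = label-injective (Eq.trans (sym (toℕ-number x)) (Eq.trans (cong toℕ e) (toℕ-number y)))

  isomorphic : G ≅ BS n k
  isomorphic = mk⤖ (number-injective , λ y → case injective⇒surjective number number-injective y of λ where (x , e) → x , λ { refl → e })
             , λ x y → true-ext (preserves x y) (reflects x y)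
    where
    labels : ∀ {x y} → BSParent k (label x) (label y) → BSParent k (toℕ (number x)) (toℕ (number y))
    labels {x} {y} = subst₂ (BSParent k) (sym (toℕ-number x)) (sym (toℕ-number y))
    labels⁻ : ∀ {x y} → BSParent k (toℕ (number x)) (toℕ (number y)) → BSParent k (label x) (label y)
    labels⁻ {x} {y} = subst₂ (BSParent k) (toℕ-number x) (toℕ-number y)
    preserves : ∀ x y → G x y ≡ true → BS n k (number x) (number y) ≡ true
    preserves x y xy with edge-par xy
    ... | inj₁ (x≢ , refl) = BS⁺ {n} {k} (inj₂ (labels {par x} {x} (label-par x≢)))
    ... | inj₂ (y≢ , refl) = BS⁺ {n} {k} (inj₁ (labels {par y} {y} (label-par y≢)))
    reflects : ∀ x y → BS n k (number x) (number y) ≡ true → G x y ≡ true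
    reflects x y e with BS⁻ {n} {k} {number x} {number y} e
    ... | inj₁ bp with parent-label (labels⁻ {x} {y} bp)
    ...   | y≢ , refl = G-sym (par-edge y≢)
    reflects x y e | inj₂ bp with parent-label (labels⁻ {y} {x} bp)
    ...   | x≢ , refl = par-edge x≢

-- Acyclicity when every vertex has at most one smaller neighbour

module Ordered {n : ℕ} (G : Graph n) (simple : IsSimple G)
  (low : ∀ {y a b} → G y a ≡ true → G y b ≡ true → toℕ a < toℕ y → toℕ b < toℕ y → a ≡ b) where

  open Growth G simple using (V; G-sym; G-irrefl)

  NoBacktrack : List V → Set
  NoBacktrack (a ∷ b ∷ c ∷ l) = (a ≢ c) × NoBacktrack (b ∷ c ∷ l)
  NoBacktrack _               = ⊤

  tail-nb : ∀ {a b z} l → NoBacktrack (a ∷ b ∷ l ++ [ z ]) → NoBacktrack (b ∷ l ++ [ z ])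
  tail-nb []      (_ , r) = r
  tail-nb (_ ∷ _) (_ , r) = r

  lastOf : V → List V → V
  lastOf a []      = a
  lastOf a (b ∷ l) = lastOf b l

  headOf : List V → V → V
  headOf []      z = z
  headOf (b ∷ l) z = b

  edge-cmp : ∀ {a b} → G a b ≡ true → (toℕ a < toℕ b) ⊎ (toℕ b < toℕ a)
  edge-cmp {a} {b} ab with <-cmp (toℕ a) (toℕ b)
  ... | tri< lt _ _ = inj₁ lt
  ... | tri> _ _ gt = inj₂ gt
  ... | tri≈ _ e _  = contradiction (subst (λ z → G a z ≡ true) (sym (Fin.toℕ-injective e)) ab) G-irrefl

  first-edge : ∀ a l {z} → Chain G (a ∷ l ++ [ z ]) → G a (headOf l z) ≡ true
  first-edge a []      (e , _) = e
  first-edge a (b ∷ l) (e , _) = e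

  final-edge : ∀ a l {z} → Chain G (a ∷ l ++ [ z ]) → G (lastOf a l) z ≡ true
  final-edge a []      (e , _) = e
  final-edge a (b ∷ l) (_ , c) = final-edge b l c

  -- After an upward step a → b the only smaller neighbour of b is a, so the walk cannot turn down.
  keeps-rising : ∀ a l {z} → Chain G (a ∷ l ++ [ z ]) → NoBacktrack (a ∷ l ++ [ z ]) → toℕ a < toℕ (headOf l z) →
    (toℕ a < toℕ z) × (toℕ (lastOf a l) < toℕ z)
  keeps-rising a []      ch nb lt = lt , lt
  keeps-rising a (b ∷ l) {z} (ab , ch) nb lt with edge-cmp (first-edge b l ch)
  ... | inj₁ up   = let r = keeps-rising b l ch (tail-nb l nb) up in <-trans lt (proj₁ r) , proj₂ r
  ... | inj₂ down = contradiction (low (G-sym ab) (first-edge b l ch) lt down) (a≢ l nb)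
    where
    a≢ : ∀ l → NoBacktrack (a ∷ b ∷ l ++ [ z ]) → a ≢ headOf l z
    a≢ []      (ne , _) = ne
    a≢ (_ ∷ _) (ne , _) = ne

  -- The falling steps at the start either last to the end or are followed by a rise, which then
  -- persists.
  rises-or-falls : ∀ a l {z} → Chain G (a ∷ l ++ [ z ]) → NoBacktrack (a ∷ l ++ [ z ]) →
    (toℕ (lastOf a l) < toℕ z) ⊎ (toℕ z < toℕ a)
  rises-or-falls a []      ch nb = edge-cmp (proj₁ ch)
  rises-or-falls a (b ∷ l) {z} ch@(ab , ch′) nb with edge-cmp ab
  ... | inj₁ up   = inj₁ (proj₂ (keeps-rising a (b ∷ l) ch nb up))
  ... | inj₂ down with rises-or-falls b l ch′ (tail-nb l nb)
  ...   | inj₁ up  = inj₁ up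
  ...   | inj₂ lt  = inj₂ (<-trans lt down)

  unique⇒no-backtrack : ∀ {z} a l → Unique (a ∷ l) → z ∉ a ∷ l → NoBacktrack (a ∷ l ++ [ z ])
  unique⇒no-backtrack a []          u z∉ = tt
  unique⇒no-backtrack a (b ∷ [])    u z∉ = (λ e → z∉ (here (sym e))) , tt
  unique⇒no-backtrack a (b ∷ c ∷ l) u@((_ ∷ a≢c ∷ _) ∷ u′) z∉ = a≢c , unique⇒no-backtrack b (c ∷ l) u′ (z∉ ∘ there)

  lastOf∈ : ∀ a l → lastOf a l ∈ a ∷ l
  lastOf∈ a []      = here refl
  lastOf∈ a (b ∷ l) = there (lastOf∈ b l)

  -- A closed walk that rises at once, or falls throughout, would give x < x. Otherwise it leaves
  -- `x` downwards and returns from below; the two smaller neighbours of `x` must coincide, against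
  -- distinctness.
  acyclic : Acyclic G
  acyclic (x , b ∷ [] , s≤s () , _)
  acyclic (x , b ∷ c ∷ r , _ , u@((_ ∷ x≢c ∷ _) ∷ u′) , ch) with edge-cmp (proj₁ ch)
  ... | inj₁ up   = <-irrefl refl (proj₁ (keeps-rising x (b ∷ c ∷ r) ch nb up))
    where
    nb : NoBacktrack (x ∷ b ∷ c ∷ r ++ [ x ])
    nb = x≢c , unique⇒no-backtrack b (c ∷ r) u′ (Unique.Unique[x∷xs]⇒x∉xs u)
  ... | inj₂ down with rises-or-falls x (b ∷ c ∷ r) ch (x≢c , unique⇒no-backtrack b (c ∷ r) u′ (Unique.Unique[x∷xs]⇒x∉xs u))
  ...   | inj₂ lt = <-irrefl refl lt
  ...   | inj₁ up = unique-∉ u′ (lastOf∈ c r) (sym (low (proj₁ ch) (G-sym (final-edge x (b ∷ c ∷ r) ch)) down up))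

-- `BS` is a tree

module _ {n} {G : Graph n} where

  reach-mono : ∀ k {x y} → reach G k x y ≡ true → reach G (suc k) x y ≡ true
  reach-mono k {x} {y} r = cong (_∨ any (λ z → G x z ∧ reach G k z y) (allFin n)) r

  reach-trans : ∀ i {j x y z} → reach G i x y ≡ true → reach G j y z ≡ true → reach G (i + j) x z ≡ true
  reach-trans zero    r s with isYes-≟ r
  ... | refl = s
  reach-trans (suc i) {j} r s with reach-suc⁻ {k = i} r
  ... | inj₁ r′ = reach-mono (i + j) (reach-trans i r′ s)
  ... | inj₂ (w , e , r′) = reach-suc {k = i + j} e (reach-trans i r′ s)

  least-≤ : ∀ p b k → p k ≡ true → least p b ≤ k
  least-≤ p zero    k pk = z≤n
  least-≤ p (suc b) k pk with p 0 in eq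
  ... | true = z≤n
  least-≤ p (suc b) zero    pk | false = contradiction (Eq.trans (sym eq) pk) λ ()
  least-≤ p (suc b) (suc k) pk | false = s≤s (least-≤ (p ∘ suc) b k pk)

  reach⇒dist≤ : ∀ k {x y} → reach G k x y ≡ true → dist G x y ≤ k
  reach⇒dist≤ k {x} {y} r = least-≤ (λ k → reach G k x y) n k r

  1≤dist : ∀ {x y} → x ≢ y → 1 ≤ dist G x y
  1≤dist {x} {y} ne = positive n refl
    where
    positive : ∀ b → n ≡ b → 1 ≤ least (λ k → reach G k x y) b
    positive zero    eq = contradiction (subst Fin eq x) λ ()
    positive (suc b) eq with reach G 0 x y in r
    ... | true  = contradiction (isYes-≟ r) ne
    ... | false = s≤s z≤n

BSParent-< : ∀ {k x y} → 1 ≤ k → BSParent k x y → x < y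
BSParent-< 1≤k (inj₁ (refl , 1≤y , _)) = 1≤y
BSParent-< {x = x} 1≤k (inj₂ (_ , refl)) = m<m+n x 1≤k

module Balanced (N c : ℕ) where

  n k : ℕ
  n = suc N
  k = suc c

  G : Graph n
  G = BS n k

  V : Set
  V = Fin n

  G-simple : IsSimple G
  G-simple = (λ x y → true-ext (flip x y) (flip y x)) , λ x → irrefl x
    where
    flip : ∀ x y → G x y ≡ true → G y x ≡ true
    flip x y e with BS⁻ {n} {k} {x} {y} e
    ... | inj₁ p = BS⁺ {n} {k} (inj₂ p)
    ... | inj₂ p = BS⁺ {n} {k} (inj₁ p)
    irrefl : ∀ x → G x x ≡ false
    irrefl x with G x x in e
    ... | false = refl
    ... | true with BS⁻ {n} {k} {x} {x} e
    ...   | inj₁ p = contradiction (BSParent-< (s≤s z≤n) p) (<-irrefl refl)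
    ...   | inj₂ p = contradiction (BSParent-< (s≤s z≤n) p) (<-irrefl refl)

  smaller⇒parent : ∀ {y a} → G y a ≡ true → toℕ a < toℕ y → BSParent k (toℕ a) (toℕ y)
  smaller⇒parent {y} {a} e lt with BS⁻ {n} {k} {y} {a} e
  ... | inj₂ p = p
  ... | inj₁ p = contradiction (BSParent-< (s≤s z≤n) p) (<-asym lt)

  G-acyclic : Acyclic G
  G-acyclic = Ordered.acyclic G G-simple λ {y} {a} {b} ya yb a< b< →
    Fin.toℕ-injective (BSParent-unique (smaller⇒parent {y} {a} ya a<) (smaller⇒parent {y} {b} yb b<))

  pos : ℕ → ℕ → ℕ
  pos e b = suc (e * k + b)

  pos-suc : ∀ e b → pos e b + k ≡ pos (suc e) b
  pos-suc e b = cong suc (shuffle e c b)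
    where
    shuffle : ∀ e c b → e * (1 + c) + b + (1 + c) ≡ (1 + c) + e * (1 + c) + b
    shuffle = solve-∀

  pos-split : ∀ t → ∃ λ e → ∃ λ b → (b < k) × (suc t ≡ pos e b)
  pos-split t = t / k , t % k , m%n<n t k , cong suc (Eq.trans (m≡m%n+[m/n]*n t k) (+-comm (t % k) _))

  climb : ∀ m e b {x y : V} → toℕ x ≡ pos (m + e) b → toℕ y ≡ pos e b → reach G m x y ≡ true
  climb zero    e b {x} {y} px py with Fin.toℕ-injective {i = x} {y} (Eq.trans px (sym py))
  ... | refl = isYes-refl x
  climb (suc m) e b {x} {y} px py = reach-suc {G = G} {k = m} {x} {y} {z} (BS⁺ {n} {k} {x} {z} (inj₂ (inj₂ (subst (1 ≤_) (sym pz) (s≤s z≤n) , Eq.trans (cong (_+ k) pz) (Eq.trans (pos-suc (m + e) b) (sym px)))))) (climb m e b pz py)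
    where
    z< : pos (m + e) b < n
    z< = <-trans (subst (pos (m + e) b <_) (Eq.trans (pos-suc (m + e) b) (sym px)) (m<m+n _ (s≤s z≤n))) (Fin.toℕ<n x)
    z : V
    z = fromℕ< z<
    pz : toℕ z ≡ pos (m + e) b
    pz = Fin.toℕ-fromℕ< z<

  centre-edge : ∀ {x : V} b → b < k → toℕ x ≡ pos 0 b → BSParent k 0 (toℕ x)
  centre-edge b b< px = inj₁ (refl , subst (1 ≤_) (sym px) (s≤s z≤n) , subst (_≤ k) (sym px) b<)

  to-centre : ∀ e b {x : V} → b < k → toℕ x ≡ pos e b → reach G (suc e) x zero ≡ true
  to-centre e b {x} b< px = subst (λ m → reach G m x zero ≡ true) (+-comm e 1)
    (reach-trans {G = G} e {1} {x} {z} {zero} (climb e 0 b (Eq.trans px (cong (λ w → pos w b) (sym (+-identityʳ e)))) pz)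
      (reach-suc {G = G} {k = 0} {z} {zero} {zero} (BS⁺ {n} {k} {z} {zero} (inj₂ (centre-edge b b< pz))) (isYes-refl {n} zero)))
    where
    z< : pos 0 b < n
    z< = ≤-trans (s≤s (≤-trans (s≤s (m≤n+m b (e * k))) (≤-reflexive (sym px)))) (Fin.toℕ<n x)
    z : V
    z = fromℕ< z<
    pz : toℕ z ≡ pos 0 b
    pz = Fin.toℕ-fromℕ< z<

  from-centre : ∀ e b {x : V} → b < k → toℕ x ≡ pos e b → reach G (suc e) zero x ≡ true
  from-centre zero    b {x} b< px = reach-suc {G = G} {k = 0} {zero} {x} {x} (BS⁺ {n} {k} {zero} {x} (inj₁ (centre-edge b b< px))) (isYes-refl x)
  from-centre (suc e) b {x} b< px = subst (λ m → reach G m zero x ≡ true) (+-comm (suc e) 1)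
    (reach-trans {G = G} (suc e) {1} {zero} {z} {x} (from-centre e b b< pz) (reach-suc {G = G} {k = 0} {z} {x} {x}
      (BS⁺ {n} {k} {z} {x} (inj₁ (inj₂ (subst (1 ≤_) (sym pz) (s≤s z≤n) , Eq.trans (cong (_+ k) pz) (Eq.trans (pos-suc e b) (sym px)))))) (isYes-refl x)))
    where
    z< : pos e b < n
    z< = <-trans (subst (pos e b <_) (Eq.trans (pos-suc e b) (sym px)) (m<m+n _ (s≤s z≤n))) (Fin.toℕ<n x)
    z : V
    z = fromℕ< z<
    pz : toℕ z ≡ pos e b
    pz = Fin.toℕ-fromℕ< z<

  G-connected : Connected G
  G-connected x y = proj₁ (up x) + proj₁ (down′ y) , reach-trans {G = G} (proj₁ (up x)) {x = x} {zero} {y} (proj₂ (up x)) (proj₂ (down′ y))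
    where
    up : ∀ x → ∃ λ m → reach G m x zero ≡ true
    up zero    = 0 , refl
    up (suc x) with pos-split (toℕ x)
    ... | e , b , b< , eq = suc e , to-centre e b b< eq
    down′ : ∀ x → ∃ λ m → reach G m zero x ≡ true
    down′ zero    = 0 , refl
    down′ (suc x) with pos-split (toℕ x)
    ... | e , b , b< , eq = suc e , from-centre e b b< eq

  G-tree : IsTree G
  G-tree = G-simple , G-connected , G-acyclic

  -- Newest vertex first, as `pairSum` expects.
  below : ∀ i → i ≤ n → List V
  below zero    _  = []
  below (suc i) i≤ = fromℕ< i≤ ∷ below i (<⇒≤ i≤)

  ∈-below⁻ : ∀ i i≤ {x} → x ∈ below i i≤ → toℕ x < i
  ∈-below⁻ (suc i) i≤ (here refl) = s≤s (≤-reflexive (Fin.toℕ-fromℕ< i≤))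
  ∈-below⁻ (suc i) i≤ (there x∈)  = m<n⇒m<1+n (∈-below⁻ i (<⇒≤ i≤) x∈)

  ∈-below⁺ : ∀ i i≤ {x} → toℕ x < i → x ∈ below i i≤
  ∈-below⁺ (suc i) i≤ {x} (s≤s x≤) with m≤n⇒m<n∨m≡n x≤
  ... | inj₁ lt = there (∈-below⁺ i (<⇒≤ i≤) lt)
  ... | inj₂ e  = here (Fin.toℕ-injective (Eq.trans e (sym (Fin.toℕ-fromℕ< i≤))))

  below-unique : ∀ i i≤ → Unique (below i i≤)
  below-unique zero    _  = []
  below-unique (suc i) i≤ = ∉⇒All≢ (λ x∈ → <-irrefl (Fin.toℕ-fromℕ< i≤) (∈-below⁻ i (<⇒≤ i≤) x∈)) ∷ below-unique i (<⇒≤ i≤)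

  below-complete : ∀ z → z ∈ below n ≤-refl
  below-complete z = ∈-below⁺ n ≤-refl (Fin.toℕ<n z)

-- A lower bound for the Harary index of `BS`

-- Here dd t is the distance from vertex h k + r + 1 to vertex t + 1 of BS, where k = c + 1. It is
-- tabulated level by level, a level being a block of k consecutive vertices of which the r-th lies
-- on the same branch.
module Profile (c h r : ℕ) (r≤c : r ≤ c) (dd : ℕ → ℕ)
  (near : ∀ e → dd (e * suc c + r) ≡ h ∸ e)
  (far : ∀ e s → s ≤ c → s ≢ r → dd (e * suc c + s) ≡ suc h + suc e) where

  dists : ℕ → List ℕ
  dists zero    = []
  dists (suc i) = dd i ∷ dists i

  -- The distances to the vertices of the same branch on the a levels nearest to the centre.
  own : ℕ → List ℕ
  own zero    = []
  own (suc a) = (h ∸ a) ∷ own a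

  own↭down : ∀ a → a ≤ h → own a ++ down (h ∸ a) ↭ down h
  own↭down zero    _  = ↭-refl
  own↭down (suc a) a< = ↭-trans (↭-sym (Perm.shift (h ∸ a) (own a) (down (h ∸ suc a))))
    (subst (λ z → own a ++ z ↭ down h) (sym last-down) (own↭down a (<⇒≤ a<)))
    where
    last-down : (h ∸ a) ∷ down (h ∸ suc a) ≡ down (h ∸ a)
    last-down = Eq.trans (cong (_∷ down (h ∸ suc a)) (sym (suc-∸ a<))) (cong down (suc-∸ a<))
      where
      suc-∸ : ∀ {a h} → suc a ≤ h → suc (h ∸ suc a) ≡ h ∸ a
      suc-∸ {a} {suc h} (s≤s p) = sym (+-∸-assoc 1 p)

  Shape : ℕ → ℕ → ℕ → Set
  Shape i a b = dists i ↭ own a ++ map (suc h +_) (levels c b)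

  shape-near : ∀ {i e b} → dd i ≡ h ∸ e → Shape i e b → Shape (suc i) (suc e) b
  shape-near {i} {e} {b} eq s = subst (λ z → z ∷ dists i ↭ own (suc e) ++ map (suc h +_) (levels c b)) (sym eq) (prep (h ∸ e) s)

  shape-far : ∀ {i e a} s → s < c → dd i ≡ suc h + suc e → Shape i a (e * c + s) → Shape (suc i) a (suc (e * c + s))
  shape-far {i} {e} {a} s s<c eq sh = ↭-trans (subst (λ z → dd i ∷ dists i ↭ z ∷ own a ++ rest) (Eq.trans eq (cong (suc h +_) (sym (lev c s<c)))) (prep (dd i) sh))
    (↭-sym (Perm.shift (suc h + level c (e * c + s)) (own a) rest))
    where
    rest = map (suc h +_) (levels c (e * c + s))
    lev : ∀ c → s < c → level c (e * c + s) ≡ suc e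
    lev (suc c) s<c = cong suc ([a*n+b]/n≡a c e s<c)

  -- The two phases are the parts of level e before and after position r: the own branch has been
  -- met e times in the first and e + 1 times in the second.
  phase₁ : ∀ e s → s ≤ r → Shape (e * suc c + s) e (e * c + s)
  phase₂ : ∀ e s → r ≤ s → s ≤ c → Shape (e * suc c + suc s) (suc e) (e * c + s)

  phase₁ zero    zero    _   = ↭-refl
  phase₁ (suc e) zero    _   = subst₂ (λ i b → Shape i (suc e) b) (wrap₁ e c) (wrap₂ e c) (phase₂ e c r≤c ≤-refl)
    where
    wrap₁ : ∀ e c → e * (1 + c) + (1 + c) ≡ (1 + c + e * (1 + c)) + 0
    wrap₁ = solve-∀
    wrap₂ : ∀ e c → e * c + c ≡ (c + e * c) + 0
    wrap₂ = solve-∀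
  phase₁ e (suc s) s<r = subst₂ (λ i b → Shape i e b) (sym (+-suc (e * suc c) s)) (sym (+-suc (e * c) s))
    (shape-far {e = e} s (≤-trans s<r r≤c) (far e s (≤-trans (<⇒≤ s<r) r≤c) (<⇒≢ s<r)) (phase₁ e s (<⇒≤ s<r)))

  phase₂ e s r≤s s≤c with m≤n⇒m<n∨m≡n r≤s
  phase₂ e s       r≤s s≤c | inj₂ refl = subst (λ i → Shape i (suc e) (e * c + s)) (sym (+-suc (e * suc c) s)) (shape-near {e = e} {e * c + s} (near e) (phase₁ e s ≤-refl))
  phase₂ e (suc s) r≤s s≤c | inj₁ (s≤s r≤s′) = subst₂ (λ i b → Shape i (suc e) b) (sym (+-suc (e * suc c) (suc s))) (sym (+-suc (e * c) s))
    (shape-far {e = e} s s≤c (far e (suc s) s≤c (λ e → <⇒≢ (s≤s r≤s′) (sym e))) (phase₂ e s r≤s′ (<⇒≤ s≤c)))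

  profile : dists (h * suc c + r) ↭ down h ++ map (suc h +_) (levels c (h * c + r))
  profile = ↭-trans (phase₁ h r ≤-refl) (Perm.++⁺ʳ (map (suc h +_) (levels c (h * c + r))) own-all)
    where
    own-all : own h ↭ down h
    own-all = ↭-trans (↭-reflexive (sym (Eq.trans (cong (λ z → own h ++ down z) (n∸n≡0 h)) (++-identityʳ (own h))))) (own↭down h ≤-refl)

module BalancedHarary (N c : ℕ) where

  open Balanced N c
  open Weighted inv inv-anti
  open Spider inv inv-anti

  private
    w : V → V → ℚ
    w x y = inv (dist G x y)

  module _ (m : ℕ) (m<N : suc m < n) where

    private
      h r : ℕ
      h = m / k
      r = m % k

      r≤c : r ≤ c
      r≤c = ≤-pred (m%n<n m k)

      m≡ : m ≡ h * k + r
      m≡ = Eq.trans (m≡m%n+[m/n]*n m k) (+-comm r (h * k))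

      x : V
      x = fromℕ< m<N

      px : toℕ x ≡ pos h r
      px = Eq.trans (Fin.toℕ-fromℕ< m<N) (cong suc m≡)

      dd : ℕ → ℕ
      dd t with t % k ≟ r
      ... | yes _ = h ∸ t / k
      ... | no _  = suc h + suc (t / k)

      rem : ∀ e s → s ≤ c → (e * k + s) % k ≡ s
      rem e s s≤c = Eq.trans (cong (_% k) (+-comm (e * k) s)) (Eq.trans ([m+kn]%n≡m%n s e k) (m<n⇒m%n≡m (s≤s s≤c)))

      near : ∀ e → dd (e * k + r) ≡ h ∸ e
      near e with (e * k + r) % k ≟ r
      ... | yes _ = cong (h ∸_) ([a*n+b]/n≡a c e (s≤s r≤c))
      ... | no ne = contradiction (rem e r r≤c) ne

      far : ∀ e s → s ≤ c → s ≢ r → dd (e * k + s) ≡ suc h + suc e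
      far e s s≤c s≢r with (e * k + s) % k ≟ r
      ... | yes eq = contradiction (Eq.trans (sym (rem e s s≤c)) eq) s≢r
      ... | no _   = cong (λ z → suc h + suc z) ([a*n+b]/n≡a c e (s≤s s≤c))

      open Profile c h r r≤c dd near far

      dist≤dd : ∀ {y : V} t → t < m → toℕ y ≡ suc t → dist G x y ≤ dd t
      dist≤dd {y} t t<m py with t % k ≟ r
      ... | yes eq = reach⇒dist≤ {G = G} (h ∸ t / k) (climb (h ∸ t / k) (t / k) r
                       (Eq.trans px (cong (λ z → pos z r) (sym (m∸n+n≡m (/-mono-≤ {o = k} (<⇒≤ t<m) ≤-refl)))))
                       (Eq.trans py (cong suc (Eq.trans (m≡m%n+[m/n]*n t k) (Eq.trans (+-comm (t % k) _) (cong (t / k * k +_) eq))))))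
      ... | no _   = reach⇒dist≤ {G = G} (suc h + suc (t / k)) (reach-trans {G = G} (suc h) {suc (t / k)} {x} {zero} {y} (to-centre h r (m%n<n m k) px)
                       (from-centre (t / k) (t % k) (m%n<n t k) (Eq.trans py (cong suc (Eq.trans (m≡m%n+[m/n]*n t k) (+-comm (t % k) _))))))

      inv-dist : ∀ {y d} → toℕ y < toℕ x → dist G x y ≤ d → inv d ≤ℚ w x y
      inv-dist lt le = f-mono (1≤dist {G = G} λ e → <⇒≢ lt (cong toℕ (sym e))) le

      toℕ-x : toℕ x ≡ suc m
      toℕ-x = Fin.toℕ-fromℕ< m<N

      -- The extra summand `inv (suc h)` stands for the centre, which `dists` does not list.
      sum-below : ∀ i i≤ → i ≤ m → sumOver inv (dists i) +ℚ inv (suc h) ≤ℚ sumOver (w x) (below (suc i) i≤)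
      sum-below zero i≤ _ = ℚ.≤-trans (ℚ.≤-reflexive (ℚ.+-comm 0ℚ (inv (suc h))))
        (ℚ.+-monoˡ-≤ 0ℚ (inv-dist (subst (0 <_) (sym toℕ-x) (s≤s z≤n)) (reach⇒dist≤ {G = G} (suc h) (to-centre h r (m%n<n m k) px))))
      sum-below (suc i) i≤ i<m = ℚ.≤-trans (ℚ.≤-reflexive (ℚ.+-assoc (inv (dd i)) _ _)) (ℚ.+-mono-≤
        (inv-dist (subst₂ _<_ (sym (Fin.toℕ-fromℕ< i≤)) (sym toℕ-x) (s≤s i<m)) (dist≤dd i i<m (Fin.toℕ-fromℕ< i≤)))
        (sum-below i (<⇒≤ i≤) (<⇒≤ i<m)))

    -- Walks along the branches and through the centre bound the distances from above; as `inv`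
    -- decreases, this bounds the contribution from below.
    newLeaf≤ : newLeaf c m ≤ℚ sumOver (w (fromℕ< m<N)) (below (suc m) (<⇒≤ m<N))
    newLeaf≤ = ℚ.≤-trans (ℚ.≤-reflexive (sym total)) (sum-below m (<⇒≤ m<N) ≤-refl)
      where
      open ≡-Reasoning
      rest : m ∸ h ≡ h * c + r
      rest = begin
        m ∸ h                    ≡⟨ cong (_∸ h) m≡ ⟩
        (h * k + r) ∸ h          ≡⟨ cong (_∸ h) (shuffle h c r) ⟩
        (h * c + r + h) ∸ h      ≡⟨ m+n∸n≡m (h * c + r) h ⟩
        h * c + r                ∎
        where
        shuffle : ∀ h c r → h * (1 + c) + r ≡ h * c + r + h
        shuffle = solve-∀
      X = sumOver inv (down h)
      Y = shifted (suc h) (levels c (h * c + r))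
      total : sumOver inv (dists m) +ℚ inv (suc h) ≡ newLeaf c m
      total = begin
        sumOver inv (dists m) +ℚ inv (suc h)                 ≡⟨ cong (λ z → sumOver inv (dists z) +ℚ inv (suc h)) m≡ ⟩
        sumOver inv (dists (h * k + r)) +ℚ inv (suc h)       ≡⟨ cong (_+ℚ inv (suc h)) (sumOver-↭ inv profile) ⟩
        sumOver inv (down h ++ map (suc h +_) (levels c (h * c + r))) +ℚ inv (suc h)
          ≡⟨ cong (_+ℚ inv (suc h)) (Eq.trans (sumOver-++ inv (down h) _) (cong (X +ℚ_) (sumOver-map inv (suc h +_) (levels c (h * c + r))))) ⟩
        (X +ℚ Y) +ℚ inv (suc h)                              ≡⟨ ℚ.+-comm (X +ℚ Y) _ ⟩
        inv (suc h) +ℚ (X +ℚ Y)                              ≡⟨ ℚ.+-assoc (inv (suc h)) X Y ⟨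
        (inv (suc h) +ℚ X) +ℚ Y                              ≡⟨ cong (λ z → (inv (suc h) +ℚ X) +ℚ shifted (suc h) (levels c z)) (sym rest) ⟩
        newLeaf c m                                          ∎

  balanced≤pairSum : ∀ i i≤ → balanced c i ≤ℚ pairSum w (below (suc i) i≤)
  balanced≤pairSum zero    i≤ = ℚ.≤-reflexive (sym (ℚ.+-identityʳ 0ℚ))
  balanced≤pairSum (suc i) i≤ = ℚ.+-mono-≤ (balanced≤pairSum i (<⇒≤ i≤)) (newLeaf≤ i i≤)

  balanced≤harary : balanced c N ≤ℚ harary G
  balanced≤harary = ℚ.≤-trans (balanced≤pairSum N ≤-refl) (ℚ.≤-reflexive (sym (allPairs≡pairSum w
    (λ x y → cong inv (Tree.dist-sym G G-tree (Tree.decompose G G-tree zero) x y)) (below-unique n ≤-refl) below-complete)))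

-- Vertices of degree two in `BS`

module BalancedDegrees (N c : ℕ) (2≤c : 2 ≤ c) (c<N : c < N) where

  open Balanced N c
  open Tree G G-tree using (Leaf; degree-≥; degree-exact; leaf-degree)

  private
    two : V → ℕ
    two x = ind (degree G x ≡ᵇ 2)

    parentOf : ∀ (y : V) {t} → toℕ y ≡ suc t → ∃ λ z → BSParent k (toℕ z) (toℕ y)
    parentOf y {t} py with pos-split t
    ... | zero  , b , b< , eq = zero , centre-edge {x = y} b b< (Eq.trans py eq)
    ... | suc e , b , b< , eq = fromℕ< z< , inj₂ (subst (1 ≤_) (sym pz) (s≤s z≤n) , Eq.trans (cong (_+ k) pz) step)
      where
      step : pos e b + k ≡ toℕ y
      step = Eq.trans (pos-suc e b) (sym (Eq.trans py eq))
      z< : pos e b < n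
      z< = <-trans (subst (pos e b <_) step (m<m+n _ (s≤s z≤n))) (Fin.toℕ<n y)
      pz : toℕ (fromℕ< z<) ≡ pos e b
      pz = Fin.toℕ-fromℕ< z<

    child : ∀ {y a : V} {t} → toℕ y ≡ suc t → BSParent k (toℕ y) (toℕ a) → toℕ a ≡ toℕ y + k
    child py (inj₁ (e , _)) = contradiction (Eq.trans (sym e) py) 0≢1+n
    child py (inj₂ (_ , e)) = sym e

    two-inner : ∀ {y t} → toℕ y ≡ suc t → suc t + k ≤ N → two y ≡ 1
    two-inner {y} {t} py le with parentOf y py
    ... | p , pp = cong (λ z → ind (z ≡ᵇ 2)) (degree-exact {y} {p ∷ ch ∷ []} ((p≢ch ∷ []) ∷ [] ∷ [])
            (BS⁺ {n} {k} {y} {p} (inj₂ pp) ∷ BS⁺ {n} {k} {y} {ch} (inj₁ pch) ∷ []) only)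
      where
      ch : V
      ch = fromℕ< (s≤s le)
      toℕ-ch : toℕ ch ≡ toℕ y + k
      toℕ-ch = Eq.trans (Fin.toℕ-fromℕ< (s≤s le)) (cong (_+ k) (sym py))
      pch : BSParent k (toℕ y) (toℕ ch)
      pch = inj₂ (subst (1 ≤_) (sym py) (s≤s z≤n) , sym toℕ-ch)
      p≢ch : p ≢ ch
      p≢ch e = <⇒≢ (<-trans (BSParent-< {k} (s≤s z≤n) pp) (BSParent-< {k} (s≤s z≤n) pch)) (cong toℕ e)
      only : ∀ {a} → G y a ≡ true → a ∈ p ∷ ch ∷ []
      only {a} e with BS⁻ {n} {k} {y} {a} e
      ... | inj₁ q = there (here (Fin.toℕ-injective (Eq.trans (child {y} {a} py q) (sym toℕ-ch))))
      ... | inj₂ q = here (Fin.toℕ-injective (BSParent-unique q pp))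

    two-end : ∀ {y t} → toℕ y ≡ suc t → N < suc t + k → two y ≡ 0
    two-end {y} {t} py gt with parentOf y py
    ... | p , pp = cong (λ z → ind (z ≡ᵇ 2)) (leaf-degree {y} {p} leaf (BS⁺ {n} {k} {y} {p} (inj₂ pp)))
      where
      is-parent : ∀ {a} → G y a ≡ true → BSParent k (toℕ a) (toℕ y)
      is-parent {a} e with BS⁻ {n} {k} {y} {a} e
      ... | inj₂ q = q
      ... | inj₁ q = contradiction (subst (_< n) (Eq.trans (child {y} {a} py q) (cong (_+ k) py)) (Fin.toℕ<n a)) (≤⇒≯ gt)
      leaf : Leaf y
      leaf {a} {b} ya yb = Fin.toℕ-injective (BSParent-unique (is-parent {a} ya) (is-parent {b} yb))

    two-centre : two zero ≡ 0
    two-centre = ind-≡ᵇ-≢ λ e → contradiction (≤-trans three (≤-reflexive e)) λ { (s≤s (s≤s ())) }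
      where
      v : ∀ i → i ≤ 3 → V
      v i le = fromℕ< (s≤s (≤-trans le (≤-trans (s≤s 2≤c) c<N)))
      edge : ∀ i le → 1 ≤ i → G zero (v i le) ≡ true
      edge i le 1≤i = BS⁺ {n} {k} {zero} {v i le} (inj₁ (inj₁ (refl , subst (1 ≤_) (sym toℕ-v) 1≤i , subst (_≤ k) (sym toℕ-v) (≤-trans le (s≤s 2≤c)))))
        where
        toℕ-v : toℕ (v i le) ≡ i
        toℕ-v = Fin.toℕ-fromℕ< _
      v-≢ : ∀ i j p q → i ≢ j → v i p ≢ v j q
      v-≢ i j p q ne e = ne (Eq.trans (sym (Fin.toℕ-fromℕ< _)) (Eq.trans (cong toℕ e) (Fin.toℕ-fromℕ< _)))
      1≤3 : 1 ≤ 3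
      1≤3 = s≤s z≤n
      2≤3 : 2 ≤ 3
      2≤3 = s≤s (s≤s z≤n)
      three : 3 ≤ degree G zero
      three = degree-≥ {zero} {v 1 1≤3 ∷ v 2 2≤3 ∷ v 3 ≤-refl ∷ []}
        ((v-≢ 1 2 1≤3 2≤3 (λ ()) ∷ v-≢ 1 3 1≤3 ≤-refl (λ ()) ∷ []) ∷ (v-≢ 2 3 2≤3 ≤-refl (λ ()) ∷ []) ∷ [] ∷ [])
        (edge 1 1≤3 (s≤s z≤n) ∷ edge 2 2≤3 (s≤s z≤n) ∷ edge 3 ≤-refl (s≤s z≤n) ∷ [])

    -- Vertex i ≥ 1 has degree two exactly when its successor i + k exists, that is for i ≤ `N ∸ k`;
    -- the centre has degree at least three.
    sum-two : ∀ i i≤ → sumN two (below (suc i) i≤) ≡ i ⊓ (N ∸ k)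
    sum-two zero    i≤ = cong (_+ 0) two-centre
    sum-two (suc i) i≤ with suc i + k ≤? N
    ... | yes le = begin
      two x + sumN two (below (suc i) (<⇒≤ i≤))  ≡⟨ cong₂ _+_ (two-inner px le) (sum-two i (<⇒≤ i≤)) ⟩
      suc (i ⊓ (N ∸ k))                          ≡⟨ cong suc (m≤n⇒m⊓n≡m (≤-trans (n≤1+n i) i<)) ⟩
      suc i                                      ≡⟨ m≤n⇒m⊓n≡m i< ⟨
      suc i ⊓ (N ∸ k)                            ∎
      where
      open ≡-Reasoning
      x = fromℕ< i≤
      px = Fin.toℕ-fromℕ< i≤
      i< : suc i ≤ N ∸ k
      i< = m+n≤o⇒m≤o∸n (suc i) le
    ... | no ≰   = begin
      two x + sumN two (below (suc i) (<⇒≤ i≤))  ≡⟨ cong₂ _+_ (two-end px (≰⇒> ≰)) (sum-two i (<⇒≤ i≤)) ⟩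
      i ⊓ (N ∸ k)                                ≡⟨ m≥n⇒m⊓n≡n N∸k≤i ⟩
      N ∸ k                                      ≡⟨ m≥n⇒m⊓n≡n (≤-trans N∸k≤i (n≤1+n i)) ⟨
      suc i ⊓ (N ∸ k)                            ∎
      where
      open ≡-Reasoning
      x = fromℕ< i≤
      px = Fin.toℕ-fromℕ< i≤
      N∸k≤i : N ∸ k ≤ i
      N∸k≤i = m≤n+o⇒m∸n≤o N k (≤-trans (≤-pred (≰⇒> ≰)) (≤-reflexive (+-comm i k)))

  numDeg2-BS : numDeg2 G ≡ N ∸ k
  numDeg2-BS = Eq.trans (sumN-↭ two (↭-sym (complete⇒↭allFin (below-unique n ≤-refl) below-complete)))
    (Eq.trans (sum-two N ≤-refl) (m≥n⇒m⊓n≡n (m∸n≤m N k)))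

-- The upper bound and the extremal tree

module UpperBound {n : ℕ} (N c q : ℕ) (n≡ : n ≡ suc (suc N)) (N≡ : suc (suc c) + q ≡ suc N) (1≤c : 1 ≤ c)
  (T : Graph n) (tree : IsTree T) (deg2 : numDeg2 T ≡ q) where

  open Tree T tree
  open Degrees T tree (subst (2 ≤_) (sym n≡) (s≤s (s≤s z≤n)))
  open Spider inv inv-anti using (balanced)

  private
    k : ℕ
    k = suc (suc c)

    c<N : suc c ≤ N
    c<N = ≤-trans (m≤m+n (suc c) q) (≤-reflexive (suc-injective N≡))

    ρ : V
    ρ = proj₁ someLeaf

    dec : Decomposition ρ
    dec = decompose ρ

    open Decomposition dec

    module M = R dec
    open M.Energy inv inv-anti

    q+4≤n : q + 4 ≤ n
    q+4≤n = ≤-trans (≤-reflexive (+-comm q 4)) (≤-trans (s≤s (s≤s (s≤s (+-monoˡ-≤ q 1≤c)))) (≤-reflexive (Eq.trans (cong suc N≡) (sym n≡))))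

    j≤ : j ≤ suc c
    j≤ = +-cancelʳ-≤ (suc q) j (suc c) (≤-pred (begin
      suc j + suc q           ≡⟨ cong (λ z → suc j + suc z) deg2 ⟨
      suc j + suc (numDeg2 T) ≤⟨ runs-bound (proj₂ someLeaf) dec (≤-trans (≤-reflexive (cong (_+ 4) deg2)) q+4≤n) ⟩
      n                       ≡⟨ n≡ ⟩
      suc (suc N)             ≡⟨ cong suc N≡ ⟨
      suc (suc (suc c) + q)   ≡⟨ cong suc (+-suc (suc c) q) ⟨
      suc (suc c + suc q)     ∎))
      where open ≤-Reasoning

    -- A tree with fewer than k leaves has fewer than k - 1 runs; empty paths raise their number to
    -- `suc c`, which is k - 1.
    pad : ∀ {i B} m → M.Runs ρ i B → (∃ λ u → u ∈ B) → M.Runs ρ (m + i) B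
    pad zero    rs _           = rs
    pad (suc m) rs ne@(u , u∈) = M.run (pad m rs ne) u∈ M.[]

    padded : M.Runs ρ (suc c) A
    padded = subst (λ z → M.Runs ρ z A) (m∸n+n≡m j≤) (pad (suc c ∸ j) (metricRuns dec) (ρ , complete ρ))

    length≡ : length A ≡ suc (suc N)
    length≡ = Eq.trans (length-A dec) n≡

  harary≤balanced : harary T ≤ℚ balanced (suc c) (suc N)
  harary≤balanced = ℚ.≤-trans (ℚ.≤-reflexive (harary≡ dec)) (energy≤ padded length≡)

  balanced-unique : balanced (suc c) (suc N) ≤ℚ harary T → T ≅ BS n k
  balanced-unique le = Numbering.isomorphic n≡ T tree centre (suc c) h
      (others-degree {centre} {k} (Eq.trans (degree≡cnt dec centre) degree≡) (s≤s (s≤s 1≤c)) (Eq.trans (cong (λ z → suc (k + z)) deg2) (Eq.trans (cong suc N≡) (sym n≡))))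
      (λ x → depth≤ (complete x))
      (Eq.trans (toAll 1) degree≡)
      (≤-trans (≤-reflexive (cong (_+ h * k) (toAll (suc h)))) bottom≤)
    where
    open BalancedCentre (energy≡⇒centre padded 1≤c c<N length≡
      (ℚ.≤-antisym (energy≤ padded length≡) (ℚ.≤-trans le (ℚ.≤-reflexive (harary≡ dec)))))
    toAll : ∀ v → cnt v (map (dist T centre) (allFin n)) ≡ cnt v (map (dist T centre) A)
    toAll v = cnt-↭ v (Perm.map⁺ (dist T centre) (↭-sym (complete⇒↭allFin (grown-unique (runs-grown runs)) complete)))

-- n stays a variable in these types so that the enumerations of Fin n do not unfold.
balanced≤harary-BS : ∀ {n} N c → n ≡ suc N → Spider.balanced inv inv-anti c N ≤ℚ harary (BS n (suc c))
balanced≤harary-BS N c refl = BalancedHarary.balanced≤harary N c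

BS-tree : ∀ {n} N c → n ≡ suc N → IsTree (BS n (suc c))
BS-tree N c refl = Balanced.G-tree N c

BS-numDeg2 : ∀ {n} N c → n ≡ suc N → 2 ≤ c → c < N → numDeg2 (BS n (suc c)) ≡ N ∸ suc c
BS-numDeg2 N c refl 2≤c c<N = BalancedDegrees.numDeg2-BS N c 2≤c c<N

theorem3p2 : (n q : ℕ) → q + 4 ≤ n →
    (IsTree (BS n (n ∸ 1 ∸ q)) × numDeg2 (BS n (n ∸ 1 ∸ q)) ≡ q) ×
    ((T : Graph n) → IsTree T → numDeg2 T ≡ q →
    (harary T ≤ℚ harary (BS n (n ∸ 1 ∸ q))) ×
    (harary T ≡ harary (BS n (n ∸ 1 ∸ q)) → T ≅ BS n (n ∸ 1 ∸ q)))
theorem3p2 n q le = subst Extremal (sym k≡) extremal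
  where
  o N c : ℕ
  -- The slack in q + 4 ≤ n: with n = 4 + o + q, the number of branches is 3 + o, hence c is k - 2
  -- and N is n - 2.
  o = proj₁ (m≤n⇒∃[o]m+o≡n le)
  N = 2 + o + q
  c = 1 + o
  n≡ : n ≡ suc (suc N)
  n≡ = Eq.trans (sym (proj₂ (m≤n⇒∃[o]m+o≡n le))) (shuffle o q)
    where
    shuffle : ∀ o q → q + 4 + o ≡ 4 + (o + q)
    shuffle = solve-∀
  k≡ : n ∸ 1 ∸ q ≡ suc (suc c)
  k≡ = Eq.trans (cong (λ z → z ∸ 1 ∸ q) n≡) (m+n∸n≡m (3 + o) q)
  Extremal : ℕ → Set
  Extremal k = (IsTree (BS n k) × numDeg2 (BS n k) ≡ q) ×
    ((T : Graph n) → IsTree T → numDeg2 T ≡ q → (harary T ≤ℚ harary (BS n k)) × (harary T ≡ harary (BS n k) → T ≅ BS n k))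
  lower : Spider.balanced inv inv-anti (suc c) (suc N) ≤ℚ harary (BS n (suc (suc c)))
  lower = balanced≤harary-BS (suc N) (suc c) n≡
  extremal : Extremal (suc (suc c))
  extremal =
    (BS-tree (suc N) (suc c) n≡ ,
     Eq.trans (BS-numDeg2 (suc N) (suc c) n≡ (s≤s (s≤s z≤n)) (s≤s (s≤s (s≤s (m≤m+n o q))))) (m+n∸m≡n (3 + o) q)) ,
    λ T tree deg2 → let open UpperBound N c q n≡ refl (s≤s z≤n) T tree deg2 in
      ℚ.≤-trans harary≤balanced lower ,
      λ eq → balanced-unique (ℚ.≤-trans lower (ℚ.≤-reflexive (sym eq)))
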